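{- Let $k\ge2$. (1) For all positive integers $n,p_1,\ldots,p_k$, the valid biddings of size $n$ and type $(p_1,\ldots,p_k)$ are in $n!$-to-1 correspondence with the disjoint union $\mathcal{C}^n_{p_1+1,p_2,\ldots,p_k}\cup\mathcal{C}^n_{p_1,p_2+1,\ldots,p_k}\cup\cdots\cup\mathcal{C}^n_{p_1,p_2,\ldots,p_k+1}$; that is, the number of valid biddings of size $n$ and type $(p_1,\ldots,p_k)$ is $n!$ times the cardinality of this disjoint union. (2) Consequently, the following two statements (for the given $k$) are equivalent: (a) for all positive integers $n,p_1,\ldots,p_k$, the number of $(p_1,\ldots,p_k)$-colored factorizations of $(1,2,\ldots,n)$ is $(n!)^{k-1}M^{n-1}_{p_1-1,\ldots,p_k-1}$; (b) for all positive integers $n,p_1,\ldots,p_k$ with $\mathcal{M}^n_{p_1,\ldots,p_k}\neq\emptyset$, if $B=((i_1,\ldots,i_{k-1}),(R_1,\ldots,R_n))$ is uniformly distributed in $[n]^{k-1}\times\mathcal{M}^n_{p_1,\ldots,p_k}$, then the probability that the graph $\alpha(B)$ is a tree equals the probability that $R_1$ has cardinality $k-1$.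
   Context: $[m]=\{1,\ldots,m\}$. $\mathcal{M}^m_{q_1,\ldots,q_k}$ is the set of $m$-tuples $(R_1,\ldots,R_m)$ of strict subsets of $[k]$ such that each $t\in[k]$ belongs to exactly $q_t$ of the subsets; $M^m_{q_1,\ldots,q_k}$ is its cardinality, equal to the coefficient of $x_1^{q_1}\cdots x_k^{q_k}$ in $\left(\prod_{i=1}^k(1+x_i)-\prod_{i=1}^kx_i\right)^m$. For $t\in[k]$, $R\subsetneq[k]$, $\alpha(t,R)\in[k]$ is defined (modulo $k$) as $t-1$ if $t\in R$, and as $t+r$ if $t\notin R$, where $r\ge0$ is such that $t+1,\ldots,t+r\in R$ and $t+r+1\notin R$. For $i_1,\ldots,i_{k-1}\in[n]$, $\alpha((i_1,\ldots,i_{k-1}),(R_1,\ldots,R_n))$ is the undirected graph (loops, multiple edges allowed) with vertex set $[k]$ and edges $e_1,\ldots,e_{k-1}$, where $e_t=\{t,\alpha(t,R_{i_t})\}$. A bidding of size $n$ and type $(p_1,\ldots,p_k)$ is a pair $((\omega_1,\ldots,\omega_k),(R_1,\ldots,R_n))$ with $\omega_1,\ldots,\omega_k$ permutations of $[n]$ and $(R_1,\ldots,R_n)\in\mathcal{M}^n_{p_1,\ldots,p_k}$; it is valid if the graph $\alpha((\omega_1(n),\ldots,\omega_{k-1}(n)),(R_1,\ldots,R_n))$ is a tree. A $(p_1,\ldots,p_k)$-colored factorization of $(1,2,\ldots,n)$ is a tuple $(\pi_1,\ldots,\pi_k,\phi_1,\ldots,\phi_k)$ where $\pi_1,\ldots,\pi_k$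 are permutations of $[n]$ with $\pi_1\circ\cdots\circ\pi_k=(1,2,\ldots,n)$ and each $\phi_t:[n]\to[p_t]$ is surjective and constant on the cycles of $\pi_t$. $\mathcal{C}^n_{p_1,\ldots,p_k}$ is the set of $(p_1,\ldots,p_k)$-colored rooted $k$-cacti of size $n$, which are in bijection with the $(p_1,\ldots,p_k)$-colored factorizations of $(1,2,\ldots,n)$. Here a $k$-constellation is a cellular embedding of a connected graph in an oriented closed connected surface, up to orientation preserving homeomorphism, with black and white faces and vertices of types $1,\ldots,k$, each edge separating a black and a white face, each black face (hyperedge) having degree $k$ and being incident to vertices of type $1,\ldots,k$ in clockwise order; the size is the number of hyperedges; it is rooted if one hyperedge is distinguished; a $k$-cactus is a $k$-constellation with exactly one white face; and it is $(p_1,\ldots,p_k)$-colored if for each $t$ the vertices of type $t$ are colored using every color in $[p_t]$. -}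

module Defs where

open import Data.Bool.Base using (if_then_else_)
open import Data.Fin.Base using (Fin; toℕ; inject≤)
open import Data.Fin.Permutation using (Permutation′; _⟨$⟩ʳ_; _⟨$⟩ˡ_; inverseʳ)
  renaming (_≈_ to _≈ₚ_; id to idₚ; flip to flipₚ; _∘ₚ_ to _⨾ₚ_)
open import Data.Fin.Properties using (toℕ-fromℕ<; toℕ-injective; toℕ<n)
open import Data.Fin.Subset using (Subset; _∈_; _∉_; _⊂_; ⊤; ∣_∣)
open import Data.Fin.Subset.Properties using (_∈?_)
open import Data.Integer.Base using (+_)
open import Data.List.Base using (List; []; _∷_)
open import Data.List.Relation.Unary.Unique.Propositional using (Unique)
open import Data.Nat.Base
  using (ℕ; zero; suc; pred; _+_; _≤_; NonZero; s≤s; z<s)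
open import Data.Nat.DivMod using (_mod_; m<n⇒m%n≡m; [m+n]%n≡m%n; m%n<n)
open import Data.Nat.Properties
  using (pred[n]≤n; ≤-refl; m≤n⇒m<n∨m≡n; +-suc; +-identityʳ)
open import Data.Product.Base using (Σ; ∃-syntax; _×_; _,_; proj₁; proj₂)
open import Data.Product.Relation.Binary.Pointwise.NonDependent using (×-setoid)
open import Data.Rational.Base using (ℚ; _/_)
open import Data.Sum.Base using (_⊎_; inj₁; inj₂)
open import Data.Vec.Base using (tabulate; lookup)
open import Data.Vec.Functional using (Vector; foldr; updateAt)
open import Data.Vec.Functional.Relation.Binary.Equality.Setoid using (≋-setoid)
open import Function.Base using (_∘_; _∘′_; id)
open import Function.Bundles using (Inverse)
open import Function.Definitions using (Surjective)
import Function.Endo.Propositional as Endo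
open import Level using (0ℓ)
open import Relation.Binary.Bundles using (Setoid)
open import Relation.Binary.Construct.Closure.Equivalence using (EqClosure)
import Relation.Binary.Construct.On as On
open import Relation.Binary.PropositionalEquality
  using (_≡_; _≢_; refl; sym; trans; cong; subst) renaming (setoid to ≡-setoid)
open import Relation.Nullary using (¬_; does; yes; no; contradiction)

-- Sets are setoids, so that proof components are ignored and objects can
-- be counted up to isomorphism.
_HasSize_ : Setoid 0ℓ 0ℓ → ℕ → Set
S HasSize N = Inverse S (≡-setoid (Fin N))

infix 4 _HasSize_

Sub : (S : Setoid 0ℓ 0ℓ) → (Setoid.Carrier S → Set) → Setoid 0ℓ 0ℓ
Sub S P = On.setoid {B = Σ (Setoid.Carrier S) P} S proj₁

module _ {I : Set} (S : I → Setoid 0ℓ 0ℓ) where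

  data _≈⨆_ : (x y : Σ I (Setoid.Carrier ∘ S)) → Set where
    same : ∀ {i x y} → Setoid._≈_ (S i) x y → (i , x) ≈⨆ (i , y)

  ⨆ : Setoid 0ℓ 0ℓ
  ⨆ = record
    { Carrier       = Σ I (Setoid.Carrier ∘ S)
    ; _≈_           = _≈⨆_
    ; isEquivalence = record
      { refl  = λ { {i , _} → same (Setoid.refl (S i)) }
      ; sym   = λ { (same {i} e) → same (Setoid.sym (S i) e) }
      ; trans = λ { (same {i} e) (same f) → same (Setoid.trans (S i) e f) }
      }
    }

-- The event E has probability q under the uniform distribution on the
-- finite nonempty set S.
record Probability (S : Setoid 0ℓ 0ℓ) (E : Setoid.Carrier S → Set) (q : ℚ) : Set where
  field
    favourable total   : ℕ
    {{total-nonZero}}  : NonZero total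
    favourable-size    : Sub S E HasSize favourable
    total-size         : S HasSize total
    ratio              : q ≡ + favourable / total

record Multigraph : Set where
  field
    vertices edges : ℕ
    ends           : Fin edges → Fin vertices × Fin vertices

module _ (G : Multigraph) where
  open Multigraph G

  Joins : Fin edges → Fin vertices → Fin vertices → Set
  Joins e u v = ends e ≡ (u , v) ⊎ ends e ≡ (v , u)

  data Walk : Fin vertices → Fin vertices → Set where
    stop : ∀ {u} → Walk u u
    step : ∀ {u v w} (e : Fin edges) → Joins e u v → Walk v w → Walk u w

  walkEdges : ∀ {u v} → Walk u v → List (Fin edges)
  walkEdges stop         = []
  walkEdges (step e _ w) = e ∷ walkEdges w

  -- All the vertices visited by the walk, except for the final one.
  walkVertices : ∀ {u v} → Walk u v → List (Fin vertices)
  walkVertices stop               = []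
  walkVertices (step {u = u} _ _ w) = u ∷ walkVertices w

  -- A loop is a cycle of length 1 and a pair of parallel edges is a cycle
  -- of length 2.
  IsCycle : ∀ {u} → Walk u u → Set
  IsCycle w = walkEdges w ≢ [] × Unique (walkEdges w) × Unique (walkVertices w)

  IsTree : Set
  IsTree = (∀ u v → Walk u v) × (∀ {u} (w : Walk u u) → ¬ IsCycle w)

SameOrbit : {A : Set} → (A → A) → A → A → Set
SameOrbit {A} f x y = ∃[ m ] (f ^ m) x ≡ y
  where open Endo A using (_^_)

Permutations : ℕ → Setoid 0ℓ 0ℓ
Permutations n = record
  { Carrier       = Permutation′ n
  ; _≈_           = _≈ₚ_
  ; isEquivalence = record
    { refl  = λ _ → refl
    ; sym   = λ e i → sym (e i)
    ; trans = λ e f i → trans (e i) (f i)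
    }
  }

IsColoring : ∀ {n p} → Permutation′ n → (Fin n → Fin p) → Set
IsColoring π φ =
    (∀ i j → SameOrbit (π ⟨$⟩ʳ_) i j → φ i ≡ φ j)
  × Surjective _≡_ _≡_ φ

compose : ∀ {k n} → Vector (Permutation′ n) k → Fin n → Fin n
compose π = foldr _∘′_ id (λ t → π t ⟨$⟩ʳ_)

longCycle : ∀ {n} → .{{_ : NonZero n}} → Fin n → Fin n
longCycle {n} i = suc (toℕ i) mod n

record ColoredFactorization {k} n .{{_ : NonZero n}} (p : Vector ℕ k) : Set where
  field
    π       : Vector (Permutation′ n) k
    φ       : ∀ t → Fin n → Fin (p t)
    product : ∀ i → compose π i ≡ longCycle i
    colored : ∀ t → IsColoring (π t) (φ t)

ColoredFactorizations : ∀ {k} n → .{{_ : NonZero n}} → Vector ℕ k → Setoid 0ℓ 0ℓ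
ColoredFactorizations n p = record
  { Carrier       = ColoredFactorization n p
  ; _≈_           = λ F F′ → (∀ t → π F t ≈ₚ π F′ t) × (∀ t i → φ F t i ≡ φ F′ t i)
  ; isEquivalence = record
    { refl  = (λ _ _ → refl) , (λ _ _ → refl)
    ; sym   = λ (e , f) → (λ t i → sym (e t i)) , (λ t i → sym (f t i))
    ; trans = λ (e , f) (e′ , f′) →
        (λ t i → trans (e t i) (e′ t i)) , (λ t i → trans (f t i) (f′ t i))
    }
  }
  where open ColoredFactorization

record 𝓜 {k} (m : ℕ) (q : Vector ℕ k) : Set where
  field
    tuple        : Vector (Subset k) m
    strict       : ∀ i → tuple i ⊂ ⊤
    -- The set of the indices i such that t ∈ tuple i.
    multiplicity : ∀ t → ∣ tabulate (λ i → lookup (tuple i) t) ∣ ≡ q t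

open 𝓜 public using (tuple)

𝓜s : ∀ {k} → ℕ → Vector ℕ k → Setoid 0ℓ 0ℓ
𝓜s {k} m q = On.setoid {B = 𝓜 m q} (≋-setoid (≡-setoid (Subset k)) m) tuple

module _ {k : ℕ} .{{k≢0 : NonZero k}} where

  infixl 6 _⊕_

  _⊕_ : Fin k → ℕ → Fin k
  t ⊕ j = (toℕ t + j) mod k

  predecessor : Fin k → Fin k
  predecessor t = t ⊕ pred k

  -- The least r ≥ j such that t + r + 1 ∉ R, looked for among the first
  -- `fuel` candidates.
  search : Subset k → Fin k → (fuel j : ℕ) → ℕ
  search R t zero       j = j
  search R t (suc fuel) j =
    if does (t ⊕ suc j ∈? R) then search R t fuel (suc j) else j

  -- If t ∉ R then k candidates are enough: see α-∉.
  α : Fin k → Subset k → Fin k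
  α t R = if does (t ∈? R) then predecessor t else t ⊕ search R t k 0

  private
    InRun : Subset k → Fin k → ℕ → Set
    InRun R t r = ∀ i → 1 ≤ i → i ≤ r → t ⊕ i ∈ R

    ⊕-k : ∀ t → t ⊕ k ≡ t
    ⊕-k t = toℕ-injective (trans (toℕ-fromℕ< (m%n<n (toℕ t + k) k))
              (trans ([m+n]%n≡m%n (toℕ t) k) (m<n⇒m%n≡m (toℕ<n t))))

    search-spec : ∀ R t fuel j → 1 ≤ fuel + j → t ⊕ (fuel + j) ∉ R → InRun R t j →
                  InRun R t (search R t fuel j) × t ⊕ suc (search R t fuel j) ∉ R
    search-spec R t zero    j pos out run = contradiction (run j pos ≤-refl) out
    search-spec R t (suc f) j pos out run with t ⊕ suc j ∈? R
    ... | no  ∉R = run , ∉R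
    ... | yes ∈R = search-spec R t f (suc j)
                     (subst (1 ≤_) (sym (+-suc f j)) pos)
                     (subst (λ x → t ⊕ x ∉ R) (sym (+-suc f j)) out)
                     run′
      where
      run′ : InRun R t (suc j)
      run′ i 1≤i i≤1+j with m≤n⇒m<n∨m≡n i≤1+j
      ... | inj₁ (s≤s i≤j) = run i 1≤i i≤j
      ... | inj₂ refl      = ∈R

    positive : ∀ m → .{{NonZero m}} → 1 ≤ m + 0
    positive (suc _) = z<s

  α-∈ : ∀ {t R} → t ∈ R → α t R ≡ predecessor t
  α-∈ {t} {R} t∈R with t ∈? R
  ... | yes _   = refl
  ... | no  t∉R = contradiction t∈R t∉R

  α-∉ : ∀ {t R} → t ∉ R →
        ∃[ r ] (∀ i → 1 ≤ i → i ≤ r → t ⊕ i ∈ R) × t ⊕ suc r ∉ R × α t R ≡ t ⊕ r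
  α-∉ {t} {R} t∉R with t ∈? R
  ... | yes t∈R = contradiction t∈R t∉R
  ... | no  _   with run , out ← search-spec R t k 0 (positive k)
                       (subst (_∉ R) (sym (trans (cong (t ⊕_) (+-identityʳ k)) (⊕-k t))) t∉R)
                       (λ { (suc _) _ () })
                = search R t k 0 , run , out , refl

  embed : Fin (pred k) → Fin k
  embed t = inject≤ t pred[n]≤n

  αGraph : ∀ {n} → Vector (Fin n) (pred k) → Vector (Subset k) n → Multigraph
  αGraph i R = record
    { vertices = k
    ; edges    = pred k
    ; ends     = λ t → embed t , α (embed t) (R (i t))
    }

  Biddings : ℕ → Vector ℕ k → Setoid 0ℓ 0ℓ
  Biddings n p = ×-setoid (≋-setoid (Permutations n) k) (𝓜s n p)

  Valid : ∀ {n p} → .{{_ : NonZero n}} → Setoid.Carrier (Biddings n p) → Set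
  Valid {n} (ω , R) = IsTree (αGraph (λ t → ω (embed t) ⟨$⟩ʳ last) (tuple R))
    where
    last : Fin n
    last = pred n mod n

  ValidBiddings : ∀ n → .{{_ : NonZero n}} → Vector ℕ k → Setoid 0ℓ 0ℓ
  ValidBiddings n p = Sub (Biddings n p) Valid

  Samples : ℕ → Vector ℕ k → Setoid 0ℓ 0ℓ
  Samples n p = ×-setoid (≋-setoid (≡-setoid (Fin n)) (pred k)) (𝓜s n p)

  TreeEvent : ∀ {n p} → Setoid.Carrier (Samples n p) → Set
  TreeEvent (i , R) = IsTree (αGraph i (tuple R))

  FirstSubsetEvent : ∀ {n p} → .{{_ : NonZero n}} → Setoid.Carrier (Samples n p) → Set
  FirstSubsetEvent {n} (i , R) = ∣ tuple R (0 mod n) ∣ ≡ pred k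

  -- Embeddings in oriented surfaces up to orientation preserving
  -- homeomorphism are given by rotation systems.  The hyperedges (black
  -- k-gons) are labelled by Fin n.  Each has one corner of each type, so a
  -- vertex of type t is given by the hyperedges around it, and rotation t
  -- maps a hyperedge to the next one in counterclockwise order around its
  -- vertex of type t: the vertices of type t are the cycles of rotation t.
  record Constellation (n : ℕ) : Set where
    field
      rotation : Vector (Permutation′ n) k

    Incident : Fin n → Fin n → Set
    Incident h h′ = ∃[ t ] rotation t ⟨$⟩ʳ h ≡ h′

    field
      connected : ∀ h h′ → EqClosure Incident h h′

    -- (h , t) is the edge of the hyperedge h from its vertex of type t to
    -- its vertex of type t+1.  It has the black face h on one side and a
    -- white face on the other.
    Edge : Set
    Edge = Fin n × Fin k

    -- Walk along the white face from the endpoint of type t+1 of (h , t) to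
    -- the one of type t.  Since the types increase clockwise around
    -- hyperedges, the white face is on the right, and the next edge of its
    -- boundary belongs to the next hyperedge in counterclockwise order
    -- around that vertex, and leads to a vertex of type t-1.
    nextOnWhiteFace : Edge → Edge
    nextOnWhiteFace (h , t) = rotation t ⟨$⟩ʳ h , predecessor t

    OneWhiteFace : Set
    OneWhiteFace = ∀ e e′ → SameOrbit nextOnWhiteFace e e′

  record ColoredRootedCactus (n : ℕ) (p : Vector ℕ k) : Set where
    field
      constellation : Constellation n
    open Constellation constellation public
    field
      oneWhiteFace : OneWhiteFace
      root         : Fin n
      -- color t h is the color of the vertex of type t of h.
      color        : ∀ t → Fin n → Fin (p t)
      colored      : ∀ t → IsColoring (rotation t) (color t)

  module _ {n : ℕ} {p : Vector ℕ k} where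
    open ColoredRootedCactus

    record _≅_ (C D : ColoredRootedCactus n p) : Set where
      field
        relabel  : Permutation′ n
        rotation≅ : ∀ t h → relabel ⟨$⟩ʳ (rotation C t ⟨$⟩ʳ h) ≡ rotation D t ⟨$⟩ʳ (relabel ⟨$⟩ʳ h)
        root≅     : relabel ⟨$⟩ʳ root C ≡ root D
        color≅    : ∀ t h → color C t h ≡ color D t (relabel ⟨$⟩ʳ h)

    private
      open _≅_

      ≅-refl : ∀ {C} → C ≅ C
      ≅-refl = record
        { relabel = idₚ ; rotation≅ = λ _ _ → refl ; root≅ = refl ; color≅ = λ _ _ → refl }

      ≅-sym : ∀ {C D} → C ≅ D → D ≅ C
      ≅-sym {C} {D} f = record
        { relabel   = flipₚ ψ
        ; rotation≅ = λ t h → trans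
            (cong (ψ ⟨$⟩ˡ_) (trans (cong (rotation D t ⟨$⟩ʳ_) (sym (inverseʳ ψ)))
                                   (sym (rotation≅ f t (ψ ⟨$⟩ˡ h)))))
            (Inverse.strictlyInverseʳ ψ _)
        ; root≅     = trans (cong (ψ ⟨$⟩ˡ_) (sym (root≅ f))) (Inverse.strictlyInverseʳ ψ _)
        ; color≅    = λ t h → trans (cong (color D t) (sym (inverseʳ ψ)))
                                    (sym (color≅ f t (ψ ⟨$⟩ˡ h)))
        }
        where
        ψ : Permutation′ n
        ψ = relabel f

      ≅-trans : ∀ {C D E} → C ≅ D → D ≅ E → C ≅ E
      ≅-trans f g = record
        { relabel   = relabel f ⨾ₚ relabel g
        ; rotation≅ = λ t h → trans (cong (relabel g ⟨$⟩ʳ_) (rotation≅ f t h)) (rotation≅ g t _)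
        ; root≅     = trans (cong (relabel g ⟨$⟩ʳ_) (root≅ f)) (root≅ g)
        ; color≅    = λ t h → trans (color≅ f t h) (color≅ g t _)
        }

    ≅-setoid : Setoid 0ℓ 0ℓ
    ≅-setoid = record
      { Carrier       = ColoredRootedCactus n p
      ; _≈_           = _≅_
      ; isEquivalence = record { refl = ≅-refl ; sym = ≅-sym ; trans = ≅-trans }
      }

  𝓒 : ℕ → Vector ℕ k → Setoid 0ℓ 0ℓ
  𝓒 n p = ≅-setoid {n} {p}

  -- The disjoint union of the 𝓒^n_{p_1,…,p_t+1,…,p_k} for t in [k].
  ⨆𝓒 : ℕ → Vector ℕ k → Setoid 0ℓ 0ℓ
  ⨆𝓒 n p = ⨆ (λ t → 𝓒 n (updateAt p t suc))

{-# OPTIONS --safe #-}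

-- A rooted cactus is traversed by its white face, and gluing the vertices
-- of the same colour turns this face into an Eulerian tour of a digraph
-- whose arcs are the pairs (t , h) of a type and a hyperedge, from the
-- colour of the vertex of type t of h to the colour of its vertex of type
-- t-1.  By the BEST theorem, a tour is given by the order in which the arcs
-- leave each vertex, provided that the last arcs form a tree towards the
-- root.  Let R_h be the set of the types t for which (t , h) is such a last
-- arc.  These sets are strict because there is no cycle of last arcs, and t
-- lies in p_t of them if the root has one of the p_t+1 colours of its type
-- and the other types have p_t colours.
--
-- The tree only uses arcs (t , h) with t ∈ R_h, which α(t , R_h) = t-1
-- preserves.  Hence the BEST theorem also applies to the digraph with the
-- arcs from the vertex of type t to the one of type α(t , R_h) of h, with
-- the same orders and the same tree, where the tour is the depth first
-- traversal of the tree.  It can be parsed with a stack after forgetting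
-- the colours, so that it amounts to a tour of the types along
-- t → α(t , R_h), if the starting point is a lowest one: the heights are
-- determined up to a constant, as in the cycle lemma.  Applying the BEST
-- theorem for the last time, to the digraph of the types with root k, the
-- tours of the types become the valid biddings.
--
-- For the second part, let T be the number of pairs ((i_t), (R_h)) that give
-- trees.  Only the last values of the first k-1 permutations matter for the
-- validity of a bidding, so that the first part says that the numbers c of
-- factorizations satisfy Σ_t c_{p+e_t} = ((n-1)!)^(k-1) T_p, and (b)
-- expresses the right hand side by the numbers in (a).  These sums
-- determine c by induction on p_k.  The first part also holds for p_k = 0,
-- where the trees are easy to count, and this starts the induction.

module Submission where

open import Defs
open import Data.Nat.Properties using (+-*-semiring)
open import Algebra.Properties.Semiring.Sum +-*-semiring using (sum; *-distribˡ-sum; sum-cong-≗)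
open import Data.Bool.Base using (Bool; true; false; if_then_else_)
open import Data.Empty using (⊥; ⊥-elim-irr)
open import Data.Fin.Base using (Fin; zero; suc; toℕ; fromℕ; cast; inject₁; punchIn; punchOut)
open import Data.Fin.Permutation using (Permutation′; permutation; _⟨$⟩ʳ_; _⟨$⟩ˡ_; inverseˡ; inverseʳ; remove; insert; ↔⇒≡; punchIn-permute; remove-insert) renaming (_≈_ to _≈ₚ_; flip to flipₚ; _∘ₚ_ to _⨾ₚ_; id to idₚ)
open import Data.Fin.Subset using (Subset; ∣_∣; _∈_; _∉_; ⊤)
open import Data.Fin.Subset.Properties using (_∈?_; ∈⊤; ⊆-antisym; ∣⊤∣≡n; ∣p∣≡n⇒p≡⊤)
open import Data.Integer.Tactic.RingSolver using (solve-∀)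
open import Data.List.Base using (List; []; _∷_; [_]; _++_; length; map; concat; filter; tabulate; lookup; iterate; last; drop; allFin; cartesianProduct)
open import Data.List.Membership.Propositional using () renaming (_∈_ to _∈ₗ_; _∉_ to _∉ₗ_)
open import Data.List.Relation.Binary.Permutation.Propositional using (_↭_; ↭-refl; ↭-sym; ↭-trans; ↭-prep; ↭⇒↭ₛ)
open import Data.List.Relation.Unary.All using (All; []; _∷_)
open import Data.List.Relation.Unary.AllPairs using ([]; _∷_)
open import Data.List.Relation.Unary.Any using (here; there)
open import Data.List.Relation.Unary.Unique.Propositional using (Unique)
open import Data.Maybe.Base using (Maybe; just; nothing)
open import Data.Nat using (ℕ; zero; suc; pred; _+_; _*_; _^_; _∸_; _≤_; _<_; _!; NonZero; z≤n; s≤s; z<s; s<s; _≤?_; _<?_)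
open import Data.Nat.DivMod using (_/_; _%_; _mod_)
open import Data.Product using (Σ; ∃; ∃-syntax; _×_; _,_; proj₁; proj₂)
open import Data.Product.Function.NonDependent.Setoid using (_×-inverse_)
open import Data.Product.Relation.Binary.Pointwise.NonDependent using (×-setoid) renaming (Pointwise-≡↔≡ to ×-Pointwise-≡↔≡)
open import Data.Sum using (_⊎_; inj₁; inj₂; [_,_]′)
open import Data.Sum.Function.Setoid using (_⊎-inverse_)
open import Data.Sum.Relation.Binary.Pointwise using (_⊎ₛ_; inj₁; inj₂) renaming (Pointwise-≡↔≡ to ⊎-Pointwise-≡↔≡)
open import Data.Vec.Base using ([]; _∷_)
open import Data.Vec.Functional using (Vector; updateAt)
open import Data.Vec.Functional.Relation.Binary.Equality.Setoid using (≋-setoid)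
open import Function using (_∘_; _⇔_; id; Inverse; mk⇔)
open import Function.Properties.Bijection using (Bijection⇒Inverse)
open import Level using (0ℓ)
open import Relation.Binary using (Setoid; DecidableEquality; tri<; tri≈; tri>)
open import Relation.Binary.Construct.Closure.Equivalence using (EqClosure)
open import Relation.Binary.PropositionalEquality using (_≡_; _≢_; _≗_; refl; sym; trans; cong; cong₂; subst; subst₂; module ≡-Reasoning) renaming (setoid to ≡-setoid)
open import Relation.Nullary using (¬_; Dec; yes; no; does; contradiction)
open import Relation.Nullary.Decidable using (dec-true; dec-false; _×-dec_; decidable-stable; ¬?)
open import Relation.Unary using (Decidable)
import Data.Fin.Properties as Fin
import Data.Integer as ℤ
import Data.Integer.Properties as ℤ
import Data.List.Membership.Propositional.Properties as ∈
import Data.List.Properties as List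
import Data.List.Relation.Binary.Permutation.Propositional.Properties as ↭
import Data.List.Relation.Binary.Permutation.Setoid.Properties as ↭ₛ
import Data.List.Relation.Unary.All as All
import Data.List.Relation.Unary.All.Properties as All
import Data.List.Relation.Unary.Any as Any
import Data.List.Relation.Unary.Unique.Propositional.Properties as Unique
import Data.Maybe.Properties as Maybe
import Data.Nat.DivMod as ℕ
import Data.Nat.Induction as ℕ
import Data.Nat.ListAction as ℕList
import Data.Nat.ListAction.Properties as ℕList
import Data.Nat.Properties as ℕ
import Data.Nat.Tactic.RingSolver as ℕSolver
import Data.Product.Properties as Product
import Data.Rational as ℚ
import Data.Rational.Properties as ℚ
import Data.Vec.Base as Vec
import Data.Vec.Functional.Properties as FVec
import Data.Vec.Properties as Vec
import Function.Construct.Composition as Compose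
import Function.Construct.Symmetry as Symmetry
import Function.Endo.Propositional as Endo
import Relation.Binary.Construct.Closure.Equivalence as EqC

-- Sizes of setoids

-- The BEST theorem trades tours for departure orders and trees, but the step from coloured vertices
-- to types must also store the names of the colours, of which there are p_t! arrangements for each
-- t. They survive because the p_t arcs (t , h) with t ∈ R_h all lead from t to t-1 and may be
-- permuted freely in a tour of the types. So a forest is relabelled such that the vertex of type t
-- and colour c is left for the last time by the c-th of these arcs. Conversely a tour is read
-- backwards from its end, where such an arc pushes its vertex on a stack and any other arc drops
-- the vertices of the run that it jumps over. The root stays on the stack because the tour starts
-- from a lowest state, and ties between lowest states are broken by `rank`; for forests this means
-- that the least arc leaving the root comes first.
--
-- Where the BEST theorem is applied, the bijection is stated as a relation between departure orders
-- (`_∼_` and `_≋ᵇ_`). Uniqueness of trails makes this relation functional and injective, and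
-- existence of trails makes it total.

infix 4 _≃_

_≃_ : Setoid 0ℓ 0ℓ → Setoid 0ℓ 0ℓ → Set
S ≃ T = Inverse S T

≃-sym : ∀ {S T} → S ≃ T → T ≃ S
≃-sym = Symmetry.inverse

infixr 0 _⨟_

_⨟_ : ∀ {S T U} → S ≃ T → T ≃ U → S ≃ U
_⨟_ = Compose.inverse

module _ {S T : Setoid 0ℓ 0ℓ} where
  private
    module S = Setoid S
    module T = Setoid T

  bijective⇒≃ : (f : S.Carrier → T.Carrier) →
                (∀ {x y} → x S.≈ y → f x T.≈ f y) →
                (∀ {x y} → f x T.≈ f y → x S.≈ y) →
                (∀ y → ∃ λ x → f x T.≈ y) → S ≃ T
  bijective⇒≃ f f-cong injective surjective = Bijection⇒Inverse record
    { to        = f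
    ; cong      = f-cong
    ; bijective = injective , λ y → let x , e = surjective y in x , λ z≈x → T.trans (f-cong z≈x) e
    }

HasSize-unique : ∀ {S a b} → S HasSize a → S HasSize b → a ≡ b
HasSize-unique i j = ↔⇒≡ (≃-sym i ⨟ j)

HasSize-Fin : ∀ {n} → ≡-setoid (Fin n) HasSize n
HasSize-Fin = bijective⇒≃ {≡-setoid _} id id id λ x → x , refl

HasSize-× : ∀ {S T a b} → S HasSize a → T HasSize b → ×-setoid S T HasSize a * b
HasSize-× i j = i ×-inverse j ⨟ ×-Pointwise-≡↔≡ ⨟ ≃-sym Fin.*↔×

HasSize-⊎ : ∀ {S T a b} → S HasSize a → T HasSize b → (S ⊎ₛ T) HasSize (a + b)
HasSize-⊎ i j = i ⊎-inverse j ⨟ ⊎-Pointwise-≡↔≡ _ _ ⨟ ≃-sym Fin.+↔⊎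

⨆-suc : ∀ {k} (S : Fin (suc k) → Setoid 0ℓ 0ℓ) → ⨆ S ≃ (S zero ⊎ₛ ⨆ (S ∘ suc))
⨆-suc S = record
  { to        = λ { (zero , x) → inj₁ x ; (suc i , x) → inj₂ (i , x) }
  ; from      = from
  ; to-cong   = λ { {zero , _} (same e) → inj₁ e ; {suc i , _} (same e) → inj₂ (same e) }
  ; from-cong = from-cong
  ; inverse   = (λ { {inj₁ x} (same e) → inj₁ e ; {inj₂ (i , x)} (same e) → inj₂ (same e) })
              , (λ { {zero , x} (inj₁ e) → same e ; {suc i , x} (inj₂ (same e)) → same e })
  }
  where
  from : Setoid.Carrier (S zero ⊎ₛ ⨆ (S ∘ suc)) → Setoid.Carrier (⨆ S)
  from (inj₁ x)       = zero , x
  from (inj₂ (i , x)) = suc i , x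
  from-cong : ∀ {x y} → Setoid._≈_ (S zero ⊎ₛ ⨆ (S ∘ suc)) x y → Setoid._≈_ (⨆ S) (from x) (from y)
  from-cong (inj₁ e)        = same e
  from-cong (inj₂ (same e)) = same e

HasSize-⨆ : ∀ {k} (S : Fin k → Setoid 0ℓ 0ℓ) {a : Vector ℕ k} →
            (∀ t → S t HasSize a t) → ⨆ S HasSize sum a
HasSize-⨆ {zero}  S i = bijective⇒≃ {⨆ S} (λ ()) (λ { {() , _} }) (λ { {() , _} }) λ ()
HasSize-⨆ {suc k} S i = ⨆-suc S ⨟ HasSize-⊎ (i zero) (HasSize-⨆ (S ∘ suc) (i ∘ suc))

-- Unlike for `≋-setoid`, the factors may differ; colourings need this since the number of colours
-- depends on the type.
Πₛ : ∀ {k} → (Fin k → Setoid 0ℓ 0ℓ) → Setoid 0ℓ 0ℓ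
Πₛ S = record
  { Carrier       = ∀ t → Setoid.Carrier (S t)
  ; _≈_           = λ f g → ∀ t → Setoid._≈_ (S t) (f t) (g t)
  ; isEquivalence = record
    { refl  = λ t → Setoid.refl (S t)
    ; sym   = λ e t → Setoid.sym (S t) (e t)
    ; trans = λ e f t → Setoid.trans (S t) (e t) (f t)
    }
  }

Πₛ-suc : ∀ {k} (S : Fin (suc k) → Setoid 0ℓ 0ℓ) → Πₛ S ≃ ×-setoid (S zero) (Πₛ (S ∘ suc))
Πₛ-suc S = bijective⇒≃ {Πₛ S} (λ f → f zero , f ∘ suc) (λ e → e zero , e ∘ suc)
  (λ { (e , f) zero → e ; (e , f) (suc i) → f i })
  λ (x , f) → (λ { zero → x ; (suc i) → f i }) , Setoid.refl (S zero) , λ t → Setoid.refl (S (suc t))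

Finite : Setoid 0ℓ 0ℓ → Set
Finite S = ∃[ N ] S HasSize N

Finite-Πₛ : ∀ {k} (S : Fin k → Setoid 0ℓ 0ℓ) → (∀ t → Finite (S t)) → Finite (Πₛ S)
Finite-Πₛ {zero}  S i = 1 , bijective⇒≃ {Πₛ S} (λ _ → zero) (λ _ → refl) (λ _ ()) λ { zero → (λ ()) , refl }
Finite-Πₛ {suc k} S i =
  let a , i₀ = i zero ; b , j = Finite-Πₛ (S ∘ suc) (i ∘ suc) in a * b , (Πₛ-suc S ⨟ HasSize-× i₀ j)

HasSize-^ : ∀ k {S a} → S HasSize a → ≋-setoid S k HasSize a ^ k
HasSize-^ zero    {S} i = bijective⇒≃ {≋-setoid S 0} (λ _ → zero) (λ _ → refl) (λ _ ()) λ { zero → (λ ()) , refl }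
HasSize-^ (suc k) {S} i = ≋⇒Πₛ ⨟ Πₛ-suc (λ _ → S) ⨟ HasSize-× i (≃-sym ≋⇒Πₛ ⨟ HasSize-^ k i)
  where
  ≋⇒Πₛ : ∀ {k} → ≋-setoid S k ≃ Πₛ {k} (λ _ → S)
  ≋⇒Πₛ {k} = bijective⇒≃ {≋-setoid S k} {Πₛ {k} (λ _ → S)} id id id λ f → f , λ _ → Setoid.refl S

-- Lists the members of A in increasing order. This serves for counting and, in `member`, as a
-- choice of representatives that depends on the sets alone.
sel : ∀ {n} (A : Subset n) → Fin ∣ A ∣ → Fin n
sel (true  ∷ A) zero    = zero
sel (true  ∷ A) (suc c) = suc (sel A c)
sel (false ∷ A) c       = suc (sel A c)

sel-∈ : ∀ {n} (A : Subset n) c → sel A c ∈ A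
sel-∈ (true  ∷ A) zero    = Vec.here
sel-∈ (true  ∷ A) (suc c) = Vec.there (sel-∈ A c)
sel-∈ (false ∷ A) c       = Vec.there (sel-∈ A c)

sel-injective : ∀ {n} (A : Subset n) {c d} → sel A c ≡ sel A d → c ≡ d
sel-injective (true  ∷ A) {zero}  {zero}  e = refl
sel-injective (true  ∷ A) {suc c} {suc d} e = cong suc (sel-injective A (Fin.suc-injective e))
sel-injective (false ∷ A)                 e = sel-injective A (Fin.suc-injective e)

sel-surjective : ∀ {n} (A : Subset n) {i} → i ∈ A → ∃ λ c → sel A c ≡ i
sel-surjective (true  ∷ A) Vec.here      = zero , refl
sel-surjective (true  ∷ A) (Vec.there p) = let c , e = sel-surjective A p in suc c , cong suc e
sel-surjective (false ∷ A) (Vec.there p) = let c , e = sel-surjective A p in c , cong suc e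

∈-tabulate⁺ : ∀ {n} (f : Fin n → Bool) {i} → f i ≡ true → i ∈ Vec.tabulate f
∈-tabulate⁺ f {i} e = Vec.lookup⇒[]= i _ (trans (Vec.lookup∘tabulate f i) e)

∈-tabulate⁻ : ∀ {n} (f : Fin n → Bool) {i} → i ∈ Vec.tabulate f → f i ≡ true
∈-tabulate⁻ f {i} p = trans (sym (Vec.lookup∘tabulate f i)) (Vec.[]=⇒lookup p)

∈-separation⁺ : ∀ {n} {P : Fin n → Set} (P? : Decidable P) {i} → P i → i ∈ Vec.tabulate (does ∘ P?)
∈-separation⁺ P? {i} p = ∈-tabulate⁺ _ (dec-true (P? i) p)

∈-separation⁻ : ∀ {n} {P : Fin n → Set} (P? : Decidable P) {i} → i ∈ Vec.tabulate (does ∘ P?) → P i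
∈-separation⁻ P? {i} q with P? i | ∈-tabulate⁻ (does ∘ P?) q
... | yes p | _ = p

bijection⇒∣∣ : ∀ {n p} (A : Subset n) (g : Fin p → Fin n) → (∀ {c d} → g c ≡ g d → c ≡ d) →
               (∀ c → g c ∈ A) → (∀ {i} → i ∈ A → ∃ λ c → g c ≡ i) → ∣ A ∣ ≡ p
bijection⇒∣∣ A g injective g-∈ surjective = ℕ.≤-antisym
  (Fin.injective⇒≤ {f = λ c → proj₁ (surjective (sel-∈ A c))} λ {c} {d} e → sel-injective A
    (trans (sym (proj₂ (surjective (sel-∈ A c)))) (trans (cong g e) (proj₂ (surjective (sel-∈ A d))))))
  (Fin.injective⇒≤ {f = λ c → proj₁ (sel-surjective A (g-∈ c))} λ {c} {d} e → injective
    (trans (sym (proj₂ (sel-surjective A (g-∈ c)))) (trans (cong (sel A) e) (proj₂ (sel-surjective A (g-∈ d))))))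

Finite-Sub : ∀ {S P} → Finite S → (∀ {x y} → Setoid._≈_ S x y → P x → P y) → Decidable P → Finite (Sub S P)
Finite-Sub {S} {P} (N , i) resp P? = ∣ A ∣ , ≃-sym (bijective⇒≃ {≡-setoid (Fin ∣ A ∣)} {Sub S P}
  (λ c → Inverse.from i (sel A c) , ∈-separation⁻ (P? ∘ Inverse.from i) (sel-∈ A c))
  (λ { refl → Setoid.refl S })
  (λ e → sel-injective A (trans (sym (Inverse.strictlyInverseˡ i _))
           (trans (Inverse.to-cong i e) (Inverse.strictlyInverseˡ i _))))
  λ (x , p) → let e = Inverse.strictlyInverseʳ i x
                  c , e′ = sel-surjective A (∈-separation⁺ (P? ∘ Inverse.from i) (resp (Setoid.sym S e) p))
              in c , Setoid.trans S (Setoid.reflexive S (cong (Inverse.from i) e′)) e)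
  where
  A : Subset N
  A = Vec.tabulate (does ∘ P? ∘ Inverse.from i)

-- Applied at `zero` this gives the factorial; applied at the last index it separates the value that
-- decides the validity of a bidding from the remaining ones.
Permutations-split : ∀ {n} (i : Fin (suc n)) →
                     Permutations (suc n) ≃ ×-setoid (≡-setoid (Fin (suc n))) (Permutations n)
Permutations-split {n} i = bijective⇒≃ {Permutations (suc n)} {×-setoid (≡-setoid (Fin (suc n))) (Permutations n)}
  (λ π → π ⟨$⟩ʳ i , remove i π)
  (λ {π} {ρ} e → e i , λ j → Fin.punchIn-injective (ρ ⟨$⟩ʳ i) _ _
    (trans (cong (λ x → punchIn x (remove i π ⟨$⟩ʳ j)) (sym (e i)))
      (trans (sym (punchIn-permute π i j)) (trans (e (punchIn i j)) (punchIn-permute ρ i j)))))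
  (λ {π} {ρ} (e , f) j → agree π ρ e f j)
  λ (j , ρ) → insert i j ρ , insert-at i j ρ , remove-insert i j ρ
  where
  agree : ∀ π ρ → π ⟨$⟩ʳ i ≡ ρ ⟨$⟩ʳ i → remove i π ≈ₚ remove i ρ → π ≈ₚ ρ
  agree π ρ e f j with i Fin.≟ j
  ... | yes refl = e
  ... | no  i≢j rewrite sym (Fin.punchIn-punchOut i≢j) =
    trans (punchIn-permute π i _) (trans (cong₂ punchIn e (f (punchOut i≢j))) (sym (punchIn-permute ρ i _)))
  insert-at : ∀ i j (ρ : Permutation′ n) → insert i j ρ ⟨$⟩ʳ i ≡ j
  insert-at i j ρ with i Fin.≟ i
  ... | yes _   = refl
  ... | no  i≢i = contradiction refl i≢i

Permutations-size : ∀ n → Permutations n HasSize n !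
Permutations-size zero    = bijective⇒≃ {Permutations 0} (λ _ → zero) (λ _ → refl) (λ _ ()) λ { zero → idₚ , refl }
Permutations-size (suc n) = Permutations-split zero ⨟ HasSize-× HasSize-Fin (Permutations-size n)

Vec-ext : ∀ {A : Set} {m} {xs ys : Vec.Vec A m} → (∀ i → Vec.lookup xs i ≡ Vec.lookup ys i) → xs ≡ ys
Vec-ext {xs = xs} {ys} e = trans (sym (Vec.tabulate∘lookup xs)) (trans (Vec.tabulate-cong e) (Vec.tabulate∘lookup ys))

-- Lists and cyclic permutations

∈-drop : {X : Set} {x : X} (s : List X) → ∀ r → x ∈ₗ s → x ∈ₗ drop r s ⊎ ∃ λ i → i < r × ∃ λ s′ → drop i s ≡ x ∷ s′
∈-drop s       zero    q           = inj₁ q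
∈-drop (y ∷ s) (suc r) (here refl) = inj₂ (0 , z<s , s , refl)
∈-drop (y ∷ s) (suc r) (there q) with ∈-drop s r q
... | inj₁ q′               = inj₁ q′
... | inj₂ (i , i<r , rest) = inj₂ (suc i , s<s i<r , rest)

drop-⊆ : {X : Set} {x : X} (s : List X) → ∀ r → x ∈ₗ drop r s → x ∈ₗ s
drop-⊆ s       zero    q = q
drop-⊆ (y ∷ s) (suc r) q = there (drop-⊆ s r q)

drop-nonempty : {X : Set} (s : List X) → ∀ r {x s′} → drop r s ≡ x ∷ s′ → r < length s
drop-nonempty (_ ∷ s) zero    e = z<s
drop-nonempty (_ ∷ s) (suc r) e = s<s (drop-nonempty s r e)

length-drop-+ : ∀ {X : Set} r (s : List X) {x s′} → drop r s ≡ x ∷ s′ → length (drop r s) + r ≡ length s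
length-drop-+ zero    s       e = ℕ.+-identityʳ _
length-drop-+ (suc r) (_ ∷ s) e = trans (ℕ.+-suc _ r) (cong suc (length-drop-+ r s e))

last-tabulate : ∀ {X : Set} {m} (f : Fin (suc m) → X) → last (tabulate f) ≡ just (f (fromℕ m))
last-tabulate {m = zero}  f = refl
last-tabulate {m = suc m} f = last-tabulate (f ∘ suc)

tabulate-injective : ∀ {X : Set} {m} {f g : Fin m → X} → tabulate f ≡ tabulate g → f ≗ g
tabulate-injective e zero    = List.∷-injectiveˡ e
tabulate-injective e (suc i) = tabulate-injective (List.∷-injectiveʳ e) i

iterate-cong : {X : Set} {f g : X → X} → f ≗ g → ∀ x m → iterate f x m ≡ iterate g x m
iterate-cong e x zero    = refl
iterate-cong {f = f} {g} e x (suc m) = cong (x ∷_) (trans (cong (λ y → iterate f y m) (e x)) (iterate-cong e (g x) m))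

Unique-resp-↭ : {X : Set} {xs ys : List X} → xs ↭ ys → Unique xs → Unique ys
Unique-resp-↭ p = ↭ₛ.Unique-resp-↭ (≡-setoid _) (↭⇒↭ₛ p)

⊆⇒↭-++ : {X : Set} {xs ys : List X} → Unique xs → (∀ {x} → x ∈ₗ xs → x ∈ₗ ys) → ∃ λ zs → ys ↭ xs ++ zs
⊆⇒↭-++ {xs = []} {ys} _ _ = ys , ↭-refl
⊆⇒↭-++ {xs = x ∷ xs} (x∉ ∷ u) ⊆ with as , bs , refl ← ∈.∈-∃++ (⊆ (here refl)) =
  let zs , p = ⊆⇒↭-++ {ys = as ++ bs} u rest in zs , ↭-trans (↭.shift x as bs) (↭-prep x p)
  where
  rest : ∀ {y} → y ∈ₗ xs → y ∈ₗ as ++ bs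
  rest y∈ with ↭.∈-resp-↭ (↭.shift x as bs) (⊆ (there y∈))
  ... | here refl = contradiction refl (All.lookup x∉ y∈)
  ... | there q   = q

⊆∧length⇒↭ : {X : Set} {xs ys : List X} → Unique xs → (∀ {x} → x ∈ₗ xs → x ∈ₗ ys) →
             length xs ≡ length ys → xs ↭ ys
⊆∧length⇒↭ {xs = xs} u ⊆ len with ⊆⇒↭-++ u ⊆
... | []     , p = ↭-sym (subst (_ ↭_) (List.++-identityʳ xs) p)
... | z ∷ zs , p = contradiction
  (trans len (trans (↭.↭-length p) (List.length-++ xs))) (ℕ.m≢1+m+n (length xs) ∘ λ e → trans e (ℕ.+-suc _ _))

⊆⇒↭ : {X : Set} {xs ys : List X} → Unique xs → Unique ys → (∀ {x} → x ∈ₗ xs → x ∈ₗ ys) →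
      (∀ {x} → x ∈ₗ ys → x ∈ₗ xs) → xs ↭ ys
⊆⇒↭ {xs = xs} u v ⊆ ⊇ with ⊆⇒↭-++ u ⊆
... | []     , p = ↭-sym (subst (_ ↭_) (List.++-identityʳ xs) p)
... | z ∷ zs , p with Unique-resp-↭ (↭-trans p (↭.shift z xs zs)) v
...   | z∉ ∷ _ = contradiction refl
  (All.lookup z∉ (∈.∈-++⁺ˡ (⊇ (↭.∈-resp-↭ (↭-sym p) (∈.∈-++⁺ʳ xs (here refl))))))

minimum : {X : Set} {_⊑_ : X → X → Set} → (∀ x y → x ⊑ y ⊎ y ⊑ x) → (∀ {x y z} → x ⊑ y → y ⊑ z → x ⊑ z) →
          ∀ x (l : List X) → ∃ λ m → m ∈ₗ x ∷ l × (∀ {y} → y ∈ₗ x ∷ l → m ⊑ y)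
minimum {_⊑_ = _⊑_} total ⊑-trans x [] = x , here refl , λ { (here refl) → [ id , id ]′ (total x x) }
minimum {_⊑_ = _⊑_} total ⊑-trans x (y ∷ l) with m , m∈ , least ← minimum {_⊑_ = _⊑_} total ⊑-trans y l with total x m
... | inj₁ x⊑m = x , here refl , λ { (here refl) → [ id , id ]′ (total x x) ; (there p) → ⊑-trans x⊑m (least p) }
... | inj₂ m⊑x = m , there m∈ , λ { (here refl) → m⊑x ; (there p) → least p }

module _ {X : Set} where
  open Endo X using () renaming (_^_ to _^ₑ_)

  ^ₑ-comm : ∀ (f : X → X) m x → (f ^ₑ m) (f x) ≡ f ((f ^ₑ m) x)
  ^ₑ-comm f zero    x = refl
  ^ₑ-comm f (suc m) x = cong f (^ₑ-comm f m x)

  ^ₑ-+ : ∀ (f : X → X) a b x → (f ^ₑ (a + b)) x ≡ (f ^ₑ a) ((f ^ₑ b) x)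
  ^ₑ-+ f zero    b x = refl
  ^ₑ-+ f (suc a) b x = cong f (^ₑ-+ f a b x)

  ^ₑ-* : ∀ (f : X → X) M q x → (f ^ₑ M) x ≡ x → (f ^ₑ (q * M)) x ≡ x
  ^ₑ-* f M zero    x e = refl
  ^ₑ-* f M (suc q) x e = trans (^ₑ-+ f M (q * M) x) (trans (cong (f ^ₑ M) (^ₑ-* f M q x e)) e)

  ∈-iterate⁻ : ∀ (f : X → X) x M {y} → y ∈ₗ iterate f x M → ∃ λ i → i < M × (f ^ₑ i) x ≡ y
  ∈-iterate⁻ f x (suc M) (here refl) = 0 , z<s , refl
  ∈-iterate⁻ f x (suc M) (there p) =
    let i , i<M , e = ∈-iterate⁻ f (f x) M p in suc i , s<s i<M , trans (sym (^ₑ-comm f i x)) e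

  ∈-iterate⁺ : ∀ (f : X → X) x {M} i → i < M → (f ^ₑ i) x ∈ₗ iterate f x M
  ∈-iterate⁺ f x {suc M} zero    _         = here refl
  ∈-iterate⁺ f x {suc M} (suc i) (s≤s i<M) =
    there (subst (_∈ₗ iterate f (f x) M) (^ₑ-comm f i x) (∈-iterate⁺ f (f x) i i<M))

  headOr : X → List X → X
  headOr z []      = z
  headOr z (x ∷ _) = x

  -- Here z is what follows the last entry. Taking z to be the head of the list expresses that f
  -- goes around the list as a cycle.
  data Follows (f : X → X) (z : X) : List X → Set where
    []  : Follows f z []
    _∷_ : ∀ {x l} → f x ≡ headOr z l → Follows f z l → Follows f z (x ∷ l)

  Follows-iterate : ∀ f x M → Follows f ((f ^ₑ M) x) (iterate f x M)
  Follows-iterate f x zero          = []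
  Follows-iterate f x (suc zero)    = refl ∷ []
  Follows-iterate f x (suc (suc M)) =
    refl ∷ subst (λ z → Follows f z (iterate f (f x) (suc M))) (cong f (^ₑ-comm f M x)) (Follows-iterate f (f x) (suc M))

  Follows⇒iterate : ∀ {f z l} → Follows f z l → iterate f (headOr z l) (length l) ≡ l
  Follows⇒iterate []                = refl
  Follows⇒iterate {f} {z} {x ∷ l} (e ∷ F) =
    cong (x ∷_) (trans (cong (λ y → iterate f y (length l)) e) (Follows⇒iterate F))

  Follows⇒^ₑ : ∀ {f z l} → Follows f z l → (f ^ₑ length l) (headOr z l) ≡ z
  Follows⇒^ₑ []                = refl
  Follows⇒^ₑ {f} {z} {x ∷ l} (e ∷ F) =
    trans (sym (^ₑ-comm f (length l) x)) (trans (cong (f ^ₑ length l) e) (Follows⇒^ₑ F))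

  Follows-agree : ∀ {f g z l} → Follows f z l → Follows g z l → ∀ {y} → y ∈ₗ l → f y ≡ g y
  Follows-agree (e ∷ _) (e′ ∷ _) (here refl) = trans e (sym e′)
  Follows-agree (_ ∷ F) (_ ∷ G)  (there p)   = Follows-agree F G p

  Follows-cong : ∀ {f g z l} → (∀ {y} → y ∈ₗ l → f y ≡ g y) → Follows f z l → Follows g z l
  Follows-cong h []      = []
  Follows-cong h (e ∷ F) = trans (sym (h (here refl))) e ∷ Follows-cong (h ∘ there) F

SingleCycle : {X : Set} → (X → X) → Set
SingleCycle f = ∀ x y → SameOrbit f x y

module Enumerated {X : Set} (_≟_ : DecidableEquality X) (univ : List X)
                  (univ-unique : Unique univ) (univ-total : ∀ x → x ∈ₗ univ) where
  open Endo X using () renaming (_^_ to _^ₑ_)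

  size : ℕ
  size = length univ

  complete⇒unique : ∀ {l} → l ↭ univ → Unique l
  complete⇒unique p = Unique-resp-↭ (↭-sym p) univ-unique

  complete⇒total : ∀ {l} → l ↭ univ → ∀ x → x ∈ₗ l
  complete⇒total p x = ↭.∈-resp-↭ (↭-sym p) (univ-total x)

  injective⇒↭ : (f : X → X) → (∀ {x y} → f x ≡ f y → x ≡ y) → map f univ ↭ univ
  injective⇒↭ f injective = ⊆∧length⇒↭ (Unique.map⁺ injective univ-unique) (λ _ → univ-total _) (List.length-map f univ)

  injective⇒surjective : (f : X → X) → (∀ {x y} → f x ≡ f y → x ≡ y) → ∀ y → ∃ λ x → f x ≡ y
  injective⇒surjective f injective y =
    let x , _ , e = ∈.∈-map⁻ f (complete⇒total (injective⇒↭ f injective) y) in x , sym e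

  module _ {f : X → X} where

    private
      LeastPeriod : X → Set
      LeastPeriod x = ∃ λ M → 0 < M × (f ^ₑ M) x ≡ x × (∀ j → 0 < j → j < M → (f ^ₑ j) x ≢ x)

      opaque
        least-period : ∀ x m → 0 < m → (f ^ₑ m) x ≡ x → LeastPeriod x
        least-period x = ℕ.<-rec (λ m → 0 < m → (f ^ₑ m) x ≡ x → LeastPeriod x) λ m rec 0<m e →
          case m rec 0<m e (ℕ.anyUpTo? (λ j → (0 <? j) ×-dec ((f ^ₑ j) x ≟ x)) m)
          where
          case : ∀ m → (∀ {j} → j < m → 0 < j → (f ^ₑ j) x ≡ x → LeastPeriod x) → 0 < m → (f ^ₑ m) x ≡ x →
                 Dec (∃ λ j → j < m × 0 < j × (f ^ₑ j) x ≡ x) → LeastPeriod x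
          case m rec 0<m e (yes (j , j<m , 0<j , e′)) = rec j<m 0<j e′
          case m rec 0<m e (no none) = m , 0<m , e , λ j 0<j j<m e′ → none (j , j<m , 0<j , e′)

    -- A repetition d + 1 steps apart, continued up to the end of the period, would bring x back to
    -- itself after d + 1 < M steps.
    iterate-unique : ∀ x M → (f ^ₑ M) x ≡ x → (∀ j → 0 < j → j < M → (f ^ₑ j) x ≢ x) → Unique (iterate f x M)
    iterate-unique x M period least = go M 0 (ℕ.+-identityʳ M)
      where
      go : ∀ r i → r + i ≡ M → Unique (iterate f ((f ^ₑ i) x) r)
      go zero    i e = []
      go (suc r) i e = All.tabulate distinct ∷ go r (suc i) (trans (ℕ.+-suc r i) e)
        where
        distinct : ∀ {y} → y ∈ₗ iterate f (f ((f ^ₑ i) x)) r → (f ^ₑ i) x ≢ y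
        distinct p eq with d , d<r , e′ ← ∈-iterate⁻ f _ r p = least (suc d) z<s
          (subst (suc d <_) e (s≤s (ℕ.≤-trans d<r (ℕ.m≤m+n r i))))
          (begin
            (f ^ₑ suc d) x                                ≡⟨ cong (f ^ₑ suc d) (sym periodic) ⟩
            (f ^ₑ suc d) ((f ^ₑ suc r) ((f ^ₑ i) x))      ≡⟨ sym (^ₑ-+ f (suc d) (suc r) _) ⟩
            (f ^ₑ (suc d + suc r)) ((f ^ₑ i) x)           ≡⟨ cong (λ m → (f ^ₑ m) ((f ^ₑ i) x)) (ℕ.+-comm (suc d) (suc r)) ⟩
            (f ^ₑ (suc r + suc d)) ((f ^ₑ i) x)           ≡⟨ ^ₑ-+ f (suc r) (suc d) _ ⟩
            (f ^ₑ suc r) ((f ^ₑ suc d) ((f ^ₑ i) x))      ≡⟨ cong (f ^ₑ suc r) (trans (sym (^ₑ-comm f d _)) (trans e′ (sym eq))) ⟩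
            (f ^ₑ suc r) ((f ^ₑ i) x)                     ≡⟨ periodic ⟩
            x                                             ∎)
          where
          open ≡-Reasoning
          periodic : (f ^ₑ suc r) ((f ^ₑ i) x) ≡ x
          periodic = trans (sym (^ₑ-+ f (suc r) i x)) (trans (cong (λ m → (f ^ₑ m) x) e) period)

    private
      opaque
        -- The orbit returns to x because f x reaches x. Up to the least period M there is no
        -- repetition, and reducing exponents modulo M shows that everything occurs, which forces M
        -- to be `size`.
        around : SingleCycle f → ∀ x → iterate f x size ↭ univ × (f ^ₑ size) x ≡ x
        around sc x with m , e ← sc (f x) x
          with suc M , 0<M , period , least ← least-period x (suc m) z<s (trans (sym (^ₑ-comm f m x)) e) =
          subst (λ N → iterate f x N ↭ univ) M≡ complete , subst (λ N → (f ^ₑ N) x ≡ x) M≡ period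
          where
          total : ∀ y → y ∈ₗ iterate f x (suc M)
          total y with m , e ← sc x y = subst (_∈ₗ iterate f x (suc M)) (trans (sym e″) e)
                                          (∈-iterate⁺ f x (m % suc M) (ℕ.m%n<n m (suc M)))
            where
            e″ : (f ^ₑ m) x ≡ (f ^ₑ (m % suc M)) x
            e″ = trans (cong (λ j → (f ^ₑ j) x) (ℕ.m≡m%n+[m/n]*n m (suc M)))
                  (trans (^ₑ-+ f (m % suc M) _ x) (cong (f ^ₑ (m % suc M)) (^ₑ-* f (suc M) (m / suc M) x period)))
          complete : iterate f x (suc M) ↭ univ
          complete = ⊆⇒↭ (iterate-unique x (suc M) period least) univ-unique (λ _ → univ-total _) (λ _ → total _)
          M≡ : suc M ≡ size
          M≡ = trans (sym (List.length-iterate f x (suc M))) (↭.↭-length complete)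

    cycle-complete : SingleCycle f → ∀ x → iterate f x size ↭ univ
    cycle-complete sc x = proj₁ (around sc x)

    cycle-closes : SingleCycle f → ∀ x → (f ^ₑ size) x ≡ x
    cycle-closes sc x = proj₂ (around sc x)

    cycle-follows : SingleCycle f → ∀ x → Follows f x (iterate f x size)
    cycle-follows sc x = subst (λ z → Follows f z (iterate f x size)) (cycle-closes sc x) (Follows-iterate f x size)

  follows⇒SingleCycle : ∀ {f x l} → x ∷ l ↭ univ → Follows f x (x ∷ l) → SingleCycle f
  follows⇒SingleCycle {f} {x} {l} complete F y z =
    let i , i<N , eᵢ = orbit y ; j , _ , eⱼ = orbit z in
    j + (suc (length l) ∸ i) ,
    (begin
      (f ^ₑ (j + (suc (length l) ∸ i))) y                ≡⟨ ^ₑ-+ f j _ y ⟩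
      (f ^ₑ j) ((f ^ₑ (suc (length l) ∸ i)) y)           ≡⟨ cong (λ w → (f ^ₑ j) ((f ^ₑ (suc (length l) ∸ i)) w)) (sym eᵢ) ⟩
      (f ^ₑ j) ((f ^ₑ (suc (length l) ∸ i)) ((f ^ₑ i) x)) ≡⟨ cong (f ^ₑ j) (sym (^ₑ-+ f (suc (length l) ∸ i) i x)) ⟩
      (f ^ₑ j) ((f ^ₑ (suc (length l) ∸ i + i)) x)       ≡⟨ cong (λ m → (f ^ₑ j) ((f ^ₑ m) x)) (ℕ.m∸n+n≡m (ℕ.<⇒≤ i<N)) ⟩
      (f ^ₑ j) ((f ^ₑ suc (length l)) x)                 ≡⟨ cong (f ^ₑ j) (Follows⇒^ₑ F) ⟩
      (f ^ₑ j) x                                         ≡⟨ eⱼ ⟩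
      z                                                  ∎)
    where
    open ≡-Reasoning
    orbit : ∀ y → ∃ λ i → i < suc (length l) × (f ^ₑ i) x ≡ y
    orbit y = ∈-iterate⁻ f x _ (subst (y ∈ₗ_) (sym (Follows⇒iterate F)) (complete⇒total complete y))

  iterate≡⇒≗ : ∀ {f g x} → SingleCycle f → SingleCycle g → iterate f x size ≡ iterate g x size → f ≗ g
  iterate≡⇒≗ {f} {g} {x} scf scg e y = Follows-agree (cycle-follows scf x)
    (subst (Follows g x) (sym e) (cycle-follows scg x)) (complete⇒total (cycle-complete scf x) y)

  -- The value y for y outside the list is a default; the lists to which this is applied later
  -- contain everything.
  next : X → List X → X → X
  next z []      y = y
  next z (x ∷ l) y = if does (y ≟ x) then headOr z l else next z l y

  next-here : ∀ z x l → next z (x ∷ l) x ≡ headOr z l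
  next-here z x l rewrite dec-true (x ≟ x) refl = refl

  next-there : ∀ z x l {y} → y ≢ x → next z (x ∷ l) y ≡ next z l y
  next-there z x l {y} y≢x rewrite dec-false (y ≟ x) y≢x = refl

  next-follows : ∀ {z l} → Unique l → Follows (next z l) z l
  next-follows []                    = []
  next-follows {z} {x ∷ l} (x∉ ∷ u) = next-here z x l
    ∷ Follows-cong (λ y∈ → sym (next-there z x l (All.lookup x∉ y∈ ∘ sym))) (next-follows u)

  next-SingleCycle : ∀ {x l} → x ∷ l ↭ univ → SingleCycle (next x (x ∷ l))
  next-SingleCycle p = follows⇒SingleCycle p (next-follows (complete⇒unique p))

  iterate-next : ∀ {x l} → x ∷ l ↭ univ → iterate (next x (x ∷ l)) x size ≡ x ∷ l
  iterate-next {x} {l} p = trans (cong (iterate (next x (x ∷ l)) x) (sym (↭.↭-length p)))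
    (Follows⇒iterate (next-follows (complete⇒unique p)))

opaque
  Fin-injective⇒permutation : ∀ {n} (f : Fin n → Fin n) → (∀ {i j} → f i ≡ f j → i ≡ j) →
                              Σ (Permutation′ n) λ π → ∀ i → π ⟨$⟩ʳ i ≡ f i
  Fin-injective⇒permutation {n} f injective =
    permutation f (proj₁ ∘ surjective) (λ i → proj₂ (surjective i)) (λ i → injective (proj₂ (surjective (f i)))) , λ _ → refl
    where
    surjective : ∀ j → ∃ λ i → f i ≡ j
    surjective = Enumerated.injective⇒surjective Fin._≟_ (allFin n) (Unique.allFin⁺ n) ∈.∈-allFin f injective

  -- A section of f is injective, hence a permutation, and f is its inverse.
  Fin-section⇒permutation : ∀ {n} (f : Fin n → Fin n) → (∀ y → ∃ λ j → f j ≡ y) →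
                            Σ (Permutation′ n) λ π → ∀ i → π ⟨$⟩ʳ i ≡ f i
  Fin-section⇒permutation {n} f surjective =
    let π , π≗ = Fin-injective⇒permutation (proj₁ ∘ surjective)
          λ {i} {j} e → trans (sym (proj₂ (surjective i))) (trans (cong f e) (proj₂ (surjective j)))
    in flipₚ π , λ i → trans (sym (proj₂ (surjective _))) (cong f (trans (sym (π≗ _)) (inverseʳ π)))

  ↭-allFin⇒permutation : ∀ {n} {l : List (Fin n)} → l ↭ allFin n →
                         Σ (Permutation′ n) λ π → tabulate (π ⟨$⟩ʳ_) ≡ l
  ↭-allFin⇒permutation {n} {l} p =
    let f , e = functional l (trans (↭.↭-length p) (List.length-tabulate {n = n} id))
        π , π≗ = Fin-section⇒permutation f λ y →
          let j , e′ = ∈.∈-tabulate⁻ {f = f} (subst (y ∈ₗ_) (sym e) (↭.∈-resp-↭ (↭-sym p) (∈.∈-allFin y))) in j , sym e′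
    in π , trans (List.tabulate-cong π≗) e
    where
    functional : ∀ {n} (l : List (Fin n)) → ∀ {m} → length l ≡ m → Σ (Fin m → Fin n) λ f → tabulate f ≡ l
    functional l refl = lookup l , List.tabulate-lookup l

-- Eulerian trails

last-∈ : {X : Set} (l : List X) {x : X} → last l ≡ just x → x ∈ₗ l
last-∈ (x ∷ [])     refl = here refl
last-∈ (_ ∷ y ∷ l) e    = there (last-∈ (y ∷ l) e)

last-exists : {X : Set} (l : List X) {y : X} → y ∈ₗ l → ∃ λ x → last l ≡ just x
last-exists (x ∷ [])    _ = x , refl
last-exists (x ∷ y ∷ l) _ = last-exists (y ∷ l) (here refl)

last-∷ : {X : Set} (y : X) (l : List X) {x : X} → last l ≡ just x → last (y ∷ l) ≡ just x
last-∷ y (_ ∷ _) e = e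

filter-∷⁻ : {X : Set} {P : X → Set} (P? : Decidable P) (m : List X) {e : X} {s : List X} → filter P? m ≡ e ∷ s →
            ∃ λ a → ∃ λ b → m ≡ a ++ e ∷ b × filter P? a ≡ [] × filter P? b ≡ s × P e
filter-∷⁻ P? (x ∷ m) eq with P? x in x?
filter-∷⁻ P? (x ∷ m) refl | yes p = [] , m , refl , refl , refl , p
filter-∷⁻ P? (x ∷ m) eq   | no ¬p with a , b , refl , ea , eb , q ← filter-∷⁻ P? m eq =
  x ∷ a , b , refl , trans (List.filter-reject P? ¬p) ea , eb , q

module Stacks {V E : Set} (_≟_ : DecidableEquality V) (src : E → V) where

  out : V → List E → List E
  out v = filter (λ e → src e ≟ v)

  infix 4 _≈ˢ_

  -- Both lists prescribe the same order of departure at each vertex, which is all that the BEST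
  -- theorem keeps of a trail besides its ends.
  _≈ˢ_ : List E → List E → Set
  m ≈ˢ l = ∀ v → out v m ≡ out v l

  out-here : ∀ {e v} → src e ≡ v → ∀ l → out v (e ∷ l) ≡ e ∷ out v l
  out-here p l = List.filter-accept (λ e → src e ≟ _) p

  out-there : ∀ {e v} → src e ≢ v → ∀ l → out v (e ∷ l) ≡ out v l
  out-there p l = List.filter-reject (λ e → src e ≟ _) p

  ∈-out⁻ : ∀ {e v} m → e ∈ₗ out v m → e ∈ₗ m × src e ≡ v
  ∈-out⁻ m = ∈.∈-filter⁻ (λ e → src e ≟ _) {xs = m}

  ∈-out⁺ : ∀ {e v m} → e ∈ₗ m → src e ≡ v → e ∈ₗ out v m
  ∈-out⁺ = ∈.∈-filter⁺ (λ e → src e ≟ _)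

  ≈ˢ-tail : ∀ {e l l′} → (e ∷ l) ≈ˢ (e ∷ l′) → l ≈ˢ l′
  ≈ˢ-tail {e} {l} {l′} eqs v with src e ≟ v
  ... | yes p = List.∷-injectiveʳ (trans (sym (out-here p l)) (trans (eqs v) (out-here p l′)))
  ... | no ¬p = trans (sym (out-there ¬p l)) (trans (eqs v) (out-there ¬p l′))

-- The BEST theorem: given the order in which the arcs leave each vertex,
-- following the first unused arc is an Eulerian trail to w if and only if
-- the last arcs lead to w from everywhere.
module Trails {V E : Set} (_≟_ : DecidableEquality V) (src tgt : E → V) where
  open Stacks _≟_ src public

  data Trail : V → List E → V → Set where
    []  : ∀ {w} → Trail w [] w
    _∷_ : ∀ e {l w} → Trail (tgt e) l w → Trail (src e) (e ∷ l) w

  Trail-uncons : ∀ {u e l w} → Trail u (e ∷ l) w → u ≡ src e × Trail (tgt e) l w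
  Trail-uncons (_ ∷ τ) = refl , τ

  data Reach (m : List E) (w : V) : V → Set where
    here : Reach m w w
    via  : ∀ {v e} → last (out v m) ≡ just e → Reach m w (tgt e) → Reach m w v

  Exits : List E → V → Set
  Exits m w = ∀ {e} → e ∈ₗ m → Reach m w (src e)

  -- Both trails have to take the first arc left at the current vertex, after which the departure
  -- orders still agree. When one trail stops, no departures are left for the other.
  Trail-unique : ∀ {u w l l′} → Trail u l w → Trail u l′ w → l ≈ˢ l′ → l ≡ l′
  Trail-unique []      []       eqs = refl
  Trail-unique []      (_∷_ e {l} τ) eqs = contradiction (trans (eqs _) (out-here refl l)) λ ()
  Trail-unique {w = w} (_∷_ e {l} τ) τ₂ eqs = go τ₂ refl eqs
    where
    go : ∀ {u l′} → Trail u l′ w → u ≡ src e → (e ∷ l) ≈ˢ l′ → e ∷ l ≡ l′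
    go []            p eqs = contradiction (trans (sym (eqs _)) (out-here refl l)) λ ()
    go (_∷_ f {l′} τ′) p eqs =
      match (List.∷-injectiveˡ (trans (sym (out-here refl l)) (trans (eqs (src e)) (out-here p l′)))) τ′ eqs
      where
      match : ∀ {f l′} → e ≡ f → Trail (tgt f) l′ w → (e ∷ l) ≈ˢ (f ∷ l′) → e ∷ l ≡ f ∷ l′
      match {l′ = l′} refl τ′ eqs = cong (e ∷_) (Trail-unique τ τ′ (≈ˢ-tail {l = l} {l′ = l′} eqs))

  -- Induction from the end of the trail. If the source of e is left again later, its last arc is
  -- among the later ones; otherwise e is its last arc, and leads to the vertex where the rest of
  -- the trail starts.
  Trail⇒Exits : ∀ {u w l} → Trail u l w → Exits l w
  Trail⇒Exits {w = w} {e ∷ l} (.e ∷ τ) = λ { (here refl) → at-head ; (there p) → weaken (Trail⇒Exits τ p) }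
    where
    weaken : ∀ {v} → Reach l w v → Reach (e ∷ l) w v
    weaken here = here
    weaken (via {v} {f} le r) = via le′ (weaken r)
      where
      le′ : last (out v (e ∷ l)) ≡ just f
      le′ with src e ≟ v
      ... | yes p = last-∷ e (out v l) le
      ... | no ¬p = le
    start : ∀ {u l} → Trail u l w → Exits l w → Reach l w u
    start []       _ = here
    start (e ∷ τ) h = h (here refl)
    at-head : Reach (e ∷ l) w (src e)
    at-head with out (src e) l in eq
    ... | []    = via (cong last (trans (out-here refl l) (cong (e ∷_) eq))) (weaken (start τ (Trail⇒Exits τ)))
    ... | f ∷ _ with f∈ , sf ← ∈-out⁻ l (subst (f ∈ₗ_) (sym eq) (here refl)) =
      subst (Reach (e ∷ l) w) sf (weaken (Trail⇒Exits τ f∈))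

  into : V → List E → List E
  into v = filter (λ e → tgt e ≟ v)

  δ : V → V → ℕ
  δ u v = if does (u ≟ v) then 1 else 0

  -- The degree condition for an Eulerian trail from u to w: the deltas supply the missing departure
  -- from w and the missing arrival at u.
  Balanced : V → V → List E → Set
  Balanced u w m = ∀ v → length (out v m) + δ w v ≡ length (into v m) + δ u v

  δ-refl : ∀ v → δ v v ≡ 1
  δ-refl v rewrite dec-true (v ≟ v) refl = refl

  δ-≢ : ∀ {u v} → u ≢ v → δ u v ≡ 0
  δ-≢ {u} {v} ≢ rewrite dec-false (u ≟ v) ≢ = refl

  private
    length-filter-∷ : (f : E → V) (v : V) (e : E) (m : List E) →
      length (filter (λ e → f e ≟ v) (e ∷ m)) ≡ δ (f e) v + length (filter (λ e → f e ≟ v) m)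
    length-filter-∷ f v e m with f e ≟ v
    ... | yes _ = refl
    ... | no  _ = refl

    length-filter-↭ : (f : E → V) (v : V) {m m′ : List E} → m ↭ m′ →
      length (filter (λ e → f e ≟ v) m) ≡ length (filter (λ e → f e ≟ v) m′)
    length-filter-↭ f v p = ↭.↭-length (↭.filter-↭ (λ e → f e ≟ v) p)

  Reach-end : ∀ {m w v} → Reach m w v → v ≡ w ⊎ ∃ λ e → e ∈ₗ m × tgt e ≡ w
  Reach-end here = inj₁ refl
  Reach-end {m} (via {v} {e} le r) with Reach-end r
  ... | inj₁ p = inj₂ (e , proj₁ (∈-out⁻ m (last-∈ (out v m) le)) , p)
  ... | inj₂ p = inj₂ p

  module _ {m w u e s} (a b : List E) (m≡ : m ≡ a ++ e ∷ b) (out-a : out u a ≡ []) (out-b : out u b ≡ s)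
           (src-e : src e ≡ u) (balanced : Balanced u w m) where
    private
      m′ : List E
      m′ = a ++ b

      m↭ : m ↭ e ∷ m′
      m↭ = subst (_↭ e ∷ m′) (sym m≡) (↭.shift e a b)

      out-m′ : ∀ v → out v m′ ≡ out v a ++ out v b
      out-m′ v = List.filter-++ (λ e → src e ≟ v) a b

      out-m : ∀ v → out v m ≡ out v a ++ out v (e ∷ b)
      out-m v = trans (cong (out v) m≡) (List.filter-++ (λ e → src e ≟ v) a (e ∷ b))

    rest-≢ : ∀ {v} → v ≢ u → out v m ≡ out v (a ++ b)
    rest-≢ {v} v≢u = trans (out-m v) (trans (cong (out v a ++_) (out-there (λ p → v≢u (trans (sym p) src-e)) b))
                       (sym (out-m′ v)))

    rest-≡ : out u (a ++ b) ≡ s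
    rest-≡ = trans (out-m′ u) (trans (cong (_++ out u b) out-a) out-b)

    whole-≡ : out u m ≡ e ∷ s
    whole-≡ = trans (out-m u) (trans (cong (_++ out u (e ∷ b)) out-a) (trans (out-here src-e b) (cong (e ∷_) out-b)))

    rest-≈ : ∀ {l} → l ≈ˢ (a ++ b) → (e ∷ l) ≈ˢ m
    rest-≈ {l} eqs v with u ≟ v
    ... | yes refl = trans (out-here src-e l) (trans (cong (e ∷_) (trans (eqs u) rest-≡)) (sym whole-≡))
    ... | no  u≢v  = trans (out-there (u≢v ∘ trans (sym src-e)) l) (trans (eqs v) (sym (rest-≢ (u≢v ∘ sym))))

    rest-balanced : Balanced (tgt e) w (a ++ b)
    rest-balanced v = ℕ.+-cancelˡ-≡ (δ u v) _ _ (begin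
      δ u v + (length (out v m′) + δ w v)         ≡⟨ sym (ℕ.+-assoc (δ u v) _ _) ⟩
      δ u v + length (out v m′) + δ w v           ≡⟨ cong (λ x → δ x v + length (out v m′) + δ w v) (sym src-e) ⟩
      δ (src e) v + length (out v m′) + δ w v     ≡⟨ cong (_+ δ w v) (sym (trans (length-filter-↭ src v m↭) (length-filter-∷ src v e m′))) ⟩
      length (out v m) + δ w v                    ≡⟨ balanced v ⟩
      length (into v m) + δ u v                   ≡⟨ cong (_+ δ u v) (trans (length-filter-↭ tgt v m↭) (length-filter-∷ tgt v e m′)) ⟩
      δ (tgt e) v + length (into v m′) + δ u v    ≡⟨ ℕ.+-comm _ (δ u v) ⟩
      δ u v + (δ (tgt e) v + length (into v m′))  ≡⟨ cong (δ u v +_) (ℕ.+-comm (δ (tgt e) v) _) ⟩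
      δ u v + (length (into v m′) + δ (tgt e) v)  ∎)
      where open ≡-Reasoning

    rest-exits : Exits m w → Exits (a ++ b) w
    rest-exits exits {e′} e′∈ = keep (exits (↭.∈-resp-↭ (↭-sym m↭) (there e′∈)))
      λ (p , s≡[] , _) → contradiction (subst (e′ ∈ₗ_) (trans rest-≡ s≡[]) (∈-out⁺ e′∈ p)) λ ()
      where
      -- Once its last arc is used, the vertex u is never visited again.
      Exhausted : V → Set
      Exhausted v = v ≡ u × s ≡ [] × u ≢ w
      -- The only departure left at u belongs to the present visit, so balance allows no further
      -- arrival.
      into-u : s ≡ [] → u ≢ w → into u m ≡ []
      into-u s≡[] u≢w = length≡0 (into u m) (ℕ.+-cancelʳ-≡ 1 _ 0 (begin
        length (into u m) + 1      ≡⟨ cong (length (into u m) +_) (sym (δ-refl u)) ⟩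
        length (into u m) + δ u u  ≡⟨ sym (balanced u) ⟩
        length (out u m) + δ w u   ≡⟨ cong₂ _+_ (cong length (trans whole-≡ (cong (e ∷_) s≡[]))) (δ-≢ (u≢w ∘ sym)) ⟩
        1                          ∎))
        where
        open ≡-Reasoning
        length≡0 : (l : List E) → length l ≡ 0 → l ≡ []
        length≡0 [] _ = refl
      last-s : ∀ s {f} → s ≢ [] → last (e ∷ s) ≡ just f → last s ≡ just f
      last-s []      s≢[] le = contradiction refl s≢[]
      last-s (_ ∷ _) s≢[] le = le
      keep : ∀ {v} → Reach m w v → ¬ Exhausted v → Reach m′ w v
      keep here _ = here
      keep (via {v} {f} le r) alive with v ≟ w
      ... | yes refl = here
      ... | no  v≢w  = via le′ (keep r λ (p , s≡[] , u≢w) → contradiction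
          (subst (f ∈ₗ_) (into-u s≡[] u≢w) (∈.∈-filter⁺ (λ e → tgt e ≟ u) (proj₁ (∈-out⁻ m (last-∈ _ le))) p)) λ ())
        where
        le′ : last (out v m′) ≡ just f
        le′ with v ≟ u
        ... | yes refl = trans (cong last rest-≡) (last-s s (λ s≡[] → alive (refl , s≡[] , v≢w))
                           (trans (cong last (sym whole-≡)) le))
        ... | no  v≢u  = trans (cong last (sym (rest-≢ v≢u))) le

  trail-exists : ∀ {u w} m → Balanced u w m → Exits m w → ∃ λ l → Trail u l w × l ↭ m × l ≈ˢ m
  trail-exists {w = w} m balanced exits = go (length m) m refl balanced exits
    where
    go : ∀ {u} n m → length m ≡ n → Balanced u w m → Exits m w → ∃ λ l → Trail u l w × l ↭ m × l ≈ˢ m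
    go {u} n m len balanced exits with out u m in out-u
    ... | [] = finish m refl
      where
      -- Without departures left, balance at u forces u to be w and leaves no arrival at w. An arc
      -- that still remained would lead to w along last arcs, which would need a departure from w or
      -- an arrival at w.
      stuck : 0 + δ w u ≡ length (into u m) + 1
      stuck = trans (cong (λ l → length l + δ w u) (sym out-u)) (trans (balanced u) (cong (length (into u m) +_) (δ-refl u)))
      w≡u : w ≡ u
      w≡u with w ≟ u | stuck
      ... | yes p | _ = p
      ... | no  _ | e = contradiction (trans e (ℕ.+-comm _ 1)) λ ()
      into-u : length (into u m) ≡ 0
      into-u = ℕ.+-cancelʳ-≡ 1 _ 0 (trans (sym stuck) (trans (cong (δ w) (sym w≡u)) (δ-refl w)))
      finish : ∀ m′ → m ≡ m′ → ∃ λ l → Trail u l w × l ↭ m × l ≈ˢ m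
      finish []       m≡ = [] , subst (Trail u []) (sym w≡u) [] , subst ([] ↭_) (sym m≡) ↭-refl , λ v → cong (out v) (sym m≡)
      finish (e ∷ _) refl with Reach-end (exits (here refl))
      ... | inj₁ p           = contradiction (subst (e ∈ₗ_) out-u (∈-out⁺ (here refl) (trans p w≡u))) λ ()
      ... | inj₂ (f , f∈ , p) = contradiction
        (subst (0 <_) into-u (List.filter-some (λ e → tgt e ≟ u) (Any.map (λ { refl → trans p w≡u }) f∈))) λ ()
    go {u} zero    [] len balanced exits | _ ∷ _ = contradiction out-u λ ()
    go {u} (suc n) m  len balanced exits | e ∷ s
      with a , b , m≡ , out-a , out-b , src-e ← filter-∷⁻ (λ e → src e ≟ u) m out-u
      with l , τ , p , eqs ← go n (a ++ b) (ℕ.suc-injective (trans (sym (trans (cong length m≡) (↭.↭-length (↭.shift e a b)))) len))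
             (rest-balanced a b m≡ out-a out-b src-e balanced) (rest-exits a b m≡ out-a out-b src-e balanced exits) =
      e ∷ l , subst (λ v → Trail v (e ∷ l) w) src-e (e ∷ τ)
      , ↭-trans (↭-prep e p) (subst (e ∷ a ++ b ↭_) (sym m≡) (↭-sym (↭.shift e a b)))
      , rest-≈ a b m≡ out-a out-b src-e balanced eqs

  -- The map ι pairs each arc with one that leaves its target. It will be `turn` or a `jump`, which
  -- move to another vertex of the same hyperedge.
  Balanced-circuit : ∀ {u m} (ι : E → E) → (∀ e → src (ι e) ≡ tgt e) → map ι m ↭ m → Balanced u u m
  Balanced-circuit {u} {m} ι src-ι p v = cong (_+ δ u v) (trans (sym (length-filter-↭ src v p)) (count m))
    where
    count : ∀ m → length (out v (map ι m)) ≡ length (into v m)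
    count []      = refl
    count (e ∷ m) = trans (length-filter-∷ src v (ι e) (map ι m)) (trans (cong₂ _+_ (cong (λ x → δ x v) (src-ι e)) (count m))
                      (sym (length-filter-∷ tgt v e m)))

  Trail-follows : ∀ {f z u l w} → Follows f z l → Trail u l w → src z ≡ w → ∀ {y} → y ∈ₗ l → src (f y) ≡ tgt y
  Trail-follows {l = x ∷ []}    (e ∷ _) (.x ∷ []) z≡ (here refl) = trans (cong src e) z≡
  Trail-follows {l = x ∷ _ ∷ _} (e ∷ _) (.x ∷ τ)  z≡ (here refl) = trans (cong src e) (sym (proj₁ (Trail-uncons τ)))
  Trail-follows                 (_ ∷ F) (_ ∷ τ)   z≡ (there p)   = Trail-follows F τ z≡ p

  follows-Trail : ∀ {f z l} → Follows f z l → (∀ y → src (f y) ≡ tgt y) → Trail (src (headOr z l)) l (src z)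
  follows-Trail [] h = []
  follows-Trail {z = z} {x ∷ l} (e ∷ F) h =
    x ∷ subst (λ v → Trail v l (src z)) (trans (cong src (sym e)) (h x)) (follows-Trail F h)

-- Runs of consecutive types

descend : {X : Set} → (X → X) → ℕ → X → X
descend f zero    x = x
descend f (suc i) x = descend f i (f x)

-- How α moves along the runs of R, where dep R t is the length of the run
-- of elements t, t-1, … of R.
record RunLaws {k} (pre : Fin k → Fin k) (al : Fin k → Subset k → Fin k) (dep : Subset k → Fin k → ℕ)
               (R : Subset k) : Set where
  base : Fin k → Fin k
  base t = descend pre (dep R t) t
  field
    dep-∉        : ∀ {t} → t ∉ R → dep R t ≡ 0
    dep-∈        : ∀ {t} → t ∈ R → dep R t ≡ suc (dep R (pre t))
    al-∈         : ∀ {t} → t ∈ R → al t R ≡ pre t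
    al-∉         : ∀ {t} → t ∉ R → descend pre (dep R (al t R)) (al t R) ≡ t
    al-injective : ∀ {t u} → al t R ≡ al u R → t ≡ u
    base-∉       : ∀ t → base t ∉ R
    base-run     : ∀ t → ∃[ j ] j + dep R t ≡ dep R (al (base t) R) × descend pre j (al (base t) R) ≡ t

  dep-suc⇒∈ : ∀ {t m} → dep R t ≡ suc m → t ∈ R
  dep-suc⇒∈ {t} e = decidable-stable (t ∈? R) λ p → contradiction (trans (sym e) (dep-∉ p)) λ ()

  dep-pred : ∀ {t m} → dep R t ≡ suc m → dep R (pre t) ≡ m
  dep-pred e = ℕ.suc-injective (trans (sym (dep-∈ (dep-suc⇒∈ e))) e)

module Cyclic (k′ : ℕ) where

  private
    k : ℕ
    k = suc k′

  toℕ-⊕ : ∀ (t : Fin k) j → toℕ (t ⊕ j) ≡ (toℕ t + j) % k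
  toℕ-⊕ t j = Fin.toℕ-fromℕ< (ℕ.m%n<n (toℕ t + j) k)

  ⊕-0 : ∀ (t : Fin k) → t ⊕ 0 ≡ t
  ⊕-0 t = Fin.toℕ-injective (trans (toℕ-⊕ t 0)
    (trans (cong (_% k) (ℕ.+-identityʳ (toℕ t))) (ℕ.m<n⇒m%n≡m (Fin.toℕ<n t))))

  ⊕-k : ∀ (t : Fin k) → t ⊕ k ≡ t
  ⊕-k t = Fin.toℕ-injective (trans (toℕ-⊕ t k) (trans (ℕ.[m+n]%n≡m%n (toℕ t) k) (ℕ.m<n⇒m%n≡m (Fin.toℕ<n t))))

  %-+ : ∀ x b → (x % k + b) % k ≡ (x + b) % k
  %-+ x b = trans (ℕ.%-distribˡ-+ (x % k) b k)
    (trans (cong (λ y → (y + b % k) % k) (ℕ.m%n%n≡m%n x k)) (sym (ℕ.%-distribˡ-+ x b k)))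

  ⊕-+ : ∀ (t : Fin k) a b → (t ⊕ a) ⊕ b ≡ t ⊕ (a + b)
  ⊕-+ t a b = Fin.toℕ-injective (begin
    toℕ ((t ⊕ a) ⊕ b)          ≡⟨ toℕ-⊕ (t ⊕ a) b ⟩
    (toℕ (t ⊕ a) + b) % k      ≡⟨ cong (λ x → (x + b) % k) (toℕ-⊕ t a) ⟩
    ((toℕ t + a) % k + b) % k  ≡⟨ %-+ (toℕ t + a) b ⟩
    (toℕ t + a + b) % k        ≡⟨ cong (_% k) (ℕ.+-assoc (toℕ t) a b) ⟩
    (toℕ t + (a + b)) % k      ≡⟨ sym (toℕ-⊕ t (a + b)) ⟩
    toℕ (t ⊕ (a + b))          ∎)
    where open ≡-Reasoning

  predecessor-⊕ : ∀ (t : Fin k) r → predecessor (t ⊕ suc r) ≡ t ⊕ r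
  predecessor-⊕ t r = trans (⊕-+ t (suc r) k′) (trans (cong (t ⊕_) (sym (ℕ.+-suc r k′)))
    (trans (sym (⊕-+ t r k)) (⊕-k (t ⊕ r))))

  successor-predecessor : ∀ (t : Fin k) → predecessor t ⊕ 1 ≡ t
  successor-predecessor t = trans (⊕-+ t k′ 1) (trans (cong (t ⊕_) (ℕ.+-comm k′ 1)) (⊕-k t))

  predecessor-successor : ∀ (t : Fin k) → predecessor (t ⊕ 1) ≡ t
  predecessor-successor t = trans (predecessor-⊕ t 0) (⊕-0 t)

  predecessor-injective : ∀ {t u : Fin k} → predecessor t ≡ predecessor u → t ≡ u
  predecessor-injective e = trans (sym (successor-predecessor _)) (trans (cong (_⊕ 1) e) (successor-predecessor _))

  offset : ∀ (s t : Fin k) → ∃ λ i → i < k × s ⊕ i ≡ t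
  offset s t = i , ℕ.m%n<n (toℕ t + (k ∸ toℕ s)) k , Fin.toℕ-injective (begin
    toℕ (s ⊕ i)                               ≡⟨ toℕ-⊕ s i ⟩
    (toℕ s + i) % k                           ≡⟨ cong (_% k) (ℕ.+-comm (toℕ s) i) ⟩
    (i + toℕ s) % k                           ≡⟨ %-+ (toℕ t + (k ∸ toℕ s)) (toℕ s) ⟩
    (toℕ t + (k ∸ toℕ s) + toℕ s) % k         ≡⟨ cong (_% k) (ℕ.+-assoc (toℕ t) _ _) ⟩
    (toℕ t + (k ∸ toℕ s + toℕ s)) % k         ≡⟨ cong (λ x → (toℕ t + x) % k) (ℕ.m∸n+n≡m (ℕ.<⇒≤ (Fin.toℕ<n s))) ⟩
    (toℕ t + k) % k                           ≡⟨ ℕ.[m+n]%n≡m%n (toℕ t) k ⟩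
    toℕ t % k                                 ≡⟨ ℕ.m<n⇒m%n≡m (Fin.toℕ<n t) ⟩
    toℕ t                                     ∎)
    where
    open ≡-Reasoning
    i : ℕ
    i = (toℕ t + (k ∸ toℕ s)) % k

  down : ℕ → Fin k → Fin k
  down = descend predecessor

  down-⊕ : ∀ i (t : Fin k) → down i (t ⊕ i) ≡ t
  down-⊕ zero    t = ⊕-0 t
  down-⊕ (suc i) t = trans (cong (down i) (predecessor-⊕ t i)) (down-⊕ i t)

  ⊕-down : ∀ i (t : Fin k) → down i t ⊕ i ≡ t
  ⊕-down zero    t = ⊕-0 t
  ⊕-down (suc i) t = trans (cong (down i (predecessor t) ⊕_) (sym (ℕ.+-comm i 1)))
    (trans (sym (⊕-+ (down i (predecessor t)) i 1)) (trans (cong (_⊕ 1) (⊕-down i (predecessor t))) (successor-predecessor t)))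

  private
    run : Subset k → ℕ → Fin k → ℕ
    run R zero    t = 0
    run R (suc f) t = if does (t ∈? R) then suc (run R f (predecessor t)) else 0

  -- Meaningless if R contains everything.
  depth : Subset k → Fin k → ℕ
  depth R = run R k

  module Runs (R : Subset k) (strict : ∃ λ s → s ∉ R) where

    private
      -- The type i steps below t is outside R, so that the recursion stops there at the latest and
      -- never touches the fuel beyond i.
      run-fuel : ∀ i f f′ t → down i t ∉ R → i ≤ f → i ≤ f′ → run R f t ≡ run R f′ t
      run-fuel zero zero zero t ∉R _ _ = refl
      run-fuel zero zero (suc f′) t ∉R _ _ rewrite dec-false (t ∈? R) ∉R = refl
      run-fuel zero (suc f) zero t ∉R _ _ rewrite dec-false (t ∈? R) ∉R = refl
      run-fuel zero (suc f) (suc f′) t ∉R _ _ rewrite dec-false (t ∈? R) ∉R = refl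
      run-fuel (suc i) (suc f) (suc f′) t ∉R (s≤s i≤f) (s≤s i≤f′) with does (t ∈? R)
      ... | true  = cong suc (run-fuel i f f′ (predecessor t) ∉R i≤f i≤f′)
      ... | false = refl

    depth-∉ : ∀ {t} → t ∉ R → depth R t ≡ 0
    depth-∉ {t} t∉R rewrite dec-false (t ∈? R) t∉R = refl

    depth-∈ : ∀ {t} → t ∈ R → depth R t ≡ suc (depth R (predecessor t))
    depth-∈ {t} t∈R with offset (proj₁ strict) t
    ... | zero  , _         , e = contradiction (subst (_∈ R) (trans (sym e) (⊕-0 _)) t∈R) (proj₂ strict)
    ... | suc i , s≤s i<k′ , refl rewrite dec-true ((proj₁ strict ⊕ suc i) ∈? R) t∈R =
      -- One unit of fuel has been spent, but the missing type lies fewer than k′ steps below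
      -- `predecessor t`, so that k′ and k units give the same result.
      cong suc (run-fuel i k′ k _ (subst (_∉ R) (sym (down-⊕ (suc i) _)) (proj₂ strict)) (ℕ.<⇒≤ i<k′) (ℕ.m≤n⇒m≤1+n (ℕ.<⇒≤ i<k′)))

    depth-suc⇒∈ : ∀ {t m} → depth R t ≡ suc m → t ∈ R
    depth-suc⇒∈ {t} e = decidable-stable (t ∈? R) λ p → contradiction (trans (sym e) (depth-∉ {t} p)) λ ()

    depth-pred : ∀ {t m} → depth R t ≡ suc m → depth R (predecessor t) ≡ m
    depth-pred {t} e = ℕ.suc-injective (trans (sym (depth-∈ {t} (depth-suc⇒∈ {t} e))) e)

    depth-down : ∀ j m {t} → depth R t ≡ j + m → depth R (down j t) ≡ m
    depth-down zero    m e = e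
    depth-down (suc j) m {t} e = depth-down j m {predecessor t} (depth-pred {t} e)

    down-depth-∉ : ∀ t → down (depth R t) t ∉ R
    down-depth-∉ t p = contradiction
      (trans (sym (depth-down (depth R t) 0 (sym (ℕ.+-identityʳ _)))) (depth-∈ p)) λ ()

    private
      above : ∀ {t} → t ∉ R → ∃ λ r → (∀ i → i ≤ r → depth R (t ⊕ i) ≡ i) × t ⊕ suc r ∉ R × α t R ≡ t ⊕ r
      above {t} t∉R with r , in-run , out , e ← α-∉ t∉R = r , heights , out , e
        where
        heights : ∀ i → i ≤ r → depth R (t ⊕ i) ≡ i
        heights zero    _   = trans (cong (depth R) (⊕-0 t)) (depth-∉ t∉R)
        heights (suc i) i<r = trans (depth-∈ (in-run (suc i) (s≤s z≤n) i<r))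
          (cong suc (trans (cong (depth R) (predecessor-⊕ t i)) (heights i (ℕ.<⇒≤ i<r))))

    α-∉-down : ∀ {t} → t ∉ R → down (depth R (α t R)) (α t R) ≡ t
    α-∉-down {t} t∉R with r , heights , _ , e ← above t∉R rewrite e | heights r ℕ.≤-refl = down-⊕ r t

    α-∉-top : ∀ {t} → t ∉ R → α t R ⊕ 1 ∉ R
    α-∉-top {t} t∉R with r , _ , out , e ← above t∉R rewrite e =
      subst (_∉ R) (sym (trans (⊕-+ t r 1) (cong (t ⊕_) (ℕ.+-comm r 1)))) out

    -- The type after α(t , R) belongs to R exactly if t does, so the two clauses of α have disjoint
    -- images, and each of them can be inverted.
    α-injective : ∀ {t u} → α t R ≡ α u R → t ≡ u
    α-injective {t} {u} e = cases (t ∈? R) (u ∈? R)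
      where
      cases : Dec (t ∈ R) → Dec (u ∈ R) → t ≡ u
      cases (yes p) (yes q) = predecessor-injective (trans (sym (α-∈ p)) (trans e (α-∈ q)))
      cases (yes p) (no  q) = contradiction
        (subst (_∈ R) (trans (sym (successor-predecessor t)) (cong (_⊕ 1) (trans (sym (α-∈ p)) e))) p) (α-∉-top q)
      cases (no  p) (yes q) = contradiction
        (subst (_∈ R) (trans (sym (successor-predecessor u)) (cong (_⊕ 1) (trans (sym (α-∈ q)) (sym e)))) q) (α-∉-top p)
      cases (no  p) (no  q) = trans (sym (α-∉-down p)) (trans (cong (λ x → down (depth R x) x) e) (α-∉-down q))

    -- α jumps from the base of t over the run that contains t.
    base : Fin k → Fin k
    base t = down (depth R t) t

    base-run : ∀ t → ∃ λ j → j + depth R t ≡ depth R (α (base t) R) × down j (α (base t) R) ≡ t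
    base-run t with r , heights , out , e ← above (down-depth-∉ t) rewrite e =
      r ∸ depth R t , trans (ℕ.m∸n+n≡m d≤r) (sym (heights r ℕ.≤-refl)) , (begin
        down (r ∸ d) (base t ⊕ r)                ≡⟨ cong (λ x → down (r ∸ d) (base t ⊕ x)) (sym (ℕ.m+[n∸m]≡n d≤r)) ⟩
        down (r ∸ d) (base t ⊕ (d + (r ∸ d)))    ≡⟨ cong (down (r ∸ d)) (sym (⊕-+ (base t) d (r ∸ d))) ⟩
        down (r ∸ d) ((base t ⊕ d) ⊕ (r ∸ d))    ≡⟨ down-⊕ (r ∸ d) _ ⟩
        base t ⊕ d                               ≡⟨ ⊕-down d t ⟩
        t                                        ∎)
      where
      open ≡-Reasoning
      d : ℕ
      d = depth R t
      inside-run : ∀ i j → j + suc i ≡ d → base t ⊕ suc i ∈ R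
      inside-run i j e = depth-suc⇒∈ (trans (cong (depth R) here′) (depth-down j (suc i) (sym e)))
        where
        down-+ : ∀ a b (t : Fin k) → down (a + b) t ≡ down b (down a t)
        down-+ zero    b t = refl
        down-+ (suc a) b t = down-+ a b (predecessor t)
        here′ : base t ⊕ suc i ≡ down j t
        here′ = trans (cong (_⊕ suc i) (trans (cong (λ x → down x t) (sym e)) (down-+ j (suc i) t))) (⊕-down (suc i) (down j t))
      -- All types above the base up to t belong to R, so the search cannot have stopped before t.
      d≤r : d ≤ r
      d≤r with d ≤? r
      ... | yes p = p
      ... | no  p = contradiction (inside-run r (d ∸ suc r) (ℕ.m∸n+n≡m (ℕ.≰⇒> p))) out

  runLaws : ∀ R → (∃[ t ] t ∉ R) → RunLaws predecessor α depth R
  runLaws R strict = record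
    { dep-∉ = depth-∉ ; dep-∈ = λ {t} → depth-∈ {t} ; al-∈ = α-∈ ; al-∉ = λ {t} → α-∉-down {t}
    ; al-injective = λ {t} {u} → α-injective {t} {u} ; base-∉ = down-depth-∉ ; base-run = base-run }
    where open Runs R strict

-- Tours of the coloured vertices and tours of the types

-- The predicate sees an entry together with the list after it, since levels and stacks are
-- functions of the remaining walk.
data Suffixes {X : Set} (P : X → List X → Set) : List X → Set where
  []  : Suffixes P []
  _∷_ : ∀ {y b} → P y b → Suffixes P b → Suffixes P (y ∷ b)

module _ {X : Set} where

  Suffixes-map : {P Q : X → List X → Set} {l : List X} → (∀ {y b} → y ∈ₗ l → P y b → Q y b) →
                 Suffixes P l → Suffixes Q l
  Suffixes-map f []      = []
  Suffixes-map f (x ∷ s) = f (here refl) x ∷ Suffixes-map (λ p → f (there p)) s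

  Suffixes-lookup : {P : X → List X → Set} {l : List X} → Suffixes P l → ∀ {y} → y ∈ₗ l → ∃ λ b → P y b
  Suffixes-lookup (x ∷ s) (here refl) = _ , x
  Suffixes-lookup (x ∷ s) (there p)   = Suffixes-lookup s p

  Suffixes-zip : {P Q S : X → List X → Set} {l : List X} → (∀ {y b} → P y b → Q y b → S y b) →
                 Suffixes P l → Suffixes Q l → Suffixes S l
  Suffixes-zip f []      []      = []
  Suffixes-zip f (x ∷ s) (y ∷ t) = f x y ∷ Suffixes-zip f s t

  Suffixes-head : {P : X → List X → Set} {y : X} {b : List X} → Suffixes P (y ∷ b) → P y b
  Suffixes-head (x ∷ _) = x

column : ∀ {k n} → (Fin n → Subset k) → Fin k → Subset n
column R t = Vec.tabulate (λ h → Vec.lookup (R h) t)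

∈-column⁺ : ∀ {k n} (R : Fin n → Subset k) {t h} → t ∈ R h → h ∈ column R t
∈-column⁺ R {t} p = ∈-tabulate⁺ (λ h → Vec.lookup (R h) t) (Vec.[]=⇒lookup p)

∈-column⁻ : ∀ {k n} (R : Fin n → Subset k) {t h} → h ∈ column R t → t ∈ R h
∈-column⁻ R {t} {h} p = Vec.lookup⇒[]= t (R h) (∈-tabulate⁻ (λ h → Vec.lookup (R h) t) p)

-- The cyclic order of the types and α enter only through the run laws, which keeps the arithmetic
-- modulo k out of this part. Entries of p may be zero, as the base case of the final induction
-- requires.
module Tours (k n : ℕ) (pre : Fin k → Fin k) (al : Fin k → Subset k → Fin k) (dep : Subset k → Fin k → ℕ)
             (laws : ∀ R → (∃[ t ] t ∉ R) → RunLaws pre al dep R)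
             (pre-injective : ∀ {t u} → pre t ≡ pre u → t ≡ u) (p : Vector ℕ k) where

  St : Set
  St = Fin k × Fin n

  states : List St
  states = cartesianProduct (allFin k) (allFin n)

  infix 4 _≟ₛ_ _≟ᵥ_

  opaque
    _≟ₛ_ : DecidableEquality St
    _≟ₛ_ = Product.≡-dec Fin._≟_ Fin._≟_

  states-unique : Unique states
  states-unique = Unique.cartesianProduct⁺ (Unique.allFin⁺ k) (Unique.allFin⁺ n)

  states-total : ∀ x → x ∈ₗ states
  states-total (t , h) = ∈.∈-cartesianProduct⁺ (∈.∈-allFin t) (∈.∈-allFin h)

  open Enumerated _≟ₛ_ states states-unique states-total public

  -- An arbitrary linear order on the states, to break ties.
  rank : St → ℕ
  rank (t , h) = toℕ (Data.Fin.Base.combine t h)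

  rank-injective : ∀ {x y} → rank x ≡ rank y → x ≡ y
  rank-injective {t , h} {u , g} e =
    let e₁ , e₂ = Fin.combine-injective t h u g (Fin.toℕ-injective e) in cong₂ _,_ e₁ e₂

  -- Coloured vertices: the colours of type t are Fin (p t), and nothing is
  -- the colour of the root.
  V : Set
  V = Σ (Fin k) λ t → Maybe (Fin (p t))

  opaque
    _≟ᵥ_ : DecidableEquality V
    _≟ᵥ_ = Product.≡-dec Fin._≟_ (Maybe.≡-dec Fin._≟_)

  Strict : (Fin n → Subset k) → Set
  Strict R = ∀ h → ∃[ t ] t ∉ R h

  Multiplicities : (Fin n → Subset k) → Set
  Multiplicities R = ∀ t → ∣ column R t ∣ ≡ p t

  module Jumps (R : Fin n → Subset k) where

    jump : St → St
    jump (t , h) = al t (R h) , h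

    depₛ : St → ℕ
    depₛ (t , h) = dep (R h) t

    -- The loss of height when leaving by x: 1 for an arc with t ∈ R_h, and otherwise minus the
    -- length of the run jumped over. Written as a difference of depths, it telescopes over a
    -- permutation of the states.
    weight : St → ℤ.ℤ
    weight x = ℤ.+ depₛ x ℤ.- ℤ.+ depₛ (jump x)

    -- The height of the walk at the start of the list l, if it is at
    -- height 0 at the end of l.
    level : List St → ℤ.ℤ
    level []      = ℤ.0ℤ
    level (x ∷ l) = weight x ℤ.+ level l

    -- A circuit is canonical if it starts from the lowest state, and from
    -- the one of least rank among these.
    Canonical : St → List St → Set
    Canonical x = Suffixes λ y b → ℤ.0ℤ ℤ.≤ level (y ∷ b) × (level (y ∷ b) ≡ ℤ.0ℤ → rank x ≤ rank y)

  module Levels (R : Fin n → Subset k) (strict : Strict R) where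

    open Jumps R public

    module Law h = RunLaws (laws (R h) (strict h))

    jump-injective : ∀ {x y} → jump x ≡ jump y → x ≡ y
    jump-injective {t , h} {u , g} e with refl ← cong proj₂ e = cong (_, h) (Law.al-injective h (cong proj₁ e))

    weight-pop : ∀ {t h} → t ∈ R h → weight (t , h) ≡ ℤ.1ℤ
    weight-pop {t} {h} t∈ = trans
      (cong₂ (λ a b → ℤ.+ a ℤ.- ℤ.+ dep (R h) b) (Law.dep-∈ h t∈) (Law.al-∈ h t∈))
      (trans (cong (ℤ._- ℤ.+ d) (ℤ.pos-+ 1 d)) (cancel ℤ.1ℤ (ℤ.+ d)))
      where
      d : ℕ
      d = dep (R h) (pre t)
      cancel : ∀ a b → (a ℤ.+ b) ℤ.- b ≡ a
      cancel = solve-∀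

    weight-jump : ∀ {t h} → t ∉ R h → weight (t , h) ≡ ℤ.- ℤ.+ depₛ (jump (t , h))
    weight-jump {t} {h} t∉ = trans (cong (λ a → ℤ.+ a ℤ.- ℤ.+ depₛ (jump (t , h))) (Law.dep-∉ h t∉)) (ℤ.+-identityˡ _)

    private
      level-telescope : ∀ l → level l ℤ.+ ℤ.+ ℕList.sum (map depₛ (map jump l)) ≡ ℤ.+ ℕList.sum (map depₛ l)
      level-telescope []      = refl
      level-telescope (x ∷ l) = begin
        (a ℤ.- b ℤ.+ level l) ℤ.+ ℤ.+ (depₛ (jump x) + c)    ≡⟨ cong (ℤ._+_ (a ℤ.- b ℤ.+ level l)) (ℤ.pos-+ (depₛ (jump x)) c) ⟩
        (a ℤ.- b ℤ.+ level l) ℤ.+ (b ℤ.+ ℤ.+ c)              ≡⟨ rearrange a b (level l) (ℤ.+ c) ⟩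
        a ℤ.+ (level l ℤ.+ ℤ.+ c)                            ≡⟨ cong (ℤ._+_ a) (level-telescope l) ⟩
        a ℤ.+ ℤ.+ ℕList.sum (map depₛ l)                     ≡⟨ sym (ℤ.pos-+ (depₛ x) _) ⟩
        ℤ.+ (depₛ x + ℕList.sum (map depₛ l))                ∎
        where
        open ≡-Reasoning
        a b : ℤ.ℤ
        a = ℤ.+ depₛ x
        b = ℤ.+ depₛ (jump x)
        c : ℕ
        c = ℕList.sum (map depₛ (map jump l))
        rearrange : ∀ a b l c → (a ℤ.- b ℤ.+ l) ℤ.+ (b ℤ.+ c) ≡ a ℤ.+ (l ℤ.+ c)
        rearrange = solve-∀

    -- The depths telescope since jump permutes the states.
    level-complete : ∀ {l} → l ↭ states → level l ≡ ℤ.0ℤ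
    level-complete {l} q = begin
      level l                                              ≡⟨ insert-and-remove (level l) (ℤ.+ s) ⟩
      (level l ℤ.+ ℤ.+ s) ℤ.- ℤ.+ s                        ≡⟨ cong (λ m → (level l ℤ.+ ℤ.+ m) ℤ.- ℤ.+ s) (sym (ℕList.sum-↭ (↭.map⁺ depₛ jump-↭))) ⟩
      (level l ℤ.+ ℤ.+ ℕList.sum (map depₛ (map jump l))) ℤ.- ℤ.+ s  ≡⟨ cong (ℤ._- ℤ.+ s) (level-telescope l) ⟩
      ℤ.+ s ℤ.- ℤ.+ s                                      ≡⟨ ℤ.+-inverseʳ (ℤ.+ s) ⟩
      ℤ.0ℤ                                                 ∎
      where
      open ≡-Reasoning
      insert-and-remove : ∀ a b → a ≡ (a ℤ.+ b) ℤ.- b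
      insert-and-remove = solve-∀
      s : ℕ
      s = ℕList.sum (map depₛ l)
      jump-↭ : map jump l ↭ l
      jump-↭ = ↭-trans (↭.map⁺ jump q) (↭-trans (injective⇒↭ jump jump-injective) (↭-sym q))

    private
      -- A potential for the whole cyclic tour. The levels computed from any starting point differ
      -- from it by a constant, as in the cycle lemma.
      Height : (St → St) → (St → ℤ.ℤ) → Set
      Height σ H = ∀ y → H y ≡ weight y ℤ.+ H (σ y)

      levelAt : List St → St → ℤ.ℤ
      levelAt []      y = ℤ.0ℤ
      levelAt (x ∷ l) y = if does (y ≟ₛ x) then level (x ∷ l) else levelAt l y

      levelAt-suffix : ∀ {l} → Unique l → Suffixes (λ y b → levelAt l y ≡ level (y ∷ b)) l
      levelAt-suffix []                 = []
      levelAt-suffix {x ∷ l} (x∉ ∷ u) = first ∷ Suffixes-map (λ {y} {b} → later {y} {b}) (levelAt-suffix u)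
        where
        first : levelAt (x ∷ l) x ≡ level (x ∷ l)
        first rewrite dec-true (x ≟ₛ x) refl = refl
        later : ∀ {y b} → y ∈ₗ l → levelAt l y ≡ level (y ∷ b) → levelAt (x ∷ l) y ≡ level (y ∷ b)
        later {y} y∈ e rewrite dec-false (y ≟ₛ x) (λ y≡x → All.lookup x∉ y∈ (sym y≡x)) = e

      height-from : ∀ {σ z l} {H : St → ℤ.ℤ} → H z ≡ ℤ.0ℤ → Follows σ z l → Suffixes (λ y b → H y ≡ level (y ∷ b)) l →
                    ∀ {y} → y ∈ₗ l → H y ≡ weight y ℤ.+ H (σ y)
      height-from {H = H} Hz (e ∷ [])       (s ∷ [])      (here refl) =
        trans s (cong (ℤ._+_ (weight _)) (sym (trans (cong H e) Hz)))
      height-from {H = H} Hz (e ∷ (_ ∷ _)) (s ∷ (s′ ∷ _)) (here refl) =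
        trans s (cong (ℤ._+_ (weight _)) (sym (trans (cong H e) s′)))
      height-from Hz (_ ∷ F) (_ ∷ S) (there q) = height-from Hz F S q

      -- The levels along the tour from an arbitrary state; they fit together where the tour closes
      -- because the total weight vanishes.
      height-exists : ∀ {σ} → SingleCycle σ → St → Σ (St → ℤ.ℤ) (Height σ)
      height-exists {σ} sc x = H , λ y → height-from Hx (cycle-follows sc x) suffix (complete⇒total complete y)
        where
        complete : iterate σ x size ↭ states
        complete = cycle-complete sc x
        H : St → ℤ.ℤ
        H = levelAt (iterate σ x size)
        suffix : Suffixes (λ y b → H y ≡ level (y ∷ b)) (iterate σ x size)
        suffix = levelAt-suffix (complete⇒unique complete)
        H-head : ∀ m → iterate σ x m ↭ states → levelAt (iterate σ x m) x ≡ level (iterate σ x m)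
        H-head zero    q = refl
        H-head (suc m) q = Suffixes-head (levelAt-suffix (complete⇒unique q))
        Hx : H x ≡ ℤ.0ℤ
        Hx = trans (H-head size complete) (level-complete complete)

      level-height : ∀ {σ H z l} → Height σ H → Follows σ z l → Suffixes (λ y b → level (y ∷ b) ≡ H y ℤ.- H z) l
      level-height ht [] = []
      level-height {H = H} {z} ht (_∷_ {y} {[]} e []) = (begin
        weight y ℤ.+ ℤ.0ℤ               ≡⟨ solve₁ (weight y) (H z) ⟩
        (weight y ℤ.+ H z) ℤ.- H z      ≡⟨ cong (λ w → (weight y ℤ.+ H w) ℤ.- H z) (sym e) ⟩
        (weight y ℤ.+ H (_)) ℤ.- H z    ≡⟨ cong (ℤ._- H z) (sym (ht y)) ⟩
        H y ℤ.- H z                     ∎) ∷ []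
        where
        open ≡-Reasoning
        solve₁ : ∀ a b → a ℤ.+ ℤ.0ℤ ≡ (a ℤ.+ b) ℤ.- b
        solve₁ = solve-∀
      level-height {H = H} {z} ht (_∷_ {y} {y′ ∷ b} e F) with S ← level-height {H = H} ht F = (begin
        weight y ℤ.+ level (y′ ∷ b)     ≡⟨ cong (ℤ._+_ (weight y)) (Suffixes-head S) ⟩
        weight y ℤ.+ (H y′ ℤ.- H z)     ≡⟨ sym (ℤ.+-assoc (weight y) (H y′) _) ⟩
        (weight y ℤ.+ H y′) ℤ.- H z     ≡⟨ cong (λ w → (weight y ℤ.+ H w) ℤ.- H z) (sym e) ⟩
        (weight y ℤ.+ H (_)) ℤ.- H z    ≡⟨ cong (ℤ._- H z) (sym (ht y)) ⟩
        H y ℤ.- H z                     ∎) ∷ S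
        where open ≡-Reasoning

      -- In terms of a potential, `Canonical` means being minimal for H first and `rank` second,
      -- which gives existence and uniqueness.
      Lowest : (St → ℤ.ℤ) → St → Set
      Lowest H x = ∀ y → H x ℤ.≤ H y × (H y ≡ H x → rank x ≤ rank y)

      lowest⇒canonical : ∀ {σ H x} → Height σ H → SingleCycle σ → Lowest H x → Canonical x (iterate σ x size)
      lowest⇒canonical {σ} {H} {x} ht sc low = Suffixes-map
        (λ {y} _ e → subst (ℤ.0ℤ ℤ.≤_) (sym e) (ℤ.i≤j⇒0≤j-i (proj₁ (low y)))
                   , λ e₀ → proj₂ (low y) (ℤ.i-j≡0⇒i≡j (H y) (H x) (trans (sym e) e₀)))
        (level-height {H = H} ht (cycle-follows sc x))

      canonical⇒lowest : ∀ {σ H x} → Height σ H → SingleCycle σ → Canonical x (iterate σ x size) → Lowest H x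
      canonical⇒lowest {σ} {H} {x} ht sc can y =
        let _ , e , nonneg , least = Suffixes-lookup (Suffixes-zip _,_ (level-height {H = H} ht (cycle-follows sc x)) can)
                                       (complete⇒total (cycle-complete sc x) y)
        in ℤ.0≤i-j⇒j≤i (subst (ℤ.0ℤ ℤ.≤_) e nonneg) , λ e₀ → least (trans e (ℤ.i≡j⇒i-j≡0 {H y} {H x} e₀))

      lowest-exists : (H : St → ℤ.ℤ) → St → ∃ (Lowest H)
      lowest-exists H x =
        let m , _ , least = minimum {_⊑_ = _⊑_} total ⊑-trans x states in m , λ y → below (least (there (states-total y)))
        where
        _⊑_ : St → St → Set
        x ⊑ y = H x ℤ.< H y ⊎ H x ≡ H y × rank x ≤ rank y
        total : ∀ x y → x ⊑ y ⊎ y ⊑ x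
        total x y with ℤ.<-cmp (H x) (H y) | ℕ.≤-total (rank x) (rank y)
        ... | tri< a _ _ | _      = inj₁ (inj₁ a)
        ... | tri> _ _ a | _      = inj₂ (inj₁ a)
        ... | tri≈ _ e _ | inj₁ q = inj₁ (inj₂ (e , q))
        ... | tri≈ _ e _ | inj₂ q = inj₂ (inj₂ (sym e , q))
        ⊑-trans : ∀ {x y z} → x ⊑ y → y ⊑ z → x ⊑ z
        ⊑-trans (inj₁ a)       (inj₁ b)        = inj₁ (ℤ.<-trans a b)
        ⊑-trans {x} (inj₁ a)       (inj₂ (e , _))  = inj₁ (subst (ℤ._<_ (H x)) e a)
        ⊑-trans {z = z} (inj₂ (e , _)) (inj₁ b)    = inj₁ (subst (λ i → i ℤ.< H z) (sym e) b)
        ⊑-trans (inj₂ (e , q)) (inj₂ (e′ , q′)) = inj₂ (trans e e′ , ℕ.≤-trans q q′)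
        below : ∀ {m y} → m ⊑ y → H m ℤ.≤ H y × (H y ≡ H m → rank m ≤ rank y)
        below (inj₁ a)       = ℤ.<⇒≤ a , λ e → contradiction a (ℤ.<-irrefl (sym e))
        below (inj₂ (e , q)) = ℤ.≤-reflexive e , λ _ → q

    canonical-exists : ∀ {σ} → SingleCycle σ → St → ∃ λ x → Canonical x (iterate σ x size)
    canonical-exists sc x =
      let H , ht = height-exists sc x ; y , low = lowest-exists H x in y , lowest⇒canonical {H = H} ht sc low

    canonical-unique : ∀ {σ x y} → SingleCycle σ → Canonical x (iterate σ x size) → Canonical y (iterate σ y size) → x ≡ y
    canonical-unique {σ} {x} {y} sc cx cy =
      let H , ht = height-exists sc x
          x≤ , x-least = canonical⇒lowest {H = H} {x} ht sc cx y
          y≤ , y-least = canonical⇒lowest {H = H} {y} ht sc cy x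
          e : H x ≡ H y
          e = ℤ.≤-antisym x≤ y≤
      in rank-injective (ℕ.≤-antisym (x-least (sym e)) (y-least e))

  V-colour : ∀ {t} {c d : Maybe (Fin (p t))} → _≡_ {A = V} (t , c) (t , d) → c ≡ d
  V-colour refl = refl

  V-nothing : ∀ {v : V} {t} → v ≡ (t , nothing) → proj₂ v ≡ nothing
  V-nothing refl = refl

  after : List St → St → List St
  after []      y = []
  after (x ∷ l) y = if does (y ≟ₛ x) then l else after l y

  after-suffix : ∀ {l} → Unique l → Suffixes (λ y b → after l y ≡ b) l
  after-suffix []                = []
  after-suffix {x ∷ l} (x∉ ∷ u) = first ∷ Suffixes-map later (after-suffix u)
    where
    first : after (x ∷ l) x ≡ l
    first rewrite dec-true (x ≟ₛ x) refl = refl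
    later : ∀ {y b} → y ∈ₗ l → after l y ≡ b → after (x ∷ l) y ≡ b
    later {y} y∈ e rewrite dec-false (y ≟ₛ x) (λ y≡x → All.lookup x∉ y∈ (sym y≡x)) = e

  -- Stacks are read where their top has type t, so the default is not confused with the colour of
  -- the root.
  colourAt : ∀ t → List V → Maybe (Fin (p t))
  colourAt t [] = nothing
  colourAt t ((u , c) ∷ _) with u Fin.≟ t
  ... | yes refl = c
  ... | no  _    = nothing

  colourAt-head : ∀ t c s → colourAt t ((t , c) ∷ s) ≡ c
  colourAt-head t c s with t Fin.≟ t
  ... | yes refl = refl
  ... | no  t≢t  = contradiction refl t≢t

  -- Irrelevance of `mult` makes the labels depend on the sets alone, so that they agree for equal
  -- sets.
  module Labels (R : Fin n → Subset k) .(mult : Multiplicities R) where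
    open Jumps R

    -- In a tour of the types, the colour c of type t stands for the c-th set that contains t.
    member : ∀ t → Fin (p t) → Fin n
    member t c = sel (column R t) (cast (sym (mult t)) c)

    member-∈ : ∀ t c → t ∈ R (member t c)
    member-∈ t c = ∈-column⁻ R (sel-∈ (column R t) _)

    member-injective : ∀ t {c d} → member t c ≡ member t d → c ≡ d
    member-injective t {c} {d} e = Fin.toℕ-injective (trans (sym (Fin.toℕ-cast _ c))
      (trans (cong toℕ (sel-injective (column R t) e)) (Fin.toℕ-cast _ d)))

    member-surjective : ∀ {t h} → t ∈ R h → ∃ λ c → member t c ≡ h
    member-surjective {t} {h} t∈ =
      let c , e = sel-surjective (column R t) (∈-column⁺ R t∈)
      in cast (mult t) c , trans (cong (sel (column R t)) (trans (Fin.cast-trans (mult t) (sym (mult t)) c) (Fin.cast-is-id refl c))) e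

    label : ∀ t → Fin n → Maybe (Fin (p t))
    label t h with Fin.any? (λ c → member t c Fin.≟ h)
    ... | yes (c , _) = just c
    ... | no  _       = nothing

    label-member : ∀ t c → label t (member t c) ≡ just c
    label-member t c with Fin.any? (λ d → member t d Fin.≟ member t c)
    ... | yes (d , e) = cong just (member-injective t e)
    ... | no  none    = contradiction (c , refl) none

    label-just : ∀ {t h c} → label t h ≡ just c → member t c ≡ h
    label-just {t} {h} e with Fin.any? (λ c → member t c Fin.≟ h)
    label-just refl | yes (c , e) = e

    ∈-label : ∀ {t h} → t ∈ R h → ∃ λ c → label t h ≡ just c
    ∈-label {t} t∈ = let c , e = member-surjective t∈ in c , trans (cong (label t) (sym e)) (label-member t c)

    ∉-label : ∀ {t h} → t ∉ R h → label t h ≡ nothing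
    ∉-label {t} {h} t∉ with Fin.any? (λ c → member t c Fin.≟ h)
    ... | yes (c , e) = contradiction (subst (λ g → t ∈ R g) e (member-∈ t c)) t∉
    ... | no  _       = refl

    height : St → ℕ
    height x = depₛ (jump x)

    change : ∀ {t} → Fin n → Maybe (Fin (p t)) → List V → List V
    change {t} h (just c) s = (t , just c) ∷ s
    change {t} h nothing  s = drop (height (t , h)) s

    module Stack (t₀ : Fin k) where

      -- The path from the current vertex to the root, if the walk l ends
      -- in the root.  Leaving a vertex of type t by its last arc (t , h)
      -- goes one step down this path, and any other arc (t , h) goes up
      -- the run of R h above t.
      stack : List St → List V
      stack []            = [ t₀ , nothing ]
      stack ((t , h) ∷ l) = change h (label t h) (stack l)

      stack-pop : ∀ {t h c} l → label t h ≡ just c → stack ((t , h) ∷ l) ≡ (t , just c) ∷ stack l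
      stack-pop {t} {h} l e = cong (λ c → change h c (stack l)) e

      stack-jump : ∀ {t h} l → t ∉ R h → stack ((t , h) ∷ l) ≡ drop (height (t , h)) (stack l)
      stack-jump {t} {h} l t∉ = cong (λ c → change h c (stack l)) (∉-label t∉)

      -- The jump from the base b of the run of t in h lands on the top of this run, and the stack
      -- at that moment is the path from there. This path follows h through the run, so that the
      -- vertex of type t is found by going down as many steps as the depths differ.
      readColour : List St → ∀ t → Fin n → Maybe (Fin (p t))
      readColour l t h = colourAt t (drop (dep (R h) (al b (R h)) ∸ dep (R h) t) (stack (after l (b , h))))
        where
        b : Fin k
        b = descend pre (dep (R h) t) t

  -- The case of `yes` and `nothing` is a default that `rep-just` excludes in a forest.
  relabel₂ : (R : Fin n → Subset k) .(mult : Multiplicities R) → ∀ t h → Dec (t ∈ R h) → Maybe (Fin (p t)) → Fin n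
  relabel₂ R mult t h (yes _) (just c) = Labels.member R mult t c
  relabel₂ R mult t h (yes _) nothing  = h
  relabel₂ R mult t h (no _)  _        = h

  source : (∀ t → Fin n → Maybe (Fin (p t))) → St → V
  source φ (t , h) = t , φ t h

  -- An Eulerian tour along the jumps with its tree of last arcs: by the `rep` fields the pairs with
  -- t ∈ R_h correspond to the coloured vertices, and by `exits` they are the last arcs of these. A
  -- closed tour could be started with any arc that leaves the root; `least` selects one.
  record Forest : Set where
    field
      φ     : ∀ t → Fin n → Maybe (Fin (p t))
      sets  : Vec.Vec (Subset k) n
      start : St
      rest  : List St

    R : Fin n → Subset k
    R = Vec.lookup sets

    root : V
    root = proj₁ start , nothing

    walk : List St
    walk = start ∷ rest

    field
      strict   : Strict R
      mult     : Multiplicities R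
      rep-just : ∀ {t h} → t ∈ R h → φ t h ≢ nothing
      rep-inj  : ∀ {t h g} → t ∈ R h → t ∈ R g → φ t h ≡ φ t g → h ≡ g
      rep-surj : ∀ t c → ∃ λ h → t ∈ R h × φ t h ≡ just c
      at-root  : ∀ {t h} → φ t h ≡ nothing → t ≡ proj₁ start

    open Jumps R using (jump)
    open Trails _≟ᵥ_ (source φ) (source φ ∘ jump) public

    field
      complete : walk ↭ states
      trail    : Trail root walk root
      exits    : ∀ {t c x} → last (out (t , just c) walk) ≡ just x → proj₁ x ∈ R (proj₂ x)
      least    : ∀ {x} → source φ x ≡ root → rank start ≤ rank x

  Forests : Setoid 0ℓ 0ℓ
  Forests = record
    { Carrier = Forest
    ; _≈_ = λ F G → (∀ t h → φ F t h ≡ φ G t h) × sets F ≡ sets G × walk F ≡ walk G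
    ; isEquivalence = record
      { refl  = (λ _ _ → refl) , refl , refl
      ; sym   = λ (e , f , g) → (λ t h → sym (e t h)) , sym f , sym g
      ; trans = λ (e , f , g) (e′ , f′ , g′) → (λ t h → trans (e t h) (e′ t h)) , trans f f′ , trans g g′
      }
    }
    where open Forest

  record TypedTour : Set where
    field
      sets : Vec.Vec (Subset k) n

    R : Fin n → Subset k
    R = Vec.lookup sets

    field
      strict : Strict R
      mult   : Multiplicities R
      σ      : St → St
      single : SingleCycle σ
      typed  : ∀ x → proj₁ (σ x) ≡ al (proj₁ x) (R (proj₂ x))

  TypedTours : Setoid 0ℓ 0ℓ
  TypedTours = record
    { Carrier = TypedTour
    ; _≈_ = λ S T → sets S ≡ sets T × σ S ≗ σ T
    ; isEquivalence = record
      { refl = refl , λ _ → refl ; sym = λ (e , f) → sym e , sym ∘ f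
      ; trans = λ (e , f) (e′ , f′) → trans e e′ , λ x → trans (f x) (f′ x) }
    }
    where open TypedTour

  -- From forests to tours of the types

  module ForestTour (F : Forest) where
    open Forest F
    open Labels R mult
    open Levels R strict
    open Stack (proj₁ start)

    -- Exchanges the representatives of the vertices of each type.
    relabel : St → St
    relabel (t , h) = t , relabel₂ R mult t h (t ∈? R h) (φ t h)

    data View (t : Fin k) (h : Fin n) : Set where
      pop  : ∀ {c} → t ∈ R h → φ t h ≡ just c → relabel (t , h) ≡ (t , member t c) → View t h
      hop  : t ∉ R h → relabel (t , h) ≡ (t , h) → View t h

    view : ∀ t h → View t h
    view t h with t ∈? R h in e | φ t h in f
    ... | yes p | just c  = pop p f (cong (t ,_) (cong₂ (relabel₂ R mult t h) e f))
    ... | yes p | nothing = contradiction f (rep-just p)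
    ... | no  p | c       = hop p (cong (t ,_) (trans (cong₂ (relabel₂ R mult t h) e f) (kept p c)))
      where
      kept : ∀ p c → relabel₂ R mult t h (no p) c ≡ h
      kept p (just _) = refl
      kept p nothing  = refl

    relabel-injective : ∀ {x y} → relabel x ≡ relabel y → x ≡ y
    relabel-injective {t , h} {u , g} e with refl ← cong proj₁ e with view t h | view u g
    ... | pop p f r | pop q f′ r′ = cong (t ,_) (rep-inj p q (trans f (trans (cong just
            (member-injective t (cong proj₂ (trans (sym r) (trans e r′))))) (sym f′))))
    ... | pop p f r | hop q r′ = contradiction (subst (λ h → t ∈ R h) (cong proj₂ (trans (sym r) (trans e r′))) (member-∈ t _)) q
    ... | hop p r | pop q f′ r′ = contradiction (subst (λ h → t ∈ R h) (cong proj₂ (trans (sym r′) (trans (sym e) r))) (member-∈ t _)) p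
    ... | hop p r | hop q r′ = trans (sym r) (trans e r′)

    -- The path in the tree: a vertex is followed by the target of its last arc (t , h).
    data Path : V → List V → Set where
      bottom : Path root [ root ]
      up     : ∀ {v s} t h → v ≡ (t , φ t h) → t ∈ R h → Path (pre t , φ (pre t) h) s → Path v (v ∷ s)

    Path-head : ∀ {v s} → Path v s → ∃ λ s′ → s ≡ v ∷ s′
    Path-head bottom = [] , refl
    Path-head (up t h _ _ _) = _ , refl

    -- For t ∈ R_h, the arc by which the path leaves the vertex of type t of h is (t , h) itself, by
    -- `rep-inj`. Hence the path stays in h down to the end of the run.
    Path-drop : ∀ j m {t h s} → Path (t , φ t h) s → dep (R h) t ≡ j + m →
                Path (descend pre j t , φ (descend pre j t) h) (drop j s)
    Path-drop zero    m π e = π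
    Path-drop (suc j) m {t} {h} π e = go π refl
      where
      t∈ : t ∈ R h
      t∈ = Law.dep-suc⇒∈ h e
      go : ∀ {v s} → Path v s → v ≡ (t , φ t h) → Path (descend pre (suc j) t , φ (descend pre (suc j) t) h) (drop (suc j) s)
      go bottom v≡ with refl ← cong proj₁ v≡ = contradiction (sym (V-colour v≡)) (rep-just t∈)
      go (up u g v≡′ u∈ π) v≡ with trans (sym v≡) v≡′
      ... | e′ with refl ← cong proj₁ e′ with refl ← rep-inj t∈ u∈ (V-colour e′) =
        Path-drop j m π (Law.dep-pred h e)

    private
      pop-length : ∀ a w l → a ≡ ℤ.1ℤ ℤ.+ l → w ≡ ℤ.1ℤ → ℤ.1ℤ ℤ.+ a ≡ ℤ.1ℤ ℤ.+ (w ℤ.+ l)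
      pop-length a w l refl refl = refl

      hop-length : ∀ a r w l → a ℤ.+ r ≡ ℤ.1ℤ ℤ.+ l → w ≡ ℤ.- r → a ≡ ℤ.1ℤ ℤ.+ (w ℤ.+ l)
      hop-length a r w l e refl = trans (add-and-remove a r) (trans (cong (ℤ._- r) e) (regroup ℤ.1ℤ l r))
        where
        add-and-remove : ∀ a r → a ≡ (a ℤ.+ r) ℤ.- r
        add-and-remove = solve-∀
        regroup : ∀ o l r → (o ℤ.+ l) ℤ.- r ≡ o ℤ.+ (ℤ.- r ℤ.+ l)
        regroup = solve-∀

    -- Induction from the end of the walk. The stack is formed from the relabelled walk but
    -- describes a path for the original one, because a relabelled last arc carries as its label the
    -- colour of the vertex that the original arc leaves.
    descent : ∀ {u l} → Trail u l root →
              Path u (stack (map relabel l)) × ℤ.+ length (stack (map relabel l)) ≡ ℤ.1ℤ ℤ.+ level (map relabel l)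
    descent [] = bottom , refl
    descent {l = (t , h) ∷ l} (_ ∷ τ) with π , len ← descent τ with view t h
    ... | pop {c} t∈ f r =
      subst (Path (t , φ t h)) (trans (cong (λ c → (t , c) ∷ stack (map relabel l)) f) (sym popped))
        (up t h refl t∈ (subst (λ u → Path (u , φ u h) (stack (map relabel l))) (Law.al-∈ h t∈) π))
      , trans (cong (λ s → ℤ.+ length s) popped) (pop-length (ℤ.+ length (stack (map relabel l))) _ _ len
          (trans (cong weight r) (weight-pop (member-∈ t c))))
      where
      popped : stack (relabel (t , h) ∷ map relabel l) ≡ (t , just c) ∷ stack (map relabel l)
      popped = trans (cong (λ x → stack (x ∷ map relabel l)) r) (stack-pop (map relabel l) (label-member t c))
    ... | hop t∉ r =
      subst (Path (t , φ t h)) (sym hopped) π′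
      , hop-length (ℤ.+ length (stack (relabel (t , h) ∷ map relabel l))) (ℤ.+ height (t , h)) _ _
          (trans (cong (λ s → ℤ.+ length s ℤ.+ ℤ.+ height (t , h)) hopped) (trans (cong ℤ.+_ lengths) len))
          (trans (cong weight r) (weight-jump t∉))
      where
      hopped : stack (relabel (t , h) ∷ map relabel l) ≡ drop (height (t , h)) (stack (map relabel l))
      hopped = trans (cong (λ x → stack (x ∷ map relabel l)) r) (stack-jump (map relabel l) t∉)
      π′ : Path (t , φ t h) (drop (height (t , h)) (stack (map relabel l)))
      π′ = subst (λ u → Path (u , φ u h) (drop (height (t , h)) (stack (map relabel l)))) (Law.al-∉ h t∉)
             (Path-drop (height (t , h)) 0 π (sym (ℕ.+-identityʳ _)))
      lengths : length (drop (height (t , h)) (stack (map relabel l))) + height (t , h) ≡ length (stack (map relabel l))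
      lengths = length-drop-+ (height (t , h)) (stack (map relabel l)) (proj₂ (Path-head π′))

    -- The stack is nonempty, so the level, which is its length minus one, is nonnegative. At level
    -- zero the walk is in the root, and `least` compares the ranks.
    canonical : ∀ {u l} → Trail u l root → Canonical start (map relabel l)
    canonical [] = []
    canonical {l = x ∷ l} (_ ∷ τ) with π , len ← descent (x ∷ τ) with s , e ← Path-head π =
      (subst (ℤ.0ℤ ℤ.≤_) (sym level≡) (ℤ.+≤+ z≤n) , lowest) ∷ canonical τ
      where
      level≡ : level (relabel x ∷ map relabel l) ≡ ℤ.+ length s
      level≡ = minus-one (trans (cong (λ s → ℤ.+ length s) (sym e)) len)
        where
        pred-suc : ∀ l → l ≡ ℤ.-1ℤ ℤ.+ (ℤ.1ℤ ℤ.+ l)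
        pred-suc = solve-∀
        minus-one : ∀ {m l} → ℤ.+ suc m ≡ ℤ.1ℤ ℤ.+ l → l ≡ ℤ.+ m
        minus-one {m} {l} e = trans (pred-suc l) (cong (ℤ._+_ ℤ.-1ℤ) (sym e))
      lowest : level (relabel x ∷ map relabel l) ≡ ℤ.0ℤ → rank start ≤ rank (relabel x)
      lowest e₀ = at-start (subst (Path _) (trans e (cong (_ ∷_) (empty s (ℤ.+-injective (trans (sym level≡) e₀))))) π)
        where
        empty : ∀ (s : List V) → length s ≡ 0 → s ≡ []
        empty [] _ = refl
        at-bottom : ∀ {v} → Path v [ v ] → v ≡ root
        at-bottom bottom = refl
        at-bottom (up _ _ _ _ π) = contradiction (proj₂ (Path-head π)) λ ()
        at-start : Path (source φ x) [ source φ x ] → rank start ≤ rank (relabel x)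
        at-start π with view (proj₁ x) (proj₂ x)
        ... | pop p f r = contradiction (trans (sym f) (V-nothing (at-bottom π))) λ ()
        ... | hop p r = subst (λ y → rank start ≤ rank y) (sym r) (least (at-bottom π))

    relabel-start : relabel start ≡ start
    relabel-start with view (proj₁ start) (proj₂ start)
    ... | hop _ r   = r
    ... | pop _ f _ = contradiction (trans (sym f) (sym (V-colour (proj₁ (Trail-uncons trail))))) λ ()

    tour : List St
    tour = start ∷ map relabel rest

    tour≡ : map relabel walk ≡ tour
    tour≡ = cong (_∷ map relabel rest) relabel-start

    tour-complete : tour ↭ states
    tour-complete = subst (_↭ states) tour≡
      (↭-trans (↭.map⁺ relabel complete) (injective⇒↭ relabel relabel-injective))

    module Typed = Trails Fin._≟_ proj₁ (proj₁ ∘ jump)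

    typed-trail : ∀ {u l} → Trail u l root → Typed.Trail (proj₁ u) (map relabel l) (proj₁ start)
    typed-trail [] = Typed.[]
    typed-trail {l = (t , h) ∷ l} (_ ∷ τ) =
      relabel (t , h) Typed.∷ subst (λ u → Typed.Trail u (map relabel l) (proj₁ start)) jump-type (typed-trail τ)
      where
      jump-type : al t (R h) ≡ al t (R (proj₂ (relabel (t , h))))
      jump-type with view t h
      ... | pop {c} p _ r = trans (Law.al-∈ h p) (trans (sym (Law.al-∈ (member t c) (member-∈ t c)))
                              (cong (λ x → al t (R (proj₂ x))) (sym r)))
      ... | hop _ r       = cong (λ x → al t (R (proj₂ x))) (sym r)

    toTour : TypedTour
    toTour = record
      { sets = sets ; strict = strict ; mult = mult ; σ = next start tour
      ; single = next-SingleCycle tour-complete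
      ; typed = λ x → Typed.Trail-follows (next-follows (complete⇒unique tour-complete))
          (subst (λ l → Typed.Trail (proj₁ start) l (proj₁ start)) tour≡ (typed-trail trail)) refl
          (complete⇒total tour-complete x)
      }

    tour-canonical : Canonical start (iterate (next start tour) start size)
    tour-canonical = subst (Canonical start) (trans tour≡ (sym (iterate-next tour-complete))) (canonical trail)

    landing : ∀ {u l} → Trail u l root → Suffixes (λ (t , h) b → t ∉ R h →
              Path (al t (R h) , φ (al t (R h)) h) (stack b)) (map relabel l)
    landing [] = []
    landing {l = (t , h) ∷ l} (_ ∷ τ) = first ∷ landing τ
      where
      first : t ∉ R (proj₂ (relabel (t , h))) → Path (al t (R _) , φ (al t (R _)) _) (stack (map relabel l))
      first with view t h
      ... | pop {c} p _ r = λ q → contradiction (subst (λ x → t ∈ R (proj₂ x)) (sym r) (member-∈ t c)) q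
      ... | hop p r       = λ _ → subst (λ g → Path (al t (R g) , φ (al t (R g)) g) (stack (map relabel l)))
                                    (sym (cong proj₂ r)) (proj₁ (descent τ))

    φ-read : ∀ t h → readColour tour t h ≡ φ t h
    φ-read t h with j , j+d , at-t ← Law.base-run h t
      with b , e , π ← Suffixes-lookup (Suffixes-zip _,_ (after-suffix (complete⇒unique tour-complete))
             (subst (Suffixes _) tour≡ (landing trail))) (complete⇒total tour-complete (Law.base h t , h)) =
      trans (cong (colourAt t) (trans (cong₂ drop j≡ (cong stack e)) s≡)) (colourAt-head t (φ t h) s)
      where
      j≡ : dep (R h) (al (Law.base h t) (R h)) ∸ dep (R h) t ≡ j
      j≡ = trans (cong (_∸ dep (R h) t) (sym j+d)) (ℕ.m+n∸n≡m j (dep (R h) t))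
      π′ : Path (t , φ t h) (drop j (stack b))
      π′ = subst (λ u → Path (u , φ u h) (drop j (stack b))) at-t (Path-drop j _ (π (Law.base-∉ h t)) (sym j+d))
      s : List V
      s = proj₁ (Path-head π′)
      s≡ : drop j (stack b) ≡ (t , φ t h) ∷ s
      s≡ = proj₂ (Path-head π′)

  private
    same-start : ∀ {A B : Vec.Vec (Subset k) n} (s : Strict (Vec.lookup A)) {σ τ x y} →
                 A ≡ B → σ ≗ τ → SingleCycle σ →
                 Jumps.Canonical (Vec.lookup A) x (iterate σ x size) →
                 Jumps.Canonical (Vec.lookup B) y (iterate τ y size) → x ≡ y
    same-start s {y = y} refl e sc cx cy =
      Levels.canonical-unique _ s sc cx (subst (Jumps.Canonical _ y) (sym (iterate-cong e y size)) cy)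

    readColour-cong : ∀ {A B : Vec.Vec (Subset k) n} .(m : Multiplicities (Vec.lookup A))
      .(m′ : Multiplicities (Vec.lookup B)) {u v l l′} →
      A ≡ B → u ≡ v → l ≡ l′ → ∀ t h →
      Labels.Stack.readColour (Vec.lookup A) m u l t h ≡ Labels.Stack.readColour (Vec.lookup B) m′ v l′ t h
    readColour-cong m m′ refl refl refl t h = refl

  relabel-cong : ∀ {F G} → Forest.sets F ≡ Forest.sets G → (∀ t h → Forest.φ F t h ≡ Forest.φ G t h) →
                 ∀ x → ForestTour.relabel F x ≡ ForestTour.relabel G x
  relabel-cong {F} {G} sets≡ φ≗ (t , h) = agree {F.sets} {G.sets} sets≡ F.mult G.mult (φ≗ t h)
    where
    module F = Forest F
    module G = Forest G
    agree : ∀ {A B : Vec.Vec (Subset k) n} → A ≡ B → .(m : Multiplicities (Vec.lookup A)) .(m′ : Multiplicities (Vec.lookup B)) →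
            ∀ {c d} → c ≡ d → (t , relabel₂ (Vec.lookup A) m t h (t ∈? Vec.lookup A h) c) ≡
                              (t , relabel₂ (Vec.lookup B) m′ t h (t ∈? Vec.lookup B h) d)
    agree refl m m′ refl = refl

  toTour-cong : ∀ {F G} → Setoid._≈_ Forests F G → Setoid._≈_ TypedTours (ForestTour.toTour F) (ForestTour.toTour G)
  toTour-cong {F} {G} (φ≗ , sets≡ , walk≡) = sets≡ , λ x → cong₂ (λ z l → next z l x) (List.∷-injectiveˡ walk≡)
    (trans (sym (ForestTour.tour≡ F)) (trans (List.map-cong (relabel-cong {F} {G} sets≡ φ≗) (Forest.walk F))
      (trans (cong (map (ForestTour.relabel G)) walk≡) (ForestTour.tour≡ G))))

  -- The tour determines the start as its canonical state, then the colours by reading the stack,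
  -- and finally the walk by undoing the relabelling.
  toTour-injective : ∀ {F G} → Setoid._≈_ TypedTours (ForestTour.toTour F) (ForestTour.toTour G) → Setoid._≈_ Forests F G
  toTour-injective {F} {G} (sets≡ , σ≗) = φ≗ , sets≡ , walk≡
    where
    module F = Forest F
    module G = Forest G
    module TF = ForestTour F
    module TG = ForestTour G
    start≡ : F.start ≡ G.start
    start≡ = same-start F.strict sets≡ σ≗ (next-SingleCycle TF.tour-complete) TF.tour-canonical TG.tour-canonical
    tour≡ : TF.tour ≡ TG.tour
    tour≡ = trans (sym (iterate-next TF.tour-complete)) (trans (iterate-cong σ≗ F.start size)
              (trans (cong (λ x → iterate (next G.start TG.tour) x size) start≡) (iterate-next TG.tour-complete)))
    φ≗ : ∀ t h → F.φ t h ≡ G.φ t h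
    φ≗ t h = trans (sym (TF.φ-read t h))
      (trans (readColour-cong {F.sets} {G.sets} F.mult G.mult sets≡ (cong proj₁ start≡) tour≡ t h) (TG.φ-read t h))
    relabel≗ : ∀ x → TF.relabel x ≡ TG.relabel x
    relabel≗ = relabel-cong {F} {G} sets≡ φ≗
    walk≡ : F.walk ≡ G.walk
    walk≡ = List.map-injective TG.relabel-injective
      (trans (sym (List.map-cong relabel≗ F.walk)) (trans TF.tour≡ (trans tour≡ (sym TG.tour≡))))

  -- From tours of the types to forests

  module TourForest
    (sets : Vec.Vec (Subset k) n) (strict : Strict (Vec.lookup sets)) (mult : Multiplicities (Vec.lookup sets))
    (x : St) (L rest : List St) (L≡ : L ≡ x ∷ rest) (complete : L ↭ states)
    (trail : Trails.Trail Fin._≟_ proj₁ (proj₁ ∘ Jumps.jump (Vec.lookup sets)) (proj₁ x) L (proj₁ x))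
    (canonical : Jumps.Canonical (Vec.lookup sets) x L) where

    R : Fin n → Subset k
    R = Vec.lookup sets

    open Labels R mult
    open Levels R strict
    module Typed = Trails Fin._≟_ proj₁ (proj₁ ∘ jump)

    t₀ : Fin k
    t₀ = proj₁ x

    root : V
    root = t₀ , nothing

    open Stack t₀

    data Kind (t : Fin k) (h : Fin n) : Set where
      pop : ∀ {c} → t ∈ R h → label t h ≡ just c → Kind t h
      hop : t ∉ R h → label t h ≡ nothing → Kind t h

    kind : ∀ t h → Kind t h
    kind t h with t ∈? R h
    ... | yes t∈ = pop t∈ (proj₂ (∈-label t∈))
    ... | no  t∉ = hop t∉ (∉-label t∉)

    -- What lies below a vertex on the stack as long as it is there.
    below : ∀ t → Fin (p t) → List V
    below t c = stack (after L (t , member t c))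

    -- Types go down by one along the stack, and `below` makes what lies under a vertex a function
    -- of this vertex. So the stacks at different times are paths in a common tree.
    data Chain : Fin k → List V → Set where
      bottom : Chain t₀ [ root ]
      above  : ∀ {t c s} → s ≡ below t c → Chain (pre t) s → Chain t ((t , just c) ∷ s)

    Chain-head : ∀ {t s} → Chain t s → s ≡ (t , colourAt t s) ∷ drop 1 s
    Chain-head bottom              = cong (λ c → (t₀ , c) ∷ []) (sym (colourAt-head t₀ nothing []))
    Chain-head (above {t} {c} {s} _ _) = cong (λ c → (t , c) ∷ s) (sym (colourAt-head t (just c) s))

    Chain-drop : ∀ j {t s} → Chain t s → j < length s → Chain (descend pre j t) (drop j s)
    Chain-drop zero    χ           _         = χ
    Chain-drop (suc j) bottom      (s≤s ())
    Chain-drop (suc j) (above _ χ) (s≤s j<s) = Chain-drop j χ j<s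

    Chain-nothing : ∀ {t s} → Chain t s → colourAt t s ≡ nothing → t ≡ t₀ × s ≡ [ root ]
    Chain-nothing bottom                  e = refl , refl
    Chain-nothing (above {t} {c} {s} _ _) e = contradiction (trans (sym (colourAt-head t (just c) s)) e) λ ()

    Chain-just : ∀ {t s c} → Chain t s → colourAt t s ≡ just c → Chain (pre t) (drop 1 s) × drop 1 s ≡ below t c
    Chain-just bottom                  e = contradiction (trans (sym (colourAt-head t₀ nothing [])) e) λ ()
    Chain-just (above {t} {c} {s} b χ) e with trans (sym (colourAt-head t (just c) s)) e
    ... | refl = χ , b

    record Info (y : St) (b : List St) : Set where
      field
        after≡  : after L y ≡ b
        before  : Chain (proj₁ y) (stack (y ∷ b))
        landed  : Chain (proj₁ (jump y)) (stack b)
        lowest  : length (stack (y ∷ b)) ≡ 1 → rank x ≤ rank y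

    private
      Sane : St → List St → Set
      Sane y b = after L y ≡ b × ℤ.0ℤ ℤ.≤ level (y ∷ b) × (level (y ∷ b) ≡ ℤ.0ℤ → rank x ≤ rank y)

      -- This is where the lowest start matters: a nonnegative level before the jump means that
      -- dropping r entries leaves at least one on the stack.
      hop-fits : ∀ m r {w l} → ℤ.+ m ≡ ℤ.1ℤ ℤ.+ l → w ≡ ℤ.- ℤ.+ r → ℤ.0ℤ ℤ.≤ w ℤ.+ l →
                 r < m × ℤ.+ (m ∸ r) ≡ ℤ.1ℤ ℤ.+ (w ℤ.+ l)
      hop-fits m r {w} {l} e refl nonneg with ℤ.- ℤ.+ r ℤ.+ l in eq
      hop-fits m r {l = l} e refl (ℤ.+≤+ _) | ℤ.+ q = subst (r <_) (sym m≡) (s≤s (ℕ.m≤m+n r q))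
          , trans (cong (λ m → ℤ.+ (m ∸ r)) m≡)
              (cong ℤ.+_ (trans (cong (_∸ r) (sym (ℕ.+-suc r q))) (ℕ.m+n∸m≡n r (suc q))))
        where
        undo : ∀ o r l → o ℤ.+ l ≡ o ℤ.+ (r ℤ.+ (ℤ.- r ℤ.+ l))
        undo = solve-∀
        m≡ : m ≡ suc (r + q)
        m≡ = ℤ.+-injective (trans e (trans (undo ℤ.1ℤ (ℤ.+ r) l) (cong (λ i → ℤ.1ℤ ℤ.+ (ℤ.+ r ℤ.+ i)) eq)))

      level-zero : ∀ {m l} → ℤ.+ m ≡ ℤ.1ℤ ℤ.+ l → m ≡ 1 → l ≡ ℤ.0ℤ
      level-zero {l = l} e refl = trans (shift-one l) (cong (ℤ._- ℤ.1ℤ) (sym e))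
        where
        shift-one : ∀ l → l ≡ (ℤ.1ℤ ℤ.+ l) ℤ.- ℤ.1ℤ
        shift-one = solve-∀

      chains : ∀ {u l} → Typed.Trail u l t₀ → Suffixes Sane l →
               Chain u (stack l) × ℤ.+ length (stack l) ≡ ℤ.1ℤ ℤ.+ level l × Suffixes Info l
      chains Typed.[] [] = bottom , refl , []
      chains {l = (t , h) ∷ b} (_ Typed.∷ τ) ((after≡ , nonneg , low) ∷ sane)
        with χ , len , infos ← chains τ sane with kind t h
      ... | pop {c} t∈ e =
        χ′ , len′ , record { after≡ = after≡ ; before = χ′ ; landed = χ ; lowest = low ∘ level-zero len′ } ∷ infos
        where
        stack≡ : stack ((t , h) ∷ b) ≡ (t , just c) ∷ stack b
        stack≡ = stack-pop b e
        χ′ : Chain t (stack ((t , h) ∷ b))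
        χ′ = subst (Chain t) (sym stack≡) (above
          (cong stack (trans (sym after≡) (cong (λ g → after L (t , g)) (sym (label-just e)))))
          (subst (λ u → Chain u (stack b)) (Law.al-∈ h t∈) χ))
        len′ : ℤ.+ length (stack ((t , h) ∷ b)) ≡ ℤ.1ℤ ℤ.+ level ((t , h) ∷ b)
        len′ = trans (cong (λ s → ℤ.+ length s) stack≡) (cong (ℤ._+_ ℤ.1ℤ) (trans len (cong (ℤ._+ level b) (sym (weight-pop t∈)))))
      ... | hop t∉ e = χ′ , len′ , record { after≡ = after≡ ; before = χ′ ; landed = χ ; lowest = low ∘ level-zero len′ } ∷ infos
        where
        r : ℕ
        r = height (t , h)
        stack≡ : stack ((t , h) ∷ b) ≡ drop r (stack b)
        stack≡ = stack-jump b t∉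
        fits : r < length (stack b) × ℤ.+ (length (stack b) ∸ r) ≡ ℤ.1ℤ ℤ.+ (weight (t , h) ℤ.+ level b)
        fits = hop-fits (length (stack b)) r len (weight-jump t∉) nonneg
        χ′ : Chain t (stack ((t , h) ∷ b))
        χ′ = subst (Chain t) (sym stack≡) (subst (λ u → Chain u (drop r (stack b))) (Law.al-∉ h t∉) (Chain-drop r χ (proj₁ fits)))
        len′ : ℤ.+ length (stack ((t , h) ∷ b)) ≡ ℤ.1ℤ ℤ.+ level ((t , h) ∷ b)
        len′ = trans (cong (λ s → ℤ.+ length s) stack≡) (trans (cong ℤ.+_ (List.length-drop r (stack b))) (proj₂ fits))

      all-chains : Chain t₀ (stack L) × ℤ.+ length (stack L) ≡ ℤ.1ℤ ℤ.+ level L × Suffixes Info L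
      all-chains = chains trail (Suffixes-zip (λ a b → a , b) (after-suffix (complete⇒unique complete)) canonical)

    infos : Suffixes Info L
    infos = proj₂ (proj₂ all-chains)

    info : ∀ y → Info y (after L y)
    info y with b , i ← Suffixes-lookup infos (complete⇒total complete y) = subst (Info y) (sym (Info.after≡ i)) i

    stack-L : stack L ≡ [ root ]
    stack-L = go (proj₁ all-chains) (ℤ.+-injective (trans (proj₁ (proj₂ all-chains)) (cong (ℤ._+_ ℤ.1ℤ) (level-complete complete))))
      where
      go : ∀ {t s} → Chain t s → length s ≡ 1 → s ≡ [ root ]
      go bottom                 _ = refl
      go (above _ bottom)       ()
      go (above _ (above _ _))  ()

    φ : ∀ t → Fin n → Maybe (Fin (p t))
    φ = readColour L

    -- The path from the vertex of type t of h to the root.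
    private
      pathFrom : Fin n → ℕ → Fin k → List V
      pathFrom h d t = drop (dep (R h) (al (descend pre d t) (R h)) ∸ d) (stack (after L (descend pre d t , h)))

    path : Fin n → Fin k → List V
    path h t = pathFrom h (dep (R h) t) t

    private
      reach : ∀ t h → dep (R h) (al (Law.base h t) (R h)) < length (stack (after L (Law.base h t , h)))
      reach t h = drop-nonempty (stack (after L (Law.base h t , h))) _ (trans (sym (stack-jump (after L (Law.base h t , h)) (Law.base-∉ h t)))
                    (Chain-head (Info.before (info (Law.base h t , h)))))

    path-chain : ∀ h t → Chain t (path h t)
    path-chain h t with j , j+d , at-t ← Law.base-run h t =
      subst (λ j → Chain t (drop j (stack (after L (Law.base h t , h))))) (sym j≡)
        (subst (λ u → Chain u (drop j (stack (after L (Law.base h t , h))))) at-t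
          (Chain-drop j (Info.landed (info (Law.base h t , h)))
            (ℕ.≤-<-trans (subst (j ≤_) j+d (ℕ.m≤m+n j _)) (reach t h))))
      where
      j≡ : dep (R h) (al (Law.base h t) (R h)) ∸ dep (R h) t ≡ j
      j≡ = trans (cong (_∸ dep (R h) t) (sym j+d)) (ℕ.m+n∸n≡m j (dep (R h) t))

    path-head : ∀ h t → path h t ≡ (t , φ t h) ∷ drop 1 (path h t)
    path-head h t = Chain-head (path-chain h t)

    -- Both paths are cut from the stack after the same jump from the base, and the numbers of
    -- dropped entries differ by one.
    path-pre : ∀ {h t} → t ∈ R h → path h (pre t) ≡ drop 1 (path h t)
    path-pre {h} {t} t∈ with j , j+d , _ ← Law.base-run h t rewrite Law.dep-∈ h t∈ =
      trans (cong (λ i → drop i X) (shift d d<r)) (trans (cong (λ i → drop i X) (ℕ.+-comm 1 (r ∸ suc d))) (sym (List.drop-drop (r ∸ suc d) 1 X)))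
      where
      d r : ℕ
      d = dep (R h) (pre t)
      r = dep (R h) (al (descend pre d (pre t)) (R h))
      X : List V
      X = stack (after L (descend pre d (pre t) , h))
      d<r : suc d ≤ r
      d<r = subst (suc d ≤_) j+d (ℕ.m≤n+m (suc d) j)
      shift : ∀ d {r} → suc d ≤ r → r ∸ d ≡ suc (r ∸ suc d)
      shift zero    (s≤s _) = refl
      shift (suc d) (s≤s q) = shift d q

    path-descend : ∀ i m {h t} → dep (R h) t ≡ i + m → path h (descend pre i t) ≡ drop i (path h t)
    path-descend zero    m e = refl
    path-descend (suc i) m {h} {t} e = trans (path-descend i m (Law.dep-pred h e))
      (trans (cong (drop i) (path-pre (Law.dep-suc⇒∈ h e))) (List.drop-drop 1 i (path h t)))

    path-hop : ∀ {h t} → t ∉ R h → path h t ≡ stack ((t , h) ∷ after L (t , h))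
    path-hop {h} {t} t∉ = trans (cong (λ d → pathFrom h d t) (Law.dep-∉ h t∉)) (sym (stack-jump (after L (t , h)) t∉))

    path-al : ∀ {h t} → t ∉ R h → path h (al t (R h)) ≡ stack (after L (t , h))
    path-al {h} {t} t∉ = trans
      (cong (λ b → drop (dep (R h) (al b (R h)) ∸ dep (R h) (al t (R h))) (stack (after L (b , h)))) (Law.al-∉ h t∉))
      (cong (λ i → drop i (stack (after L (t , h)))) (ℕ.n∸n≡0 (dep (R h) (al t (R h)))))

    -- For t ∈ R_h the path goes on to the vertex of type t-1 of h, whereas the path from the root
    -- consists of the root only.
    rep-just : ∀ {t h} → t ∈ R h → φ t h ≢ nothing
    rep-just {t} {h} t∈ e with _ , path≡ ← Chain-nothing (path-chain h t) e =
      contradiction (trans (sym (path-head h (pre t))) (trans (path-pre t∈) (cong (drop 1) path≡))) λ ()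

    at-root : ∀ {t h} → φ t h ≡ nothing → t ≡ t₀
    at-root {t} {h} e = proj₁ (Chain-nothing (path-chain h t) e)

    private
      -- Going backwards, the arc (t , member t c) pushes the vertex (t , c), which either stays on
      -- the stack or is dropped by a jump. The entries dropped by the jump of (u , h) are the
      -- vertices of h in the run above u, so that in this case h represents c. At the start of the
      -- tour only the root is on the stack, which leaves the second alternative.
      pushed : ∀ t c {l} → Suffixes Info l → (t , member t c) ∈ₗ l →
               (t , just c) ∈ₗ stack l ⊎ ∃ λ h → t ∈ R h × φ t h ≡ just c
      pushed t c {_ ∷ b} (_ ∷ _) (here refl) = inj₁ (subst ((t , just c) ∈ₗ_) (sym (stack-pop b (label-member t c))) (here refl))
      pushed t c {(u , h) ∷ b} (i ∷ is) (there q) with pushed t c is q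
      ... | inj₂ found = inj₂ found
      ... | inj₁ q′ with kind u h
      ...   | pop _ e = inj₁ (subst ((t , just c) ∈ₗ_) (sym (stack-pop b e)) (there q′))
      ...   | hop u∉ _ with ∈-drop (stack b) (height (u , h)) q′
      ...     | inj₁ q″ = inj₁ (subst ((t , just c) ∈ₗ_) (sym (stack-jump b u∉)) q″)
      ...     | inj₂ (j , j<r , s , e) = inj₂ (h , t∈ , V-colour φ≡)
        where
        r : ℕ
        r = height (u , h)
        top : Fin k
        top = al u (R h)
        r≡ : r ≡ j + (r ∸ j)
        r≡ = sym (ℕ.m+[n∸m]≡n (ℕ.<⇒≤ j<r))
        path≡ : path h (descend pre j top) ≡ (t , just c) ∷ s
        path≡ = trans (path-descend j (r ∸ j) r≡)
          (trans (cong (drop j) (trans (path-al u∉) (cong stack (Info.after≡ i)))) e)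
        head≡ : (descend pre j top , φ (descend pre j top) h) ≡ (t , just c)
        head≡ = List.∷-injectiveˡ (trans (sym (path-head h (descend pre j top))) path≡)
        type≡ : descend pre j top ≡ t
        type≡ = cong proj₁ head≡
        φ≡ : _≡_ {A = V} (t , φ t h) (t , just c)
        φ≡ = subst (λ u → _≡_ {A = V} (u , φ u h) (t , just c)) type≡ head≡
        t∈ : t ∈ R h
        t∈ = subst (_∈ R h) type≡ (Law.dep-suc⇒∈ h (trans (deps j (r ∸ j) r≡) (sym (ℕ.suc-pred (r ∸ j) {{Data.Nat.>-nonZero (ℕ.m<n⇒0<n∸m j<r)}}))))
          where
          deps : ∀ j m {t} → dep (R h) t ≡ j + m → dep (R h) (descend pre j t) ≡ m
          deps zero    m e = e
          deps (suc j) m e = deps j m (Law.dep-pred h e)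

    opaque
      rep-surj : ∀ t c → ∃ λ h → t ∈ R h × φ t h ≡ just c
      rep-surj t c with pushed t c infos (complete⇒total complete (t , member t c))
      ... | inj₂ found = found
      ... | inj₁ q with subst ((t , just c) ∈ₗ_) stack-L q
      ...   | here ()
      ...   | there ()

    rep : ∀ t → Fin (p t) → Fin n
    rep t c = proj₁ (rep-surj t c)

    rep-∈ : ∀ t c → t ∈ R (rep t c)
    rep-∈ t c = proj₁ (proj₂ (rep-surj t c))

    φ-rep : ∀ t c → φ t (rep t c) ≡ just c
    φ-rep t c = proj₂ (proj₂ (rep-surj t c))

    rep-injective : ∀ t {c d} → rep t c ≡ rep t d → c ≡ d
    rep-injective t {c} {d} e = Maybe.just-injective (trans (sym (φ-rep t c)) (trans (cong (φ t) e) (φ-rep t d)))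

    -- There are as many sets containing t as there are colours.
    rep-surjective : ∀ {t h} → t ∈ R h → ∃ λ c → rep t c ≡ h
    rep-surjective {t} {h} t∈ =
      let d , e  = member-surjective t∈
          c , e′ = Enumerated.injective⇒surjective Fin._≟_ (allFin (p t)) (Unique.allFin⁺ (p t)) ∈.∈-allFin index index-injective d
      in c , trans (sym (proj₂ (member-surjective (rep-∈ t c)))) (trans (cong (member t) e′) e)
      where
      index : Fin (p t) → Fin (p t)
      index c = proj₁ (member-surjective (rep-∈ t c))
      index-injective : ∀ {c d} → index c ≡ index d → c ≡ d
      index-injective {c} {d} e = rep-injective t (trans (sym (proj₂ (member-surjective (rep-∈ t c))))
        (trans (cong (member t) e) (proj₂ (member-surjective (rep-∈ t d)))))

    rep-inj : ∀ {t h g} → t ∈ R h → t ∈ R g → φ t h ≡ φ t g → h ≡ g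
    rep-inj {t} t∈ t∈′ e =
      let c , a = rep-surjective t∈ ; d , b = rep-surjective t∈′
      in trans (sym a) (trans (cong (rep t) (Maybe.just-injective (trans (sym (φ-rep t c))
           (trans (cong (φ t) a) (trans e (trans (cong (φ t) (sym b)) (φ-rep t d))))))) b)

    unlabel₂ : ∀ t → Fin n → Maybe (Fin (p t)) → Fin n
    unlabel₂ t h (just c) = rep t c
    unlabel₂ t h nothing  = h

    unlabel : St → St
    unlabel (t , h) = t , unlabel₂ t h (label t h)

    unlabel-pop : ∀ {t h c} → label t h ≡ just c → unlabel (t , h) ≡ (t , rep t c)
    unlabel-pop {t} {h} e = cong (λ c → t , unlabel₂ t h c) e

    unlabel-hop : ∀ {t h} → label t h ≡ nothing → unlabel (t , h) ≡ (t , h)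
    unlabel-hop {t} {h} e = cong (λ c → t , unlabel₂ t h c) e

    unlabel-injective : ∀ {y z} → unlabel y ≡ unlabel z → y ≡ z
    unlabel-injective {t , h} {u , g} e with refl ← cong proj₁ e with kind t h | kind u g
    ... | pop {c} _ f | pop {d} _ f′ = cong (t ,_) (trans (sym (label-just f)) (trans (cong (member t)
            (rep-injective t (cong proj₂ (trans (sym (unlabel-pop f)) (trans e (unlabel-pop f′)))))) (label-just f′)))
    ... | pop {c} _ f | hop q f′ = contradiction
            (subst (λ h → t ∈ R h) (cong proj₂ (trans (sym (unlabel-pop f)) (trans e (unlabel-hop f′)))) (rep-∈ t c)) q
    ... | hop q f | pop {c} _ f′ = contradiction
            (subst (λ h → t ∈ R h) (cong proj₂ (trans (sym (unlabel-pop f′)) (trans (sym e) (unlabel-hop f)))) (rep-∈ t c)) q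
    ... | hop _ f | hop _ f′ = trans (sym (unlabel-hop f)) (trans e (unlabel-hop f′))

    unlabel-start : unlabel x ≡ x
    unlabel-start with kind (proj₁ x) (proj₂ x)
    ... | hop _ e = unlabel-hop e
    ... | pop _ e = contradiction (trans (sym (stack-pop rest e)) (trans (cong stack (sym L≡)) stack-L)) λ ()

    open Trails _≟ᵥ_ (source φ) (source φ ∘ jump)

    walk-trail : ∀ {l v s} → Suffixes Info l → stack l ≡ v ∷ s → Trail v (map unlabel l) root
    walk-trail {[]} [] refl = []
    walk-trail {(t , h) ∷ b} {v} (i ∷ is) e with kind t h
    ... | pop {c} t∈ f = subst₂ (λ v y → Trail v (y ∷ map unlabel b) root) v≡ (sym (unlabel-pop f))
        ((t , rep t c) ∷ walk-trail is stack-b)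
      where
      v≡ : (t , φ t (rep t c)) ≡ v
      v≡ = trans (cong (t ,_) (φ-rep t c)) (List.∷-injectiveˡ (trans (sym (stack-pop b f)) e))
      -- The path from any vertex with colour c continues with what lies below (t , c). For
      -- `rep t c` this must be the stack after the arc of the tour that pops (t , c), which is
      -- `member t c`.
      below≡ : drop 1 (path (rep t c) t) ≡ stack b
      below≡ = trans (proj₂ (Chain-just (path-chain (rep t c) t) (φ-rep t c)))
        (cong stack (trans (cong (λ g → after L (t , g)) (label-just f)) (Info.after≡ i)))
      stack-b : stack b ≡ source φ (jump (t , rep t c)) ∷ drop 1 (path (rep t c) (pre t))
      stack-b = trans (sym below≡) (trans (sym (path-pre (rep-∈ t c))) (trans (path-head (rep t c) (pre t))
        (cong (λ u → (u , φ u (rep t c)) ∷ drop 1 (path (rep t c) (pre t))) (sym (Law.al-∈ (rep t c) (rep-∈ t c))))))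
    ... | hop t∉ f = subst₂ (λ v y → Trail v (y ∷ map unlabel b) root) v≡ (sym (unlabel-hop f))
        ((t , h) ∷ walk-trail is stack-b)
      where
      v≡ : (t , φ t h) ≡ v
      v≡ = List.∷-injectiveˡ (trans (sym (path-head h t)) (trans (path-hop t∉) (trans (cong (λ b → stack ((t , h) ∷ b)) (Info.after≡ i)) e)))
      stack-b : stack b ≡ source φ (jump (t , h)) ∷ drop 1 (path h (al t (R h)))
      stack-b = trans (cong stack (sym (Info.after≡ i))) (trans (sym (path-al t∉)) (path-head h (al t (R h))))

    stack-∈ : ∀ t c l → (t , just c) ∈ₗ stack l → (t , member t c) ∈ₗ l
    stack-∈ t c [] (here ())
    stack-∈ t c [] (there ())
    stack-∈ t c ((u , h) ∷ l) q with kind u h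
    ... | hop u∉ _ = there (stack-∈ t c l (drop-⊆ (stack l) (height (u , h)) (subst ((t , just c) ∈ₗ_) (stack-jump l u∉) q)))
    ... | pop {d} _ e with subst ((t , just c) ∈ₗ_) (stack-pop l e) q
    ...   | here refl = here (cong (t ,_) (label-just e))
    ...   | there q′  = there (stack-∈ t c l q′)

    -- If the last departure from (t , c) were a jump, then (t , c) would be on the stack right
    -- after it, and would have to be popped later, which is another departure.
    walk-exits : ∀ {l t c y} → Suffixes Info l → last (out (t , just c) (map unlabel l)) ≡ just y → proj₁ y ∈ R (proj₂ y)
    walk-exits {z@(u , h) ∷ b} {t} {c} {y} (i ∷ is) e with source φ (unlabel z) ≟ᵥ (t , just c)
    ... | no  _  = walk-exits is e
    ... | yes s≡ = go (out (t , just c) (map unlabel b)) refl e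
      where
      go : ∀ o → out (t , just c) (map unlabel b) ≡ o → last (unlabel z ∷ o) ≡ just y → proj₁ y ∈ R (proj₂ y)
      go (_ ∷ _) o≡ e = walk-exits is (trans (cong last o≡) e)
      go []      o≡ refl with kind u h
      ... | pop {d} _ f = subst (λ y → proj₁ y ∈ R (proj₂ y)) (sym (unlabel-pop f)) (rep-∈ u d)
      ... | hop u∉ f = contradiction (subst ((t , rep t c) ∈ₗ_) o≡ (∈-out⁺
              (subst (_∈ₗ map unlabel b) (unlabel-pop (label-member t c)) (∈.∈-map⁺ unlabel (stack-∈ t c b on-stack)))
              (cong (t ,_) (φ-rep t c)))) λ ()
        where
        on-stack : (t , just c) ∈ₗ stack b
        on-stack = drop-⊆ (stack b) (height (u , h)) (subst ((t , just c) ∈ₗ_) (stack-jump b u∉)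
          (subst ((t , just c) ∈ₗ_) (trans (path-hop u∉) (cong (λ b → stack (z ∷ b)) (Info.after≡ i)))
            (subst ((t , just c) ∈ₗ_) (sym (path-head h u))
              (here (trans (sym s≡) (cong (source φ) (unlabel-hop f)))))))

    walk-least : ∀ {y} → source φ y ≡ root → rank x ≤ rank y
    walk-least {t , h} s≡ with kind t h
    ... | pop t∈ _ = contradiction (V-nothing s≡) (rep-just t∈)
    ... | hop t∉ _ = Info.lowest (info (t , h)) (cong length
            (trans (sym (path-hop t∉)) (proj₂ (Chain-nothing (path-chain h t) (V-nothing s≡)))))

    walk≡ : map unlabel L ≡ x ∷ map unlabel rest
    walk≡ = trans (cong (map unlabel) L≡) (cong (_∷ map unlabel rest) unlabel-start)

    forest : Forest
    forest = record
      { φ = φ ; sets = sets ; start = x ; rest = map unlabel rest ; strict = strict ; mult = mult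
      ; rep-just = rep-just ; rep-inj = rep-inj ; rep-surj = rep-surj ; at-root = at-root
      ; complete = subst (_↭ states) walk≡ (↭-trans (↭.map⁺ unlabel complete)
                     (injective⇒↭ unlabel unlabel-injective))
      ; trail = subst (λ l → Trail root l root) walk≡ (walk-trail infos stack-L)
      ; exits = λ {t} {c} e → walk-exits infos (trans (cong (λ l → last (out (t , just c) l)) walk≡) e)
      ; least = walk-least
      }

    private module FT = ForestTour forest

    relabel-unlabel : ∀ y → FT.relabel (unlabel y) ≡ y
    relabel-unlabel (t , h) with kind t h
    ... | pop {c} t∈ f = trans (cong FT.relabel (unlabel-pop f)) (relabel-rep (FT.view t (rep t c)))
      where
      relabel-rep : FT.View t (rep t c) → FT.relabel (t , rep t c) ≡ (t , h)
      relabel-rep (FT.pop _ g r) = trans r (cong (t ,_)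
        (trans (cong (member t) (Maybe.just-injective (trans (sym g) (φ-rep t c)))) (label-just f)))
      relabel-rep (FT.hop q _)   = contradiction (rep-∈ t c) q
    ... | hop t∉ f = trans (cong FT.relabel (unlabel-hop f)) (relabel-hop (FT.view t h))
      where
      relabel-hop : FT.View t h → FT.relabel (t , h) ≡ (t , h)
      relabel-hop (FT.pop q _ _) = contradiction q t∉
      relabel-hop (FT.hop _ r)   = r

    tour≡ : FT.tour ≡ L
    tour≡ = trans (cong (x ∷_) (trans (sym (List.map-∘ rest)) (trans (List.map-cong relabel-unlabel rest) (List.map-id rest)))) (sym L≡)

  Forests≃TypedTours : St → Forests ≃ TypedTours
  Forests≃TypedTours x₀ = bijective⇒≃ {Forests} {TypedTours} ForestTour.toTour
    (λ {F} {G} → toTour-cong {F} {G}) (λ {F} {G} → toTour-injective {F} {G}) surjective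
    where
    surjective : ∀ T → ∃ λ F → Setoid._≈_ TypedTours (ForestTour.toTour F) T
    surjective T = forest , refl , λ y → trans (cong (λ l → next x l y) tour≡)
        (Follows-agree (next-follows (complete⇒unique (cycle-complete single x))) (cycle-follows single x)
          (complete⇒total (cycle-complete single x) y))
      where
      open TypedTour T
      x : St
      x = proj₁ (Levels.canonical-exists R strict single x₀)
      split : ∀ m → x ∈ₗ iterate σ x m → ∃ λ rest → iterate σ x m ≡ x ∷ rest
      split (suc m) _ = iterate σ (σ x) m , refl
      rest : List St
      rest = proj₁ (split size (complete⇒total (cycle-complete single x) x))
      rest≡ : iterate σ x size ≡ x ∷ rest
      rest≡ = proj₂ (split size (complete⇒total (cycle-complete single x) x))
      open TourForest sets strict mult x (iterate σ x size) rest rest≡ (cycle-complete single x)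
        (subst (λ l → Trails.Trail Fin._≟_ proj₁ (proj₁ ∘ Jumps.jump R) l (iterate σ x size) (proj₁ x)) (cong (proj₁ ∘ headOr x) rest≡)
          (Trails.follows-Trail Fin._≟_ proj₁ (proj₁ ∘ Jumps.jump R) (cycle-follows single x) typed))
        (proj₂ (Levels.canonical-exists R strict single x₀))

  -- Cactus tours and forests

  Colouring : Set
  Colouring = ∀ t → Fin n → Maybe (Fin (p t))

  turn : St → St
  turn (t , h) = pre t , h

  turn-injective : ∀ {x y} → turn x ≡ turn y → x ≡ y
  turn-injective {t , h} e with refl ← cong proj₂ e = cong (_, h) (pre-injective (cong proj₁ e))

  -- The type `t₀` of the root is determined by φ, through `root-∃` and `at-root`; therefore
  -- `CactusTours` compares only φ and σ.
  record CactusTour : Set where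
    field
      φ        : Colouring
      t₀       : Fin k
      at-root  : ∀ {t h} → φ t h ≡ nothing → t ≡ t₀
      root-∃   : ∃ λ h → φ t₀ h ≡ nothing
      attained : ∀ t c → ∃ λ h → φ t h ≡ just c
      σ        : St → St
      single   : SingleCycle σ
      matched  : ∀ x → source φ (σ x) ≡ source φ (turn x)

  CactusTours : Setoid 0ℓ 0ℓ
  CactusTours = record
    { Carrier = CactusTour
    ; _≈_ = λ C D → (∀ t h → φ C t h ≡ φ D t h) × σ C ≗ σ D
    ; isEquivalence = record
      { refl = (λ _ _ → refl) , λ _ → refl
      ; sym = λ (e , f) → (λ t h → sym (e t h)) , sym ∘ f
      ; trans = λ (e , f) (e′ , f′) → (λ t h → trans (e t h) (e′ t h)) , λ x → trans (f x) (f′ x) }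
    }
    where open CactusTour

  module Out (φ : Colouring) = Stacks _≟ᵥ_ (source φ)
  module Turns (φ : Colouring) = Trails _≟ᵥ_ (source φ) (source φ ∘ turn)
  module JumpTrails (φ : Colouring) (R : Fin n → Subset k) = Trails _≟ᵥ_ (source φ) (source φ ∘ Jumps.jump R)

  source-cong : ∀ {φ ψ : Colouring} → (∀ t h → φ t h ≡ ψ t h) → ∀ x → source φ x ≡ source ψ x
  source-cong φ≗ψ (t , h) = cong (t ,_) (φ≗ψ t h)

  out-cong : ∀ {φ ψ : Colouring} → (∀ t h → φ t h ≡ ψ t h) → ∀ v l → Out.out φ v l ≡ Out.out ψ v l
  out-cong {φ} {ψ} φ≗ψ v l = List.filter-≐ (λ x → source φ x ≟ᵥ v) (λ x → source ψ x ≟ᵥ v)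
    ((λ {x} e → trans (sym (source-cong {φ} {ψ} φ≗ψ x)) e) , λ {x} e → trans (source-cong {φ} {ψ} φ≗ψ x) e) l

  Trail-cong : ∀ {src src′ tgt tgt′ : St → V} → src ≗ src′ → tgt ≗ tgt′ → ∀ {u l w} →
               Trails.Trail _≟ᵥ_ src tgt u l w → Trails.Trail _≟ᵥ_ src′ tgt′ u l w
  Trail-cong s g Trails.[] = Trails.[]
  Trail-cong s g {w = w} (Trails._∷_ x {l} τ) =
    subst (λ u → Trails.Trail _≟ᵥ_ _ _ u (x ∷ l) w) (sym (s x))
      (x Trails.∷ subst (λ u → Trails.Trail _≟ᵥ_ _ _ u l w) (g x) (Trail-cong s g τ))

  -- The tree consists of the last arcs of the vertices other than w, so that only their targets
  -- have to agree.
  Reach-retarget : ∀ {src tgt tgt′ : St → V} {m w} →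
    (∀ {v x} → v ≢ w → last (Stacks.out _≟ᵥ_ src v m) ≡ just x → tgt x ≡ tgt′ x) →
    ∀ {v} → Trails.Reach _≟ᵥ_ src tgt m w v → Trails.Reach _≟ᵥ_ src tgt′ m w v
  Reach-retarget agree Trails.here = Trails.here
  Reach-retarget {src} {tgt} {tgt′} {m} {w} agree {v} (Trails.via {e = x} le r) with v ≟ᵥ w
  ... | yes refl = Trails.here
  ... | no  v≢w  = Trails.via le (subst (Trails.Reach _≟ᵥ_ src tgt′ m w) (agree v≢w le) (Reach-retarget agree r))

  tour-of : CactusTour → St → List St
  tour-of C x = iterate (CactusTour.σ C) x size

  -- The arcs leave each vertex in the same order in both walks.
  record _∼_ (C : CactusTour) (F : Forest) : Set where
    field
      colours : ∀ t h → CactusTour.φ C t h ≡ Forest.φ F t h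
      orders  : ∀ v → Out.out (CactusTour.φ C) v (tour-of C (Forest.start F)) ≡ Out.out (Forest.φ F) v (Forest.walk F)

  start-rooted : ∀ F → Forest.φ F (proj₁ (Forest.start F)) (proj₂ (Forest.start F)) ≡ nothing
  start-rooted F = V-nothing (sym (proj₁ (Forest.Trail-uncons F (Forest.trail F))))

  tour-trail : ∀ C {x} → Turns.Trail (CactusTour.φ C) (source (CactusTour.φ C) x) (tour-of C x) (source (CactusTour.φ C) x)
  tour-trail C {x} = go size (Turns.follows-Trail φ (cycle-follows single x) matched) (cycle-complete single x)
    where
    open CactusTour C
    go : ∀ m → Turns.Trail φ (source φ (headOr x (iterate σ x m))) (iterate σ x m) (source φ x) → iterate σ x m ↭ states →
         Turns.Trail φ (source φ x) (iterate σ x m) (source φ x)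
    go zero    τ _ = τ
    go (suc m) τ _ = τ

  colour-known : ∀ F {t h} → t ∈ Forest.R F h → ∃ λ c → Forest.φ F t h ≡ just c
  colour-known F {t} {h} t∈ with Forest.φ F t h in e
  ... | just c  = c , refl
  ... | nothing = contradiction e (Forest.rep-just F t∈)

  start-least : ∀ F G → (∀ t h → Forest.φ F t h ≡ Forest.φ G t h) → rank (Forest.start G) ≤ rank (Forest.start F)
  start-least F G φ≗ = Forest.least G (trans (cong (proj₁ (Forest.start F) ,_) e) (cong (_, nothing) (Forest.at-root G e)))
    where
    e : Forest.φ G (proj₁ (Forest.start F)) (proj₂ (Forest.start F)) ≡ nothing
    e = trans (sym (φ≗ _ _)) (start-rooted F)

  start-unique : ∀ F G → (∀ t h → Forest.φ F t h ≡ Forest.φ G t h) → Forest.start F ≡ Forest.start G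
  start-unique F G φ≗ = rank-injective (ℕ.≤-antisym (start-least G F (λ t h → sym (φ≗ t h))) (start-least F G φ≗))

  -- In a forest, t ∈ R_h means that (t , h) is the last arc of a vertex other than the root, and
  -- this is visible in the departure orders.
  sets-⊆ : ∀ F G → (∀ t h → Forest.φ F t h ≡ Forest.φ G t h) →
           (∀ v → Out.out (Forest.φ F) v (Forest.walk F) ≡ Out.out (Forest.φ G) v (Forest.walk G)) →
           ∀ {t h} → t ∈ Forest.R F h → t ∈ Forest.R G h
  sets-⊆ F G φ≗ orders {t} {h} t∈ with c , e ← colour-known F t∈
    with (u , g) , le ← last-exists (Out.out (Forest.φ F) (t , just c) (Forest.walk F))
           (Forest.∈-out⁺ F (complete⇒total (Forest.complete F) (t , h)) (cong (t ,_) e))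
    with s ← proj₂ (Forest.∈-out⁻ F (Forest.walk F) (last-∈ _ le))
    with refl ← cong proj₁ s
    with refl ← Forest.rep-inj F t∈ (Forest.exits F le) (trans e (sym (V-colour s))) =
    Forest.exits G (trans (cong last (sym (orders (t , just c)))) le)

  Forest-determined : ∀ F G → (∀ t h → Forest.φ F t h ≡ Forest.φ G t h) →
    (∀ v → Out.out (Forest.φ F) v (Forest.walk F) ≡ Out.out (Forest.φ G) v (Forest.walk G)) → Setoid._≈_ Forests F G
  Forest-determined F G φ≗ orders = φ≗ , sets≡ , Forest.Trail-unique F (Forest.trail F) trailG
      (λ v → trans (orders v) (sym (out-cong φ≗ v (Forest.walk G))))
    where
    sets≡ : Forest.sets F ≡ Forest.sets G
    sets≡ = Vec-ext λ h → ⊆-antisym (sets-⊆ F G φ≗ orders) (sets-⊆ G F (λ t h → sym (φ≗ t h)) (sym ∘ orders))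
    trailG : Forest.Trail F (Forest.root F) (Forest.walk G) (Forest.root F)
    trailG = subst (λ x → Forest.Trail F (proj₁ x , nothing) (Forest.walk G) (proj₁ x , nothing)) (sym (start-unique F G φ≗))
      (Trail-cong (λ x → sym (source-cong φ≗ x))
        (λ (t , h) → trans (cong (λ A → source (Forest.φ G) (al t (Vec.lookup A h) , h)) (sym sets≡)) (sym (source-cong φ≗ _)))
        (Forest.trail G))

  ∼-functional : ∀ {C F G} → C ∼ F → C ∼ G → Setoid._≈_ Forests F G
  ∼-functional {C} {F} {G} r s = Forest-determined F G φ≗
    λ v → trans (sym (_∼_.orders r v)) (trans (cong (λ x → Out.out _ v (tour-of C x)) (start-unique F G φ≗)) (_∼_.orders s v))
    where
    φ≗ : ∀ t h → Forest.φ F t h ≡ Forest.φ G t h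
    φ≗ t h = trans (sym (_∼_.colours r t h)) (_∼_.colours s t h)

  ∼-injective : ∀ {C D F} → C ∼ F → D ∼ F → Setoid._≈_ CactusTours C D
  ∼-injective {C} {D} {F} r s = φ≗ , iterate≡⇒≗ {x = x} C.single D.single
      (Turns.Trail-unique C.φ (tour-trail C) trailD
        λ v → trans (_∼_.orders r v) (trans (sym (_∼_.orders s v)) (sym (out-cong φ≗ v (tour-of D x)))))
    where
    module C = CactusTour C
    module D = CactusTour D
    x : St
    x = Forest.start F
    φ≗ : ∀ t h → C.φ t h ≡ D.φ t h
    φ≗ t h = trans (_∼_.colours r t h) (sym (_∼_.colours s t h))
    trailD : Turns.Trail C.φ (source C.φ x) (tour-of D x) (source C.φ x)
    trailD = subst (λ v → Turns.Trail C.φ v (tour-of D x) v) (sym (source-cong φ≗ x))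
      (Trail-cong (λ y → sym (source-cong φ≗ y)) (λ y → sym (source-cong φ≗ (turn y))) (tour-trail D))

  ∼-respˡ : ∀ {C D F} → Setoid._≈_ CactusTours C D → D ∼ F → C ∼ F
  ∼-respˡ {C} {D} {F} (φ≗ , σ≗) r = record
    { colours = λ t h → trans (φ≗ t h) (_∼_.colours r t h)
    ; orders = λ v → trans (out-cong φ≗ v (tour-of C (Forest.start F)))
        (trans (cong (Out.out _ v) (iterate-cong σ≗ (Forest.start F) size)) (_∼_.orders r v)) }

  ∼-respʳ : ∀ {C F G} → Setoid._≈_ Forests F G → C ∼ F → C ∼ G
  ∼-respʳ {C} {F} {G} (φ≗ , _ , walk≡) r = record
    { colours = λ t h → trans (_∼_.colours r t h) (φ≗ t h)
    ; orders = λ v → trans (cong (λ x → Out.out _ v (tour-of C x)) (sym (List.∷-injectiveˡ walk≡)))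
        (trans (_∼_.orders r v) (trans (out-cong φ≗ v (Forest.walk F)) (cong (Out.out _ v) walk≡))) }

  turn-↭ : ∀ {l} → l ↭ states → map turn l ↭ l
  turn-↭ q = ↭-trans (↭.map⁺ turn q) (↭-trans (injective⇒↭ turn turn-injective) (↭-sym q))

  jump-↭ : ∀ {R} → Strict R → ∀ {l} → l ↭ states → map (Jumps.jump R) l ↭ l
  jump-↭ {R} s q = ↭-trans (↭.map⁺ (Jumps.jump R) q) (↭-trans (injective⇒↭ _ (Levels.jump-injective R s)) (↭-sym q))

  same-head : ∀ {src tgt tgt′ : St → V} {v x l m w} → Trails.Trail _≟ᵥ_ src tgt v (x ∷ l) w → 
              Trails.Trail _≟ᵥ_ src tgt′ v m v → m ↭ states →
              Stacks.out _≟ᵥ_ src v m ≡ Stacks.out _≟ᵥ_ src v (x ∷ l) → ∃ λ l′ → m ≡ x ∷ l′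
  same-head {src} {tgt} {tgt′} {x = x} {l} {[]} τ τ′ q e with () ← complete⇒total q x
  same-head {src} {tgt} {tgt′} {x = x} {l} {y ∷ m} τ τ′ q e = m , cong (_∷ m) (List.∷-injectiveˡ
    (trans (sym (Stacks.out-here _≟ᵥ_ src (sym (proj₁ (Trails.Trail-uncons _≟ᵥ_ src tgt′ τ′))) m))
      (trans e (Stacks.out-here _≟ᵥ_ src (sym (proj₁ (Trails.Trail-uncons _≟ᵥ_ src tgt τ))) l))))

  module FromForest (F : Forest) where
    open Forest F hiding (Trail; Reach; Exits; trail-exists; Trail⇒Exits; Balanced-circuit; Trail-uncons; Trail-unique; Trail-follows)

    private
      lasts-agree : ∀ {v x} → v ≢ root → last (out v walk) ≡ just x → source φ (Jumps.jump R x) ≡ source φ (turn x)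
      lasts-agree {v} {t , h} v≢ le = cong (λ u → source φ (u , h)) (RunLaws.al-∈ (laws (R h) (strict h)) t∈)
        where
        t∈ : t ∈ R h
        t∈ with φ t h in e | proj₂ (∈-out⁻ walk (last-∈ _ le))
        ... | nothing | s = contradiction (trans (sym s) (cong (_, nothing) (at-root e))) v≢
        ... | just c  | refl = exits le

      built : ∃ λ l → Turns.Trail φ root l root × l ↭ walk × Out._≈ˢ_ φ l walk
      built = Turns.trail-exists φ walk
        (Turns.Balanced-circuit φ {u = root} turn (λ _ → refl) (turn-↭ complete))
        (λ x∈ → Reach-retarget lasts-agree (Forest.Trail⇒Exits F trail x∈))

    l : List St
    l = proj₁ built

    l↭ : l ↭ states
    l↭ = ↭-trans (proj₁ (proj₂ (proj₂ built))) complete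

    headed : ∃ λ l′ → l ≡ start ∷ l′
    headed = same-head trail (proj₁ (proj₂ built)) l↭ (proj₂ (proj₂ (proj₂ built)) root)

    l′ : List St
    l′ = proj₁ headed

    l′↭ : start ∷ l′ ↭ states
    l′↭ = subst (_↭ states) (proj₂ headed) l↭

    cactusTour : CactusTour
    cactusTour = record
      { φ = φ ; t₀ = proj₁ start ; at-root = at-root ; root-∃ = proj₂ start , start-rooted F
      ; attained = λ t c → let h , _ , e = rep-surj t c in h , e
      ; σ = next start (start ∷ l′) ; single = next-SingleCycle l′↭
      ; matched = λ x → Turns.Trail-follows φ (next-follows (complete⇒unique l′↭))
          (subst (λ m → Turns.Trail φ root m root) (proj₂ headed) (proj₁ (proj₂ built)))
          (sym (proj₁ (Forest.Trail-uncons F trail))) (complete⇒total l′↭ x)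
      }

    cactusTour∼ : cactusTour ∼ F
    cactusTour∼ = record
      { colours = λ _ _ → refl
      ; orders = λ v → trans (cong (out v) (trans (iterate-next l′↭) (sym (proj₂ headed)))) (proj₂ (proj₂ (proj₂ built)) v) }

  module ToForest (C : CactusTour) where
    open CactusTour C
    open Turns φ

    root : V
    root = t₀ , nothing

    private
      roots : ∃ λ x → source φ x ≡ root × (∀ {y} → source φ y ≡ root → rank x ≤ rank y)
      roots with out root states in e
      ... | []     = contradiction (subst ((t₀ , proj₁ root-∃) ∈ₗ_) e
                       (∈-out⁺ (states-total _) (cong (t₀ ,_) (proj₂ root-∃)))) λ ()
      ... | y ∷ ys with m , m∈ , least ← minimum {_⊑_ = λ x y → rank x ≤ rank y}
                          (λ x y → ℕ.≤-total (rank x) (rank y)) ℕ.≤-trans y ys =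
        m , proj₂ (∈-out⁻ states (subst (m ∈ₗ_) (sym e) m∈))
        , λ s → least (subst (_ ∈ₗ_) e (∈-out⁺ (states-total _) s))

    x : St
    x = proj₁ roots

    x-root : source φ x ≡ root
    x-root = proj₁ (proj₂ roots)

    l : List St
    l = tour-of C x

    l↭ : l ↭ states
    l↭ = cycle-complete single x

    trail : Trail root l root
    trail = subst (λ v → Trail v l v) x-root (tour-trail C)

    opaque
      lastArc : ∀ t c → ∃ λ h → last (out (t , just c) l) ≡ just (t , h) × φ t h ≡ just c
      lastArc t c with h , e ← attained t c
        with (u , g) , le ← last-exists (out (t , just c) l) (∈-out⁺ (complete⇒total l↭ (t , h)) (cong (t ,_) e))
        with s ← proj₂ (∈-out⁻ l (last-∈ (out (t , just c) l) le)) with refl ← cong proj₁ s = g , le , V-colour s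

    g : ∀ t → Fin (p t) → Fin n
    g t c = proj₁ (lastArc t c)

    isRep? : ∀ t h → Dec (∃ λ c → g t c ≡ h)
    isRep? t h = Fin.any? λ c → g t c Fin.≟ h

    sets : Vec.Vec (Subset k) n
    sets = Vec.tabulate λ h → Vec.tabulate λ t → does (isRep? t h)

    R : Fin n → Subset k
    R = Vec.lookup sets

    R≡ : ∀ h → R h ≡ Vec.tabulate λ t → does (isRep? t h)
    R≡ h = Vec.lookup∘tabulate _ h

    ∈-R⁻ : ∀ {t h} → t ∈ R h → ∃ λ c → g t c ≡ h
    ∈-R⁻ {t} {h} t∈ = ∈-separation⁻ (λ t → isRep? t h) (subst (t ∈_) (R≡ h) t∈)

    ∈-R⁺ : ∀ t c → t ∈ R (g t c)
    ∈-R⁺ t c = subst (t ∈_) (sym (R≡ (g t c))) (∈-separation⁺ (λ u → isRep? u (g t c)) (c , refl))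

    φ-g : ∀ t c → φ t (g t c) ≡ just c
    φ-g t c = proj₂ (proj₂ (lastArc t c))

    ∈-R-colour : ∀ {t h} → t ∈ R h → ∃ λ c → g t c ≡ h × φ t h ≡ just c
    ∈-R-colour {t} t∈ = let c , e = ∈-R⁻ t∈ in c , e , trans (cong (φ t) (sym e)) (φ-g t c)

    g-last : ∀ {t c y} → last (out (t , just c) l) ≡ just y → y ≡ (t , g t c)
    g-last {t} {c} le = Maybe.just-injective (trans (sym le) (proj₁ (proj₂ (lastArc t c))))

    -- If R h is everything, then the last arcs around h form a cycle.
    not-all : ∀ h → ¬ (∀ t → t ∈ R h)
    not-all h all = no-reach (Trail⇒Exits trail (complete⇒total l↭ (t₀ , h))) t₀ refl
      where
      no-reach : ∀ {v} → Reach l root v → ∀ t → v ≡ (t , φ t h) → ⊥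
      no-reach here t e with c , _ , f ← ∈-R-colour (all t) with refl ← cong proj₁ e =
        contradiction (trans (V-colour e) f) λ ()
      no-reach (via {e = y} le r) t refl with c , e , f ← ∈-R-colour (all t) =
        no-reach r (pre t) (cong (source φ ∘ turn) (trans (g-last (trans (cong (λ c → last (out (t , c) l)) (sym f)) le)) (cong (t ,_) e)))

    strict : Strict R
    strict h = Fin.¬∀⟶∃¬ k (_∈ R h) (_∈? R h) (not-all h)

    mult : Multiplicities R
    mult t = bijection⇒∣∣ (column R t) (g t)
      (λ {c} {d} e → Maybe.just-injective (trans (sym (φ-g t c)) (trans (cong (φ t) e) (φ-g t d))))
      (λ c → ∈-column⁺ R (∈-R⁺ t c)) (λ q → ∈-R⁻ (∈-column⁻ R q))

    jump : St → St
    jump = Jumps.jump R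

    lasts-agree : ∀ {v y} → v ≢ root → last (out v l) ≡ just y → source φ (turn y) ≡ source φ (jump y)
    lasts-agree {v} {t , h} v≢ le = cong (λ u → source φ (u , h)) (sym (RunLaws.al-∈ (laws (R h) (strict h)) t∈))
      where
      t∈ : t ∈ R h
      t∈ with φ t h in e | proj₂ (∈-out⁻ l (last-∈ _ le))
      ... | nothing | s = contradiction (trans (sym s) (cong (_, nothing) (at-root e))) v≢
      ... | just c  | refl = subst (λ y → proj₁ y ∈ R (proj₂ y)) (sym (g-last le)) (∈-R⁺ t c)

    private
      built : ∃ λ m → JumpTrails.Trail φ R root m root × m ↭ l × Out._≈ˢ_ φ m l
      built = JumpTrails.trail-exists φ R l (JumpTrails.Balanced-circuit φ R {u = root} jump (λ _ → refl) (jump-↭ strict l↭))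
        (λ x∈ → Reach-retarget lasts-agree (Trail⇒Exits trail x∈))

      l-headed : ∃ λ l′ → l ≡ x ∷ l′
      l-headed = go size l↭
        where
        go : ∀ m → iterate σ x m ↭ states → ∃ λ l′ → iterate σ x m ≡ x ∷ l′
        go zero    q with () ← complete⇒total q x
        go (suc m) q = iterate σ (σ x) m , refl

      m : List St
      m = proj₁ built

      m-orders : ∀ v → out v m ≡ out v l
      m-orders = proj₂ (proj₂ (proj₂ built))

      m-headed : ∃ λ m′ → m ≡ x ∷ m′
      m-headed = same-head (subst (λ l → Trail root l root) (proj₂ l-headed) trail) (proj₁ (proj₂ built))
        (↭-trans (proj₁ (proj₂ (proj₂ built))) l↭) (trans (m-orders root) (cong (out root) (proj₂ l-headed)))

      x-type : proj₁ x ≡ t₀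
      x-type = cong proj₁ x-root

    forest : Forest
    forest = record
      { φ = φ ; sets = sets ; start = x ; rest = proj₁ m-headed ; strict = strict ; mult = mult
      ; rep-just = λ t∈ e → contradiction (trans (sym (proj₂ (proj₂ (∈-R-colour t∈)))) e) λ ()
      ; rep-inj = λ {t} t∈ t∈′ e → let c , a , f = ∈-R-colour t∈ ; d , b , f′ = ∈-R-colour t∈′ in
          trans (sym a) (trans (cong (g t) (Maybe.just-injective (trans (sym f) (trans e f′)))) b)
      ; rep-surj = λ t c → g t c , ∈-R⁺ t c , φ-g t c
      ; at-root = λ e → trans (at-root e) (sym x-type)
      ; complete = subst (_↭ states) (proj₂ m-headed) (↭-trans (proj₁ (proj₂ (proj₂ built))) l↭)
      ; trail = subst₂ (λ t m → JumpTrails.Trail φ R (t , nothing) m (t , nothing)) (sym x-type) (proj₂ m-headed) (proj₁ (proj₂ built))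
      ; exits = λ {t} {c} le → subst (λ y → proj₁ y ∈ R (proj₂ y))
          (sym (g-last (trans (cong last (trans (sym (m-orders (t , just c))) (cong (out (t , just c)) (proj₂ m-headed)))) le))) (∈-R⁺ t c)
      ; least = λ s → proj₂ (proj₂ roots) (trans s (cong (_, nothing) x-type))
      }

    ∼forest : C ∼ forest
    ∼forest = record
      { colours = λ _ _ → refl ; orders = λ v → trans (sym (m-orders v)) (cong (out v) (proj₂ m-headed)) }

  CactusTours≃Forests : CactusTours ≃ Forests
  CactusTours≃Forests = bijective⇒≃ {CactusTours} {Forests} ToForest.forest
    (λ {C} {D} e → ∼-functional {C} {ToForest.forest C} {ToForest.forest D} (ToForest.∼forest C)
      (∼-respˡ {C} {D} {ToForest.forest D} e (ToForest.∼forest D)))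
    (λ {C} {D} e → ∼-injective {C} {D} {ToForest.forest D}
      (∼-respʳ {C} {ToForest.forest C} {ToForest.forest D} e (ToForest.∼forest C)) (ToForest.∼forest D))
    λ F → FromForest.cactusTour F , ∼-functional {FromForest.cactusTour F} {ToForest.forest (FromForest.cactusTour F)} {F}
      (ToForest.∼forest (FromForest.cactusTour F)) (FromForest.cactusTour∼ F)

-- Valid biddings

-- There is one edge for each vertex but the last, towards its successor under f. Such a graph is a
-- tree exactly if the successors lead from everywhere to the last vertex, which turns validity into
-- the condition of the BEST theorem.
module SuccessorGraph (m : ℕ) (f : Fin m → Fin (suc m)) where

  graph : Multigraph
  graph = record { vertices = suc m ; edges = m ; ends = λ e → embed e , f e }

  data ToLast : Fin (suc m) → Set where
    here : ToLast (fromℕ m)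
    via  : ∀ e → ToLast (f e) → ToLast (embed e)

  embed≡inject₁ : ∀ (e : Fin m) → embed e ≡ inject₁ e
  embed≡inject₁ e = Fin.toℕ-injective (trans (Fin.toℕ-inject≤ e _) (sym (Fin.toℕ-inject₁ e)))

  embed-injective : ∀ {e e′ : Fin m} → embed e ≡ embed e′ → e ≡ e′
  embed-injective {e} {e′} q = Fin.inject₁-injective (trans (sym (embed≡inject₁ e)) (trans q (embed≡inject₁ e′)))

  embed≢last : ∀ {e : Fin m} → embed e ≢ fromℕ m
  embed≢last {e} q = Fin.fromℕ≢inject₁ (trans (sym q) (embed≡inject₁ e))

  last-or-embed : ∀ {m} (v : Fin (suc m)) → v ≡ fromℕ m ⊎ ∃ λ (e : Fin m) → v ≡ inject₁ e
  last-or-embed {zero}  zero    = inj₁ refl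
  last-or-embed {suc m} zero    = inj₂ (zero , refl)
  last-or-embed {suc m} (suc v) with last-or-embed v
  ... | inj₁ q       = inj₁ (cong suc q)
  ... | inj₂ (e , q) = inj₂ (suc e , cong suc q)

  cases : ∀ (v : Fin (suc m)) → v ≡ fromℕ m ⊎ ∃ λ (e : Fin m) → v ≡ embed e
  cases v with last-or-embed v
  ... | inj₁ q       = inj₁ q
  ... | inj₂ (e , q) = inj₂ (e , trans q (sym (embed≡inject₁ e)))

  unvia : ∀ {v} → ToLast v → ∀ {e} → v ≡ embed e → ToLast (f e)
  unvia here       q = contradiction (sym q) embed≢last
  unvia (via e r)  q = subst (ToLast ∘ f) (embed-injective q) r

  -- A walk to the last vertex is read from its end: an edge taken forwards adds a step to the chain
  -- of successors, and an edge taken backwards removes one.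
  tree⇒toLast : IsTree graph → ∀ v → ToLast v
  tree⇒toLast (connected , _) v = along (connected v (fromℕ m)) here
    where
    along : ∀ {u w} → Walk graph u w → ToLast w → ToLast u
    along stop r = r
    along (step e (inj₁ refl) w) r = via e (along w r)
    along (step e (inj₂ refl) w) r = unvia (along w r) refl

  module _ (all : ∀ v → ToLast v) where
    private
      size : ∀ {v} → ToLast v → ℕ
      size here      = 0
      size (via e r) = suc (size r)

      size-unique : ∀ {v w} (r : ToLast v) (s : ToLast w) → v ≡ w → size r ≡ size s
      size-unique here      here      q = refl
      size-unique here      (via e s) q = contradiction (sym q) embed≢last
      size-unique (via e r) here      q = contradiction q embed≢last
      size-unique (via e r) (via e′ s) q = cong suc (size-unique r s (cong f (embed-injective q)))

      D : Fin (suc m) → ℕ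
      D v = size (all v)

      D-embed : ∀ e → D (embed e) ≡ suc (D (f e))
      D-embed e = size-unique (all (embed e)) (via e (all (f e))) refl

      _▹_ : ∀ {u v w} → Walk graph u v → Walk graph v w → Walk graph u w
      stop       ▹ w′ = w′
      step e j w ▹ w′ = step e j (w ▹ w′)

      to-last : ∀ {v} → ToLast v → Walk graph v (fromℕ m)
      to-last here      = stop
      to-last (via e r) = step e (inj₁ refl) (to-last r)

      from-last : ∀ {v} → ToLast v → Walk graph (fromℕ m) v
      from-last here      = stop
      from-last (via e r) = from-last r ▹ step e (inj₂ refl) stop

      -- A walk that does not repeat edges keeps going down once it has
      -- started to go down.
      sink : ∀ {u v} e (w : Walk graph (embed e) v) → u ≡ f e → Unique (e ∷ walkEdges graph w) →
             D u < D v × ∃ λ e′ → e′ ∈ₗ e ∷ walkEdges graph w × embed e′ ≡ v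
      sink e stop refl _ = subst (D (f e) <_) (sym (D-embed e)) ℕ.≤-refl , e , here refl , refl
      sink e (step e′ (inj₁ q) w) refl (e∉ ∷ _) = contradiction (sym (embed-injective (cong proj₁ q))) (All.lookup e∉ (here refl))
      sink e (step e′ (inj₂ q) w) refl (_ ∷ u) with refl ← cong proj₁ q
        with d , e″ , e″∈ , s ← sink e′ w (sym (cong proj₂ q)) u =
        ℕ.<-trans (subst (D (f e) <_) (sym (D-embed e)) ℕ.≤-refl) d , e″ , there e″∈ , s

      -- After a step upwards, a walk without repeated edges either goes on upwards or turns and
      -- then, by `sink`, ends in the lower end of one of its later edges. For a closed walk the
      -- former contradicts the distances D, and the latter repeats the edge e.
      climb : ∀ {u v} e → u ≡ embed e → (w : Walk graph (f e) v) → Unique (e ∷ walkEdges graph w) →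
              D v < D u ⊎ ∃ λ e′ → e′ ∈ₗ walkEdges graph w × embed e′ ≡ v
      climb e refl stop _ = inj₁ (subst (D (f e) <_) (sym (D-embed e)) ℕ.≤-refl)
      climb e refl (step e′ (inj₁ q) w) (_ ∷ u) with refl ← cong proj₂ q
        with climb e′ (sym (cong proj₁ q)) w u
      ... | inj₁ d = inj₁ (ℕ.<-trans d (subst (D (f e) <_) (sym (D-embed e)) ℕ.≤-refl))
      ... | inj₂ (e″ , e″∈ , s) = inj₂ (e″ , there e″∈ , s)
      climb e refl (step e′ (inj₂ q) w) (_ ∷ u) with refl ← cong proj₁ q =
        inj₂ (proj₂ (sink e′ w (sym (cong proj₂ q)) u))

    toLast⇒tree : IsTree graph
    toLast⇒tree = (λ u v → to-last (all u) ▹ from-last (all v)) , acyclic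
      where
      acyclic : ∀ {u} (w : Walk graph u u) → ¬ IsCycle graph w
      acyclic stop (≢[] , _) = ≢[] refl
      acyclic (step e (inj₁ refl) w) (_ , (e∉ ∷ un) , _) with climb e refl w (e∉ ∷ un)
      ... | inj₁ d                = ℕ.<-irrefl refl d
      ... | inj₂ (e′ , e′∈ , s) = All.lookup e∉ e′∈ (sym (embed-injective s))
      acyclic (step e (inj₂ refl) w) (_ , un , _) = ℕ.<-irrefl refl (proj₁ (sink e w refl un))

mod≡fromℕ : ∀ n → n mod suc n ≡ fromℕ n
mod≡fromℕ n = Fin.toℕ-injective (trans (Fin.toℕ-fromℕ< (ℕ.m%n<n n (suc n)))
  (trans (ℕ.m<n⇒m%n≡m (ℕ.n<1+n n)) (sym (Fin.toℕ-fromℕ n))))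

module ValidBiddingTours (k′ n′ : ℕ) (p : Vector ℕ (suc k′)) where
  private
    k n : ℕ
    k = suc k′
    n = suc n′

  open Cyclic k′ using (depth; runLaws; predecessor-injective)
  open Tours k n predecessor α depth runLaws (λ {t} {u} → predecessor-injective {t} {u}) p public

  Bidding : Set
  Bidding = Setoid.Carrier (Biddings n p)

  top : Fin k
  top = fromℕ k′

  block : (Fin k → Permutation′ n) → Fin k → List St
  block ω t = tabulate λ j → t , ω t ⟨$⟩ʳ j

  -- The input for `trail-exists`: of this arrangement of the arcs, only the departure orders ω
  -- matter.
  blocks : (Fin k → Permutation′ n) → List (Fin k) → List St
  blocks ω ts = concat (map (block ω) ts)

  blocks-↭ : ∀ ω → blocks ω (allFin k) ↭ states
  blocks-↭ ω = go (allFin k)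
    where
    block-↭ : ∀ t → block ω t ↭ map (t ,_) (allFin n)
    block-↭ t = subst (_↭ map (t ,_) (allFin n))
      (trans (cong (map (t ,_)) (List.map-tabulate id (ω t ⟨$⟩ʳ_))) (List.map-tabulate (ω t ⟨$⟩ʳ_) (t ,_)))
      (↭.map⁺ (t ,_) (Enumerated.injective⇒↭ Fin._≟_ (allFin n) (Unique.allFin⁺ n) ∈.∈-allFin (ω t ⟨$⟩ʳ_)
        λ e → trans (sym (inverseˡ (ω t))) (trans (cong (ω t ⟨$⟩ˡ_) e) (inverseˡ (ω t)))))
    go : ∀ ts → blocks ω ts ↭ cartesianProduct ts (allFin n)
    go []       = ↭-refl
    go (t ∷ ts) = ↭.++⁺ (block-↭ t) (go ts)

  module TypeOut = Stacks (Fin._≟_ {n = k}) (proj₁ {B = λ _ → Fin n})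
  open TypeOut using (out)
  module TypeTrails (R : Fin n → Subset k) = Trails (Fin._≟_ {n = k}) (proj₁ {B = λ _ → Fin n}) (proj₁ ∘ Jumps.jump R)

  out-blocks : ∀ ω t → out t (blocks ω (allFin k)) ≡ block ω t
  out-blocks ω t = present (allFin k) (Unique.allFin⁺ k) (∈.∈-allFin t)
    where
    P? : ∀ x → Dec (proj₁ x ≡ t)
    P? x = proj₁ x Fin.≟ t
    own : filter P? (block ω t) ≡ block ω t
    own = List.filter-all P? (All.tabulate⁺ {f = λ j → t , ω t ⟨$⟩ʳ j} λ _ → refl)
    other : ∀ {u} → u ≢ t → filter P? (block ω u) ≡ []
    other {u} u≢t = List.filter-none P? (All.tabulate⁺ {f = λ j → u , ω u ⟨$⟩ʳ j} λ _ → u≢t)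
    absent : ∀ ts → t ∉ₗ ts → filter P? (blocks ω ts) ≡ []
    absent []       _  = refl
    absent (u ∷ ts) t∉ = trans (List.filter-++ P? (block ω u) (blocks ω ts))
      (cong₂ _++_ (other (λ e → t∉ (here (sym e)))) (absent ts (t∉ ∘ there)))
    present : ∀ ts → Unique ts → t ∈ₗ ts → filter P? (blocks ω ts) ≡ block ω t
    present (u ∷ ts) (u∉ ∷ un) (here refl) = trans (List.filter-++ P? (block ω t) (blocks ω ts))
      (trans (cong₂ _++_ own (absent ts λ q → All.lookup u∉ q refl)) (List.++-identityʳ _))
    present (u ∷ ts) (u∉ ∷ un) (there q) = trans (List.filter-++ P? (block ω u) (blocks ω ts))
      (cong₂ _++_ (other (All.lookup u∉ q)) (present ts un q))

  successor : (Fin k → Permutation′ n) → (Fin n → Subset k) → Fin k′ → Fin k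
  successor ω R e = α (embed e) (R (ω (embed e) ⟨$⟩ʳ (n′ mod n)))

  module _ (ω : Fin k → Permutation′ n) (R R′ : Fin n → Subset k) (R≗ : R ≗ R′) {m : List St}
           (orders : ∀ t → out t m ≡ block ω t) where
    open SuccessorGraph k′ (successor ω R)
    open TypeTrails R′ using (Reach; here; via)

    private
      last-arc : ∀ t → last (out t m) ≡ just (t , ω t ⟨$⟩ʳ (n′ mod n))
      last-arc t = trans (cong last (orders t)) (trans (last-tabulate (λ j → t , ω t ⟨$⟩ʳ j))
        (cong (λ j → just (t , ω t ⟨$⟩ʳ j)) (sym (mod≡fromℕ n′))))

    toLast⇒reach : ∀ {v} → ToLast v → Reach m top v
    toLast⇒reach here      = here
    toLast⇒reach (via e r) = via (last-arc (embed e)) (subst (Reach m top) (cong (α (embed e)) (R≗ _)) (toLast⇒reach r))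

    reach⇒toLast : ∀ {v} → Reach m top v → ToLast v
    reach⇒toLast here = here
    reach⇒toLast (via {v} {x} le r) with cases v
    ... | inj₁ refl = here
    ... | inj₂ (e , refl) with refl ← trans (sym le) (last-arc (embed e)) =
      via e (subst ToLast (sym (cong (α (embed e)) (R≗ _))) (reach⇒toLast r))

  -- The permutation ω_t lists the hyperedges in the order in which the tour, started at (`top` ,
  -- h), leaves type t. In particular h is the first value of ω_k.
  record _≋ᵇ_ (B : Bidding) (T : TypedTour × Fin n) : Set where
    field
      same-sets : ∀ h → 𝓜.tuple (proj₂ B) h ≡ TypedTour.R (proj₁ T) h
      orders    : ∀ t → out t (iterate (TypedTour.σ (proj₁ T)) (top , proj₂ T) size) ≡ block (proj₁ B) t

  tour-trailᵗ : ∀ T {x} → TypeTrails.Trail (TypedTour.R T) (proj₁ x) (iterate (TypedTour.σ T) x size) (proj₁ x)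
  tour-trailᵗ T {x} = go size (TypeTrails.follows-Trail R (cycle-follows single x) typed) (cycle-complete single x)
    where
    open TypedTour T
    go : ∀ m → TypeTrails.Trail R (proj₁ (headOr x (iterate σ x m))) (iterate σ x m) (proj₁ x) → iterate σ x m ↭ states →
         TypeTrails.Trail R (proj₁ x) (iterate σ x m) (proj₁ x)
    go zero    τ _ = τ
    go (suc m) τ _ = τ

  ≋ᵇ-injective : ∀ {B C T} → B ≋ᵇ T → C ≋ᵇ T → Setoid._≈_ (Biddings n p) B C
  ≋ᵇ-injective {ω , _} {ω′ , _} r s =
    (λ t j → cong proj₂ (tabulate-injective {f = λ j → t , ω t ⟨$⟩ʳ j} {g = λ j → t , ω′ t ⟨$⟩ʳ j} (trans (sym (_≋ᵇ_.orders r t)) (_≋ᵇ_.orders s t)) j))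
    , λ h → trans (_≋ᵇ_.same-sets r h) (sym (_≋ᵇ_.same-sets s h))

  ≋ᵇ-respˡ : ∀ {B C T} → Setoid._≈_ (Biddings n p) B C → C ≋ᵇ T → B ≋ᵇ T
  ≋ᵇ-respˡ (ω≈ , R≗) r = record
    { same-sets = λ h → trans (R≗ h) (_≋ᵇ_.same-sets r h)
    ; orders = λ t → trans (_≋ᵇ_.orders r t) (List.tabulate-cong λ j → cong (t ,_) (sym (ω≈ t j))) }

  ≋ᵇ-respʳ : ∀ {B T U} → Setoid._≈_ (×-setoid TypedTours (≡-setoid (Fin n))) T U → B ≋ᵇ T → B ≋ᵇ U
  ≋ᵇ-respʳ {T = T , h} ((sets≡ , σ≗) , refl) r = record
    { same-sets = λ h → trans (_≋ᵇ_.same-sets r h) (cong (λ A → Vec.lookup A h) sets≡)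
    ; orders = λ t → trans (cong (out t) (sym (iterate-cong σ≗ (top , h) size))) (_≋ᵇ_.orders r t) }

  out-iterate : ∀ (T : TypedTour) x → ∃ λ l → out (proj₁ x) (iterate (TypedTour.σ T) x size) ≡ x ∷ l
  out-iterate T x = go size (cycle-complete (TypedTour.single T) x)
    where
    go : ∀ m → iterate (TypedTour.σ T) x m ↭ states → ∃ λ l → out (proj₁ x) (iterate (TypedTour.σ T) x m) ≡ x ∷ l
    go zero    q with () ← complete⇒total q x
    go (suc m) q = _ , TypeOut.out-here refl (iterate (TypedTour.σ T) (TypedTour.σ T x) m)

  ≋ᵇ-functional : ∀ {B T U} → B ≋ᵇ T → B ≋ᵇ U → Setoid._≈_ (×-setoid TypedTours (≡-setoid (Fin n))) T U
  ≋ᵇ-functional {B} {T , h} {U , g} r s = (sets≡ , iterate≡⇒≗ {x = top , h} T.single U.single tours≡) , h≡g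
    where
    module T = TypedTour T
    module U = TypedTour U
    sets≡ : T.sets ≡ U.sets
    sets≡ = Vec-ext λ i → trans (sym (_≋ᵇ_.same-sets r i)) (_≋ᵇ_.same-sets s i)
    h≡g : h ≡ g
    h≡g = cong proj₂ (List.∷-injectiveˡ (trans (sym (proj₂ (out-iterate T (top , h))))
      (trans (trans (_≋ᵇ_.orders r top) (sym (_≋ᵇ_.orders s top))) (proj₂ (out-iterate U (top , g))))))
    tours≡ : iterate T.σ (top , h) size ≡ iterate U.σ (top , h) size
    tours≡ = TypeTrails.Trail-unique T.R (tour-trailᵗ T)
      (subst (λ A → TypeTrails.Trail (Vec.lookup A) top (iterate U.σ (top , h) size) top) (sym sets≡) (tour-trailᵗ U))
      λ t → trans (_≋ᵇ_.orders r t) (trans (sym (_≋ᵇ_.orders s t)) (cong (λ g → out t (iterate U.σ (top , g) size)) (sym h≡g)))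

  module FromBidding (ω : Fin k → Permutation′ n) (M : 𝓜 n p) (valid : Valid {n = n} {p} (ω , M)) where

    sets : Vec.Vec (Subset k) n
    sets = Vec.tabulate (𝓜.tuple M)

    R : Fin n → Subset k
    R = Vec.lookup sets

    R≗ : 𝓜.tuple M ≗ R
    R≗ h = sym (Vec.lookup∘tabulate (𝓜.tuple M) h)

    strict : Strict R
    strict h = let t , _ , t∉ = proj₂ (𝓜.strict M h) in t , subst (t ∉_) (R≗ h) t∉

    mult : Multiplicities R
    mult t = trans (cong ∣_∣ (Vec.tabulate-cong λ h → cong (λ A → Vec.lookup A t) (sym (R≗ h)))) (𝓜.multiplicity M t)

    m : List St
    m = blocks ω (allFin k)

    opaque
      built : ∃ λ l → TypeTrails.Trail R top l top × l ↭ m × l TypeOut.≈ˢ m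
      built = TypeTrails.trail-exists R m
        (TypeTrails.Balanced-circuit R {u = top} (Jumps.jump R) (λ _ → refl) (jump-↭ strict (blocks-↭ ω)))
        (λ {x} _ → toLast⇒reach ω (𝓜.tuple M) R R≗ {m} (out-blocks ω)
          (SuccessorGraph.tree⇒toLast k′ (successor ω (𝓜.tuple M)) valid (proj₁ x)))

    complete : proj₁ built ↭ states
    complete = ↭-trans (proj₁ (proj₂ (proj₂ built))) (blocks-↭ ω)

    headed : ∃ λ h → ∃ λ l → proj₁ built ≡ (top , h) ∷ l
    headed = go (proj₁ (proj₂ built)) complete
      where
      go : ∀ {l} → TypeTrails.Trail R top l top → l ↭ states → ∃ λ h → ∃ λ l′ → l ≡ (top , h) ∷ l′
      go {[]}          τ q with () ← complete⇒total q (top , zero)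
      go {(t , h) ∷ l} τ q with refl ← proj₁ (TypeTrails.Trail-uncons R τ) = h , l , refl

    h₀ : Fin n
    h₀ = proj₁ headed

    l : List St
    l = proj₁ (proj₂ headed)

    l≡ : proj₁ built ≡ (top , h₀) ∷ l
    l≡ = proj₂ (proj₂ headed)

    l↭ : (top , h₀) ∷ l ↭ states
    l↭ = subst (_↭ states) l≡ complete

    typedTour : TypedTour
    typedTour = record
      { sets = sets ; strict = strict ; mult = mult ; σ = next (top , h₀) ((top , h₀) ∷ l)
      ; single = next-SingleCycle l↭
      ; typed = λ x → TypeTrails.Trail-follows R (next-follows (complete⇒unique l↭))
          (subst (λ l → TypeTrails.Trail R top l top) l≡ (proj₁ (proj₂ built))) refl (complete⇒total l↭ x) }

    related : (ω , M) ≋ᵇ (typedTour , h₀)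
    related = record
      { same-sets = R≗
      ; orders = λ t → trans (cong (out t) (trans (iterate-next l↭) (sym l≡)))
          (trans (proj₂ (proj₂ (proj₂ built)) t) (out-blocks ω t)) }

  module ToBidding (T : TypedTour) (h : Fin n) where
    open TypedTour T

    private
      l : List St
      l = iterate σ (top , h) size

      l↭ : l ↭ states
      l↭ = cycle-complete single (top , h)

      opaque
        order : ∀ t → Σ (Permutation′ n) λ π → tabulate (π ⟨$⟩ʳ_) ≡ map proj₂ (out t l)
        order t = ↭-allFin⇒permutation (subst (map proj₂ (out t l) ↭_)
          (trans (cong (map proj₂) (out-blocks (λ _ → idₚ) t)) (List.map-tabulate (λ j → t , j) proj₂))
          (↭.map⁺ proj₂ (↭.filter-↭ (λ x → proj₁ x Fin.≟ t) (↭-trans l↭ (↭-sym (blocks-↭ λ _ → idₚ))))))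

      ω : Fin k → Permutation′ n
      ω t = proj₁ (order t)

      retype : ∀ {t} (xs : List St) → All (λ x → proj₁ x ≡ t) xs → map (t ,_) (map proj₂ xs) ≡ xs
      retype []       []          = refl
      retype (x ∷ xs) (refl ∷ ps) = cong (x ∷_) (retype xs ps)

      orders : ∀ t → out t l ≡ block ω t
      orders t = trans (sym (retype (out t l) (All.all-filter (λ x → proj₁ x Fin.≟ t) l)))
        (trans (cong (map (t ,_)) (sym (proj₂ (order t)))) (List.map-tabulate (ω t ⟨$⟩ʳ_) (t ,_)))

    bidding : Bidding
    bidding = ω , record
      { tuple = R ; strict = λ i → (λ _ → ∈⊤) , proj₁ (strict i) , ∈⊤ , proj₂ (strict i) ; multiplicity = mult }

    valid : Valid {n = n} {p} bidding
    valid = SuccessorGraph.toLast⇒tree k′ (successor ω R) λ v →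
      reach⇒toLast ω R R (λ _ → refl) {l} orders
        (TypeTrails.Trail⇒Exits R (tour-trailᵗ T) (complete⇒total l↭ (v , h)))

    related : bidding ≋ᵇ (T , h)
    related = record { same-sets = λ _ → refl ; orders = orders }

  ValidBiddings≃TypedTours : ValidBiddings n p ≃ ×-setoid TypedTours (≡-setoid (Fin n))
  ValidBiddings≃TypedTours = bijective⇒≃ {ValidBiddings n p} {×-setoid TypedTours (≡-setoid (Fin n))} to
    (λ {B} {C} e → ≋ᵇ-functional (to-related B) (≋ᵇ-respˡ e (to-related C)))
    (λ {B} {C} e → ≋ᵇ-injective (≋ᵇ-respʳ e (to-related B)) (to-related C))
    λ (T , h) → (ToBidding.bidding T h , ToBidding.valid T h)
      , ≋ᵇ-functional (to-related (ToBidding.bidding T h , ToBidding.valid T h)) (ToBidding.related T h)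
    where
    to : Setoid.Carrier (ValidBiddings n p) → TypedTour × Fin n
    to ((ω , M) , valid) = FromBidding.typedTour ω M valid , FromBidding.h₀ ω M valid
    to-related : ∀ B → proj₁ B ≋ᵇ to B
    to-related ((ω , M) , valid) = FromBidding.related ω M valid

-- The long cycle and the white face

module _ {n k : ℕ} where

  compose-conj : (f : Fin n → Fin n) (ρ π : Vector (Permutation′ n) k) →
                 (∀ t j → f (π t ⟨$⟩ʳ j) ≡ ρ t ⟨$⟩ʳ f j) → ∀ j → f (compose π j) ≡ compose ρ (f j)
  compose-conj f ρ π e j = go ρ π e
    where
    go : ∀ {m} (ρ π : Vector (Permutation′ n) m) → (∀ t j → f (π t ⟨$⟩ʳ j) ≡ ρ t ⟨$⟩ʳ f j) → f (compose π j) ≡ compose ρ (f j)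
    go {zero}  ρ π e = refl
    go {suc m} ρ π e = trans (e zero (compose (π ∘ suc) j)) (cong (ρ zero ⟨$⟩ʳ_) (go (ρ ∘ suc) (π ∘ suc) (e ∘ suc)))

module _ {X : Set} where
  open Endo X using () renaming (_^_ to _^ₑ_)

  SingleCycle-conj : {Y : Set} {f : X → X} {g : Y → Y} (E : X → Y) → (∀ x → E (f x) ≡ g (E x)) →
                     (∀ y → ∃ λ x → E x ≡ y) → SingleCycle f → SingleCycle g
  SingleCycle-conj {Y} {f} {g} E comm onto sc y z with x , refl ← onto y with w , refl ← onto z with m , e ← sc x w =
    m , trans (sym (power m)) (cong E e)
    where
    module Y = Endo Y
    power : ∀ m → E ((f ^ₑ m) x) ≡ (g Y.^ m) (E x)
    power zero    = refl
    power (suc m) = trans (comm _) (cong g (power m))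

  -- Some power of f undoes f at x, and hence along the whole orbit of x, which contains y.
  single⇒injective : {f : X → X} → SingleCycle f → ∀ {x y} → f x ≡ f y → x ≡ y
  single⇒injective {f} sc {x} {y} e with m , period ← sc (f x) x with j , refl ← sc x y =
    trans (sym period) (trans (cong (f ^ₑ m) e) (along j))
    where
    along : ∀ j → (f ^ₑ m) (f ((f ^ₑ j) x)) ≡ (f ^ₑ j) x
    along zero    = period
    along (suc j) = trans (^ₑ-comm f m _) (cong f (along j))

  SingleCycle-cong : {f g : X → X} → f ≗ g → SingleCycle f → SingleCycle g
  SingleCycle-cong e = SingleCycle-conj id e λ y → y , refl

  orbit-unique : {Y : Set} {f : X → X} {g : Y → Y} {a b : X → Y} → SingleCycle f → (∀ x → a (f x) ≡ g (a x)) →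
                 (∀ x → b (f x) ≡ g (b x)) → ∀ x → a x ≡ b x → a ≗ b
  orbit-unique {Y} {f} {g} {a} {b} sc ea eb x e y with m , refl ← sc x y = go m
    where
    go : ∀ m → a ((f ^ₑ m) x) ≡ b ((f ^ₑ m) x)
    go zero    = e
    go (suc m) = trans (ea _) (trans (cong g (go m)) (sym (eb _)))

module LongCycle (n′ : ℕ) where
  private
    n : ℕ
    n = suc n′
  open Cyclic n′ using (⊕-0; ⊕-+; ⊕-k; offset; toℕ-⊕)
  open Endo (Fin n) using () renaming (_^_ to _^ₑ_)

  longCycle-⊕ : ∀ (i : Fin n) → longCycle i ≡ i ⊕ 1
  longCycle-⊕ i = cong (_mod n) (ℕ.+-comm 1 (toℕ i))

  longCycle-single : SingleCycle (longCycle {n})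
  longCycle-single x y with i , _ , e ← offset x y = i , trans (power i) e
    where
    power : ∀ m → (longCycle ^ₑ m) x ≡ x ⊕ m
    power zero    = sym (⊕-0 x)
    power (suc m) = trans (cong longCycle (power m)) (trans (longCycle-⊕ (x ⊕ m))
      (trans (⊕-+ x m 1) (cong (x ⊕_) (ℕ.+-comm m 1))))

  private module Points = Enumerated Fin._≟_ (allFin n) (Unique.allFin⁺ n) ∈.∈-allFin

  tabulate-iterate : ∀ {X : Set} (c : X → X) x {m} (f : Fin m → X) → tabulate f ≡ iterate c x m →
                     ∀ j → f j ≡ Endo._^_ X c (toℕ j) x
  tabulate-iterate c x f e zero    = List.∷-injectiveˡ e
  tabulate-iterate c x f e (suc j) =
    trans (tabulate-iterate c (c x) (f ∘ suc) (List.∷-injectiveʳ e) j) (^ₑ-comm c (toℕ j) x)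

  opaque
    -- Numbers the cycle from x, with θ j as the j-th iterate. At the last index the numbering
    -- closes up because n steps around the cycle are the identity.
    labelling : ∀ (c : Fin n → Fin n) → SingleCycle c → ∀ x →
                Σ (Permutation′ n) λ θ → θ ⟨$⟩ʳ zero ≡ x × ∀ j → θ ⟨$⟩ʳ longCycle j ≡ c (θ ⟨$⟩ʳ j)
    labelling c sc x with θ , e ← ↭-allFin⇒permutation (Points.cycle-complete sc x) =
      θ , power zero , λ j → turn-over j (ℕ.m≤n⇒m<n∨m≡n (Fin.toℕ<n j))
      where
      size≡ : Points.size ≡ n
      size≡ = List.length-tabulate {n = n} id
      power : ∀ j → θ ⟨$⟩ʳ j ≡ (c ^ₑ toℕ j) x
      power = tabulate-iterate c x (θ ⟨$⟩ʳ_) (trans e (cong (iterate c x) size≡))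
      toℕ-longCycle : ∀ (j : Fin n) → toℕ (longCycle j) ≡ suc (toℕ j) % n
      toℕ-longCycle j = Fin.toℕ-fromℕ< (ℕ.m%n<n (suc (toℕ j)) n)
      turn-over : ∀ (j : Fin n) → suc (toℕ j) < n ⊎ suc (toℕ j) ≡ n → θ ⟨$⟩ʳ longCycle j ≡ c (θ ⟨$⟩ʳ j)
      turn-over j (inj₁ j<n) = trans (power (longCycle j)) (trans
        (cong (λ m → (c ^ₑ m) x) (trans (toℕ-longCycle j) (ℕ.m<n⇒m%n≡m j<n))) (cong c (sym (power j))))
      turn-over j (inj₂ j≡n) = trans (power (longCycle j)) (trans
        (cong (λ m → (c ^ₑ m) x) (trans (toℕ-longCycle j) (trans (cong (_% n) j≡n) (ℕ.n%n≡0 n))))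
        (trans (sym (subst (λ m → (c ^ₑ m) x ≡ x) (trans size≡ (sym j≡n)) (Points.cycle-closes sc x))) (cong c (sym (power j)))))

module Rotations (k′ n′ : ℕ) where
  private
    k n : ℕ
    k = suc k′
    n = suc n′
    St : Set
    St = Fin k × Fin n
  open Cyclic k′
  open Endo (Fin k × Fin n) using () renaming (_^_ to _^ₑ_)
  open Endo (Fin n) using () renaming (_^_ to _^ₚ_)

  -- From the vertex of type t of h to the one of type t-1, and on to the next hyperedge around it.
  -- From type `zero`, k steps apply the last rotation first and amount to `compose ρ`.
  walkOn : Vector (Permutation′ n) k → St → St
  walkOn ρ (t , h) = predecessor t , ρ (predecessor t) ⟨$⟩ʳ h

  module _ (ρ : Vector (Permutation′ n) k) where
    private
      N : St → St
      N = walkOn ρ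

      O : Fin k
      O = zero

      at : ℕ → Fin k
      at j = O ⊕ j

      at-toℕ : ∀ t → at (toℕ t) ≡ t
      at-toℕ t = Fin.toℕ-injective (trans (toℕ-⊕ O (toℕ t)) (ℕ.m<n⇒m%n≡m (Fin.toℕ<n t)))

      r : ℕ → Fin n → Fin n
      r j = ρ (at j) ⟨$⟩ʳ_

      N-at : ∀ j h → N (at (suc j) , h) ≡ (at j , r j h)
      N-at j h = cong (λ t → t , ρ t ⟨$⟩ʳ h) (predecessor-⊕ O j)

      between : ℕ → ℕ → Fin n → Fin n
      between zero    j h = h
      between (suc i) j h = between i j (r (j + i) h)

      N-between : ∀ i j h → (N ^ₑ i) (at (j + i) , h) ≡ (at j , between i j h)
      N-between zero    j h = cong (λ x → at x , h) (ℕ.+-identityʳ j)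
      N-between (suc i) j h = trans (sym (^ₑ-comm N i _)) (trans (cong (N ^ₑ i)
        (trans (cong (λ x → N (at x , h)) (ℕ.+-suc j i)) (N-at (j + i) h))) (N-between i j (r (j + i) h)))

      compose-between : ∀ m j (π : Vector (Permutation′ n) m) → (∀ t h → π t ⟨$⟩ʳ h ≡ r (j + toℕ t) h) →
                        ∀ h → compose π h ≡ between m j h
      compose-between zero    j π e h = refl
      compose-between (suc m) j π e h = trans (e zero _) (trans (cong (λ x → r x _) (ℕ.+-identityʳ j))
        (trans (cong (r j) (compose-between m (suc j) (π ∘ suc)
          (λ t h → trans (e (suc t) h) (cong (λ x → r x h) (ℕ.+-suc j (toℕ t)))) h)) (unroll m j h)))
        where
        unroll : ∀ m j h → r j (between m (suc j) h) ≡ between (suc m) j h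
        unroll zero    j h = cong (λ x → r x h) (sym (ℕ.+-identityʳ j))
        unroll (suc m) j h = trans (unroll m j (r (suc j + m) h))
          (cong (λ x → between m j (r (j + m) (r x h))) (sym (ℕ.+-suc j m)))

      N^k : ∀ h → (N ^ₑ k) (O , h) ≡ (O , compose ρ h)
      N^k h = trans (cong (λ t → (N ^ₑ k) (t , h)) (sym (⊕-k O))) (trans (N-between k 0 h)
        (cong₂ _,_ (⊕-0 O) (sym (compose-between k 0 ρ (λ t h → cong (λ u → ρ u ⟨$⟩ʳ h) (sym (at-toℕ t))) h))))

      N^qk : ∀ q h → (N ^ₑ (q * k)) (O , h) ≡ (O , (compose ρ ^ₚ q) h)
      N^qk zero    h = refl
      N^qk (suc q) h = trans (^ₑ-+ N k (q * k) _) (trans (cong (N ^ₑ k) (N^qk q h)) (N^k _))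

      back : ∀ i j h → ∃ λ g → (N ^ₑ i) (at (j + i) , g) ≡ (at j , h)
      back zero    j h = h , cong (λ x → at x , h) (ℕ.+-identityʳ j)
      back (suc i) j h with g , e ← back i j h = ρ (at (j + i)) ⟨$⟩ˡ g ,
        trans (sym (^ₑ-comm N i _)) (trans (cong (N ^ₑ i) (trans (cong (λ x → N (at x , ρ (at (j + i)) ⟨$⟩ˡ g)) (ℕ.+-suc j i))
          (trans (N-at (j + i) _) (cong (at (j + i) ,_) (inverseʳ (ρ (at (j + i)))))))) e)

    -- Go down from t to type `zero`, make q full rounds, and use a part of another round to reach
    -- u. The hyperedge g′ at which the rounds aim is found by going back from (u , g).
    compose⇒walkOn : SingleCycle (compose ρ) → SingleCycle N
    compose⇒walkOn sc (t , h) (u , g) =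
      let g′ , e = back (k ∸ toℕ u) (toℕ u) g
          q , e′ = sc (between (toℕ t) 0 h) g′
      in (k ∸ toℕ u) + (q * k + toℕ t) , (begin
        (N ^ₑ ((k ∸ toℕ u) + (q * k + toℕ t))) (t , h)        ≡⟨ ^ₑ-+ N (k ∸ toℕ u) _ _ ⟩
        (N ^ₑ (k ∸ toℕ u)) ((N ^ₑ (q * k + toℕ t)) (t , h))   ≡⟨ cong (N ^ₑ (k ∸ toℕ u)) (^ₑ-+ N (q * k) (toℕ t) _) ⟩
        (N ^ₑ (k ∸ toℕ u)) ((N ^ₑ (q * k)) ((N ^ₑ toℕ t) (t , h)))
          ≡⟨ cong (λ x → (N ^ₑ (k ∸ toℕ u)) ((N ^ₑ (q * k)) x)) (trans (cong (λ x → (N ^ₑ toℕ t) (x , h)) (sym (at-toℕ t)))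
               (trans (N-between (toℕ t) 0 h) (cong (_, between (toℕ t) 0 h) (⊕-0 O)))) ⟩
        (N ^ₑ (k ∸ toℕ u)) ((N ^ₑ (q * k)) (O , between (toℕ t) 0 h))  ≡⟨ cong (N ^ₑ (k ∸ toℕ u)) (trans (N^qk q _) (cong (O ,_) e′)) ⟩
        (N ^ₑ (k ∸ toℕ u)) (O , g′)
          ≡⟨ cong (λ x → (N ^ₑ (k ∸ toℕ u)) (x , g′)) (trans (sym (⊕-k O)) (cong at (sym (ℕ.m+[n∸m]≡n (ℕ.<⇒≤ (Fin.toℕ<n u)))))) ⟩
        (N ^ₑ (k ∸ toℕ u)) (at (toℕ u + (k ∸ toℕ u)) , g′)    ≡⟨ e ⟩
        (at (toℕ u) , g)                                      ≡⟨ cong (_, g) (at-toℕ u) ⟩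
        (u , g)                                               ∎)
      where open ≡-Reasoning

    -- Types recur only after multiples of k steps, so that a walk between two states of type `zero`
    -- consists of full rounds.
    walkOn⇒compose : SingleCycle N → SingleCycle (compose ρ)
    walkOn⇒compose sc h g with m , e ← sc (O , h) (O , g) = m / k , cong proj₂ (trans (sym (N^qk (m / k) h)) at-end)
      where
      split : (N ^ₑ (m % k)) (O , (compose ρ ^ₚ (m / k)) h) ≡ (O , g)
      split = trans (cong (N ^ₑ (m % k)) (sym (N^qk (m / k) h)))
        (trans (sym (^ₑ-+ N (m % k) (m / k * k) _)) (trans (cong (λ x → (N ^ₑ x) (O , h)) (sym (ℕ.m≡m%n+[m/n]*n m k))) e))
      no-rest : ∀ s {x} → s < k → (N ^ₑ s) (O , x) ≡ (O , g) → s ≡ 0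
      no-rest zero    _   _ = refl
      no-rest (suc s) {x} s<k e = contradiction
        (trans (sym (trans (toℕ-⊕ O (k ∸ suc s)) (ℕ.m<n⇒m%n≡m (ℕ.∸-monoʳ-< {k} z<s (ℕ.<⇒≤ s<k)))))
          (cong (toℕ ∘ proj₁) (trans (sym (N-between (suc s) (k ∸ suc s) x)) (trans (cong (λ t → (N ^ₑ suc s) (t , x))
            (trans (cong at (ℕ.m∸n+n≡m (ℕ.<⇒≤ s<k))) (⊕-k O))) e))))
        (ℕ.>⇒≢ (ℕ.m<n⇒0<n∸m s<k))
      at-end : (N ^ₑ (m / k * k)) (O , h) ≡ (O , g)
      at-end = trans (N^qk (m / k) h) (trans (cong (λ s → (N ^ₑ s) (O , (compose ρ ^ₚ (m / k)) h))
        (sym (no-rest (m % k) (ℕ.m%n<n m k) split))) split)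

IsColoring⇒invariant : ∀ {n p} {π : Permutation′ n} {φ : Fin n → Fin p} → IsColoring π φ → ∀ i → φ (π ⟨$⟩ʳ i) ≡ φ i
IsColoring⇒invariant (c , _) i = sym (c i _ (1 , refl))

invariant⇒IsColoring : ∀ {n p} {π : Permutation′ n} {φ : Fin n → Fin p} → (∀ i → φ (π ⟨$⟩ʳ i) ≡ φ i) →
                       (∀ c → ∃ λ i → φ i ≡ c) → IsColoring π φ
invariant⇒IsColoring {n} {π = π} {φ} inv onto =
  (λ { i j (m , refl) → sym (go m i) }) , λ c → let i , e = onto c in i , λ { refl → e }
  where
  go : ∀ m i → φ (Endo._^_ (Fin n) (π ⟨$⟩ʳ_) m i) ≡ φ i
  go zero    i = refl
  go (suc m) i = trans (inv _) (go m i)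

IsColoring⇒surjective : ∀ {n p} {π : Permutation′ n} {φ : Fin n → Fin p} → IsColoring π φ → ∀ c → ∃ λ i → φ i ≡ c
IsColoring⇒surjective (_ , s) c = let i , e = s c in i , e refl

perm-injective : ∀ {n} (π : Permutation′ n) {i j} → π ⟨$⟩ʳ i ≡ π ⟨$⟩ʳ j → i ≡ j
perm-injective π e = trans (sym (inverseˡ π)) (trans (cong (π ⟨$⟩ˡ_) e) (inverseˡ π))

-- Since ⨾ₚ composes from left to right, these are θ⁻¹ ρ θ and θ ρ θ⁻¹.
conj conj⁻¹ : ∀ {n} → Permutation′ n → Permutation′ n → Permutation′ n
conj θ ρ   = (θ ⨾ₚ ρ) ⨾ₚ flipₚ θ
conj⁻¹ θ ρ = (flipₚ θ ⨾ₚ ρ) ⨾ₚ θ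

conj-intertwines : ∀ {n} (θ ρ : Permutation′ n) j → θ ⟨$⟩ʳ (conj θ ρ ⟨$⟩ʳ j) ≡ ρ ⟨$⟩ʳ (θ ⟨$⟩ʳ j)
conj-intertwines θ ρ j = inverseʳ θ

conj⁻¹-intertwines : ∀ {n} (θ ρ : Permutation′ n) j → θ ⟨$⟩ʳ (ρ ⟨$⟩ʳ j) ≡ conj⁻¹ θ ρ ⟨$⟩ʳ (θ ⟨$⟩ʳ j)
conj⁻¹-intertwines θ ρ j = cong (λ i → θ ⟨$⟩ʳ (ρ ⟨$⟩ʳ i)) (sym (inverseˡ θ))

-- Factorizations as rooted cacti

module Factorizations (k′ n′ : ℕ) where
  private
    k n : ℕ
    k = suc k′
    n = suc n′
  open Cyclic k′ using (successor-predecessor; predecessor-successor)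
  open LongCycle n′
  open Rotations k′ n′

  product⇒single : ∀ (ρ : Vector (Permutation′ n) k) → (∀ i → compose ρ i ≡ longCycle i) → SingleCycle (compose ρ)
  product⇒single ρ e = SingleCycle-cong (λ i → sym (e i)) longCycle-single

  -- The state (t , h) is the edge (h , t-1) of a constellation.
  edge : Fin k × Fin n → Fin n × Fin k
  edge (t , h) = h , predecessor t

  unedge : Fin n × Fin k → Fin k × Fin n
  unedge (h , t) = t ⊕ 1 , h

  module _ {q : Vector ℕ k} where

    rotate-connected : (ρ : Vector (Permutation′ n) k) → SingleCycle (compose ρ) → ∀ h h′ →
                       EqClosure (λ h h′ → ∃[ t ] ρ t ⟨$⟩ʳ h ≡ h′) h h′
    rotate-connected ρ sc h h′ with m , refl ← sc h h′ = orbit m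
      where
      Incident : Fin n → Fin n → Set
      Incident h h′ = ∃[ t ] ρ t ⟨$⟩ʳ h ≡ h′
      composed : ∀ {m} (π : Vector (Permutation′ n) m) → (∀ t g → Incident g (π t ⟨$⟩ʳ g)) → ∀ g →
                 EqClosure Incident g (compose π g)
      composed {zero}  π i g = EqC.reflexive Incident
      composed {suc m} π i g = EqC.transitive Incident (composed (π ∘ suc) (i ∘ suc) g) (EqC.return (i zero _))
      orbit : ∀ m → EqClosure Incident h (Endo._^_ (Fin n) (compose ρ) m h)
      orbit zero    = EqC.reflexive Incident
      orbit (suc m) = EqC.transitive Incident (orbit m) (composed ρ (λ t g → t , refl) _)

    toCactus : ColoredFactorization {k} n q → ColoredRootedCactus n q
    toCactus F = record
      { constellation = record { rotation = π ; connected = rotate-connected π (product⇒single π product) }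
      ; oneWhiteFace = SingleCycle-conj edge (λ _ → refl)
          (λ (h , t) → unedge (h , t) , cong (h ,_) (predecessor-successor t))
          (compose⇒walkOn π (product⇒single π product))
      ; root = zero ; color = φ ; colored = colored }
      where open ColoredFactorization F

    private
      module CF = ColoredFactorization
      module CRC = ColoredRootedCactus

    compose-single : (C : ColoredRootedCactus n q) → SingleCycle (compose (CRC.rotation C))
    compose-single C = walkOn⇒compose (CRC.rotation C) (SingleCycle-conj unedge
      (λ (h , t) → cong₂ (λ u v → u , CRC.rotation C v ⟨$⟩ʳ h)
        (trans (successor-predecessor t) (sym (predecessor-successor t))) (sym (predecessor-successor t)))
      (λ (t , h) → edge (t , h) , cong (_, h) (successor-predecessor t)) (CRC.oneWhiteFace C))

    conjugate : (ρ : Vector (Permutation′ n) k) (color : ∀ t → Fin n → Fin (q t)) → (∀ t → IsColoring (ρ t) (color t)) →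
                (θ : Permutation′ n) → (∀ j → θ ⟨$⟩ʳ longCycle j ≡ compose ρ (θ ⟨$⟩ʳ j)) → ColoredFactorization {k} n q
    conjugate ρ color colored θ turns = record
      { π = λ t → conj θ (ρ t)
      ; φ = λ t j → color t (θ ⟨$⟩ʳ j)
      ; product = λ i → perm-injective θ (trans
          (compose-conj (θ ⟨$⟩ʳ_) ρ (λ t → conj θ (ρ t)) (λ t → conj-intertwines θ (ρ t)) i) (sym (turns i)))
      ; colored = λ t → invariant⇒IsColoring {π = conj θ (ρ t)}
          (λ i → trans (cong (color t) (conj-intertwines θ (ρ t) i)) (IsColoring⇒invariant {π = ρ t} (colored t) _))
          λ c → let i , e = IsColoring⇒surjective {π = ρ t} (colored t) c in θ ⟨$⟩ˡ i , trans (cong (color t) (inverseʳ θ)) e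
      }

    -- The hyperedges of a rooted cactus can be labelled from the root along `compose`. An
    -- isomorphism between two cacti with such labels fixes `zero` and commutes with the long cycle,
    -- hence is the identity.
    ColoredFactorizations≃𝓒 : ColoredFactorizations {k} n q ≃ 𝓒 n q
    ColoredFactorizations≃𝓒 = bijective⇒≃ {ColoredFactorizations {k} n q} {𝓒 n q} toCactus
      (λ (π≈ , φ≈) → record { relabel = idₚ ; rotation≅ = π≈ ; root≅ = refl ; color≅ = φ≈ })
      (λ {F} {G} → reflects F G)
      λ C → let θ , θ0 , turns = labelling (compose (CRC.rotation C)) (compose-single C) (CRC.root C) in
        conjugate (CRC.rotation C) (CRC.color C) (CRC.colored C) θ turns
        , record { relabel = θ ; rotation≅ = λ t → conj-intertwines θ (CRC.rotation C t) ; root≅ = θ0 ; color≅ = λ _ _ → refl }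
      where
      reflects : ∀ F G → toCactus F ≅ toCactus G → Setoid._≈_ (ColoredFactorizations {k} n q) F G
      reflects F G iso = (λ t h → trans (sym (fixed _)) (trans (rotation≅ t h) (cong (CF.π G t ⟨$⟩ʳ_) (fixed h))))
          , λ t h → trans (color≅ t h) (cong (CF.φ G t) (fixed h))
        where
        open _≅_ iso
        fixed : ∀ h → relabel ⟨$⟩ʳ h ≡ h
        fixed = orbit-unique longCycle-single
          (λ h → trans (cong (relabel ⟨$⟩ʳ_) (sym (CF.product F h)))
            (trans (compose-conj (relabel ⟨$⟩ʳ_) (CF.π G) (CF.π F) rotation≅ h) (CF.product G _)))
          (λ _ → refl) zero root≅

-- The colours of C^n_{p+e_t₀}, where the additional colour of type t₀ is
-- taken to be the root.
rooted : ∀ {k} (p : Vector ℕ k) t₀ t → Fin (updateAt p t₀ suc t) → Maybe (Fin (p t))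
rooted {suc k} p zero     zero    zero    = nothing
rooted {suc k} p zero     zero    (suc c) = just c
rooted {suc k} p zero     (suc t) c       = just c
rooted {suc k} p (suc t₀) zero    c       = just c
rooted {suc k} p (suc t₀) (suc t) c       = rooted (p ∘ suc) t₀ t c

rooted-injective : ∀ {k} (p : Vector ℕ k) t₀ t {c d} → rooted p t₀ t c ≡ rooted p t₀ t d → c ≡ d
rooted-injective {suc k} p zero     zero    {zero}  {zero}  e = refl
rooted-injective {suc k} p zero     zero    {suc c} {suc d} e = cong suc (Maybe.just-injective e)
rooted-injective {suc k} p zero     (suc t) e = Maybe.just-injective e
rooted-injective {suc k} p (suc t₀) zero    e = Maybe.just-injective e
rooted-injective {suc k} p (suc t₀) (suc t) e = rooted-injective (p ∘ suc) t₀ t e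

rooted-just : ∀ {k} (p : Vector ℕ k) t₀ t c → ∃ λ d → rooted p t₀ t d ≡ just c
rooted-just {suc k} p zero     zero    c = suc c , refl
rooted-just {suc k} p zero     (suc t) c = c , refl
rooted-just {suc k} p (suc t₀) zero    c = c , refl
rooted-just {suc k} p (suc t₀) (suc t) c = rooted-just (p ∘ suc) t₀ t c

rooted-nothing⁺ : ∀ {k} (p : Vector ℕ k) t → ∃ λ d → rooted p t t d ≡ nothing
rooted-nothing⁺ {suc k} p zero    = zero , refl
rooted-nothing⁺ {suc k} p (suc t) = rooted-nothing⁺ (p ∘ suc) t

rooted-nothing⁻ : ∀ {k} (p : Vector ℕ k) t₀ t d → rooted p t₀ t d ≡ nothing → t ≡ t₀
rooted-nothing⁻ {suc k} p zero     zero    zero e = refl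
rooted-nothing⁻ {suc k} p (suc t₀) (suc t) d    e = cong suc (rooted-nothing⁻ (p ∘ suc) t₀ t d e)

rooted-surjective : ∀ {k} (p : Vector ℕ k) t₀ t (c : Maybe (Fin (p t))) → (c ≡ nothing → t ≡ t₀) → ∃ λ d → rooted p t₀ t d ≡ c
rooted-surjective p t₀ t (just c) _ = rooted-just p t₀ t c
rooted-surjective p t₀ t nothing  h with refl ← h refl = rooted-nothing⁺ p t

module CactusFactorizations (k′ n′ : ℕ) (p : Vector ℕ (suc k′)) where
  private
    k n : ℕ
    k = suc k′
    n = suc n′
  open Cyclic k′ using (predecessor-successor; successor-predecessor)
  open ValidBiddingTours k′ n′ p using (CactusTour; CactusTours; St; V-colour; source; module CactusTour)
  open Rotations k′ n′
  open LongCycle n′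
  open Factorizations k′ n′

  Pieces : Setoid 0ℓ 0ℓ
  Pieces = ⨆ (λ t → ColoredFactorizations {k} n (updateAt p t suc))

  -- Factorizations label the hyperedges in the order of the white face, cactus tours arbitrarily.
  -- Conjugation by θ introduces arbitrary labels, and the image of `zero` under θ becomes the root.
  LabelledFactorizations : Setoid 0ℓ 0ℓ
  LabelledFactorizations = ×-setoid (Permutations n) Pieces

  private
    module CF = ColoredFactorization
    module CT = CactusTour

  module FromFactorization (θ : Permutation′ n) (t₀ : Fin k) (F : ColoredFactorization {k} n (updateAt p t₀ suc)) where
    open ColoredFactorization F using (π; product; colored) renaming (φ to color)

    ρ : Vector (Permutation′ n) k
    ρ t = conj⁻¹ θ (π t)

    φ : ∀ t → Fin n → Maybe (Fin (p t))
    φ t h = rooted p t₀ t (color t (θ ⟨$⟩ˡ h))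

    compose-ρ : ∀ j → θ ⟨$⟩ʳ longCycle j ≡ compose ρ (θ ⟨$⟩ʳ j)
    compose-ρ j = trans (cong (θ ⟨$⟩ʳ_) (sym (product j))) (compose-conj (θ ⟨$⟩ʳ_) ρ π (λ t → conj⁻¹-intertwines θ (π t)) j)

    φ-attained : ∀ t c → ∃ λ h → φ t h ≡ rooted p t₀ t c
    φ-attained t c = let i , e = IsColoring⇒surjective {π = π t} (colored t) c
                     in θ ⟨$⟩ʳ i , cong (rooted p t₀ t) (trans (cong (color t) (inverseˡ θ)) e)

    tour : CactusTour
    tour = record
      { φ = φ ; t₀ = t₀
      ; at-root = λ {t} {h} e → rooted-nothing⁻ p t₀ t _ e
      ; root-∃ = let d , e = rooted-nothing⁺ p t₀ ; h , e′ = φ-attained t₀ d in h , trans e′ e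
      ; attained = λ t c → let d , e = rooted-just p t₀ t c ; h , e′ = φ-attained t d in h , trans e′ e
      ; σ = walkOn ρ
      ; single = compose⇒walkOn ρ (SingleCycle-conj (θ ⟨$⟩ʳ_) compose-ρ (λ h → θ ⟨$⟩ˡ h , inverseʳ θ) longCycle-single)
      ; matched = λ (t , h) → cong (λ c → predecessor t , rooted p t₀ (predecessor t) c)
          (trans (cong (color (predecessor t)) (inverseˡ θ))
            (IsColoring⇒invariant {π = π (predecessor t)} (colored (predecessor t)) _))
      }

  to : Setoid.Carrier LabelledFactorizations → CactusTour × Fin n
  to (θ , (t₀ , F)) = FromFactorization.tour θ t₀ F , θ ⟨$⟩ʳ zero

  Target : Setoid 0ℓ 0ℓ
  Target = ×-setoid CactusTours (≡-setoid (Fin n))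

  to-cong : ∀ {x y} → Setoid._≈_ LabelledFactorizations x y → Setoid._≈_ Target (to x) (to y)
  to-cong {θ , (t₀ , F)} {θ′ , (_ , G)} (θ≈ , same (π≈ , φ≈)) =
    ((λ t h → cong (rooted p t₀ t) (trans (φ≈ t _) (cong (CF.φ G t) (θ⁻¹≈ h))))
    , λ (t , h) → cong (predecessor t ,_) (trans (θ≈ _) (cong (θ′ ⟨$⟩ʳ_)
        (trans (π≈ (predecessor t) _) (cong (CF.π G (predecessor t) ⟨$⟩ʳ_) (θ⁻¹≈ h))))))
    , θ≈ zero
    where
    θ⁻¹≈ : ∀ h → θ ⟨$⟩ˡ h ≡ θ′ ⟨$⟩ˡ h
    θ⁻¹≈ h = trans (sym (inverseˡ θ′)) (cong (θ′ ⟨$⟩ˡ_) (trans (sym (θ≈ _)) (inverseʳ θ)))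

  same-type : ∀ {θ θ′ t₀ t₁ F G} → Setoid._≈_ Target (to (θ , (t₀ , F))) (to (θ′ , (t₁ , G))) → t₀ ≡ t₁
  same-type {θ} {θ′} {t₀} {t₁} {F} {G} ((φ≈ , _) , _) =
    let h , e = CT.root-∃ (FromFactorization.tour θ t₀ F)
    in CT.at-root (FromFactorization.tour θ′ t₁ G) (trans (sym (φ≈ t₀ h)) e)

  to-injective-at : ∀ {θ θ′ t₀ F G} → Setoid._≈_ Target (to (θ , (t₀ , F))) (to (θ′ , (t₀ , G))) →
                    Setoid._≈_ LabelledFactorizations (θ , (t₀ , F)) (θ′ , (t₀ , G))
  to-injective-at {θ} {θ′} {t₀} {F} {G} ((φ≈ , σ≈) , root≈) = θ≈ , same (π≈ , colours≈)
    where
    module F = FromFactorization θ t₀ F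
    module G = FromFactorization θ′ t₀ G
    ρ≈ : ∀ t h → F.ρ t ⟨$⟩ʳ h ≡ G.ρ t ⟨$⟩ʳ h
    ρ≈ t h = subst (λ u → F.ρ u ⟨$⟩ʳ h ≡ G.ρ u ⟨$⟩ʳ h) (predecessor-successor t) (cong proj₂ (σ≈ (t ⊕ 1 , h)))
    θ≈ : ∀ j → θ ⟨$⟩ʳ j ≡ θ′ ⟨$⟩ʳ j
    θ≈ = orbit-unique {g = compose F.ρ} longCycle-single F.compose-ρ
      (λ j → trans (G.compose-ρ j) (sym (compose-conj id G.ρ F.ρ ρ≈ (θ′ ⟨$⟩ʳ j)))) zero root≈
    π≈ : ∀ t j → CF.π F t ⟨$⟩ʳ j ≡ CF.π G t ⟨$⟩ʳ j
    π≈ t j = perm-injective θ (trans (conj⁻¹-intertwines θ (CF.π F t) j) (trans (ρ≈ t _)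
      (trans (cong (G.ρ t ⟨$⟩ʳ_) (θ≈ j)) (trans (sym (conj⁻¹-intertwines θ′ (CF.π G t) j)) (sym (θ≈ _))))))
    colours≈ : ∀ t j → CF.φ F t j ≡ CF.φ G t j
    colours≈ t j = rooted-injective p t₀ t (trans (cong (λ i → rooted p t₀ t (CF.φ F t i)) (sym (inverseˡ θ)))
      (trans (φ≈ t (θ ⟨$⟩ʳ j)) (cong (λ i → rooted p t₀ t (CF.φ G t i)) (trans (cong (θ′ ⟨$⟩ˡ_) (θ≈ j)) (inverseˡ θ′)))))

  to-injective : ∀ {x y} → Setoid._≈_ Target (to x) (to y) → Setoid._≈_ LabelledFactorizations x y
  to-injective {θ , (t₀ , F)} {θ′ , (t₁ , G)} e = go (same-type {θ} {θ′} {t₀} {t₁} {F} {G} e) G e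
    where
    go : ∀ {t₁} → t₀ ≡ t₁ → (G : ColoredFactorization {k} n (updateAt p t₁ suc)) →
         Setoid._≈_ Target (to (θ , (t₀ , F))) (to (θ′ , (t₁ , G))) →
         Setoid._≈_ LabelledFactorizations (θ , (t₀ , F)) (θ′ , (t₁ , G))
    go refl G e = to-injective-at {θ} {θ′} {t₀} {F} {G} e

  module ToFactorization (C : CactusTour) (h₀ : Fin n) where
    open CactusTour C

    arrive : ∀ t h → Fin n
    arrive t h = proj₂ (σ (t ⊕ 1 , h))

    σ-type : ∀ x → proj₁ (σ x) ≡ predecessor (proj₁ x)
    σ-type x = cong proj₁ (matched x)

    opaque
      turnsAt : ∀ t → Σ (Permutation′ n) λ π → ∀ h → π ⟨$⟩ʳ h ≡ arrive t h
      turnsAt t = Fin-injective⇒permutation (arrive t) λ {g} {h} e → cong proj₂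
        (single⇒injective single (cong₂ _,_ (trans (σ-type (t ⊕ 1 , g)) (sym (σ-type (t ⊕ 1 , h)))) e))

    ρ : Vector (Permutation′ n) k
    ρ t = proj₁ (turnsAt t)

    σ≗ : ∀ x → walkOn ρ x ≡ σ x
    σ≗ (t , h) = cong₂ _,_ (sym (σ-type (t , h)))
      (trans (proj₂ (turnsAt (predecessor t)) h) (cong (λ u → proj₂ (σ (u , h))) (successor-predecessor t)))

    found : Σ (Permutation′ n) λ θ → θ ⟨$⟩ʳ zero ≡ h₀ × ∀ j → θ ⟨$⟩ʳ longCycle j ≡ compose ρ (θ ⟨$⟩ʳ j)
    found = labelling (compose ρ) (walkOn⇒compose ρ (SingleCycle-cong (λ x → sym (σ≗ x)) single)) h₀

    colour : ∀ t h → ∃ λ c → rooted p t₀ t c ≡ φ t h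
    colour t h = rooted-surjective p t₀ t (φ t h) at-root

    φ-invariant : ∀ t h → φ t (ρ t ⟨$⟩ʳ h) ≡ φ t h
    φ-invariant t h = V-colour (subst (λ u → (u , φ u (ρ u ⟨$⟩ʳ h)) ≡ (u , φ u h)) (predecessor-successor t)
      (trans (cong (source φ) (σ≗ (t ⊕ 1 , h))) (matched (t ⊕ 1 , h))))

    factorization : ColoredFactorization {k} n (updateAt p t₀ suc)
    factorization = conjugate ρ (λ t h → proj₁ (colour t h))
      (λ t → invariant⇒IsColoring {π = ρ t}
        (λ i → rooted-injective p t₀ t (trans (proj₂ (colour t _)) (trans (φ-invariant t i) (sym (proj₂ (colour t i))))))
        (λ c → let h , e = hit t (rooted p t₀ t c) (λ e → rooted-nothing⁻ p t₀ t c e)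
               in h , rooted-injective p t₀ t (trans (proj₂ (colour t h)) e)))
      (proj₁ found) (proj₂ (proj₂ found))
      where
      hit : ∀ t c → (c ≡ nothing → t ≡ t₀) → ∃ λ h → φ t h ≡ c
      hit t (just c) _ = attained t c
      hit t nothing  r with refl ← r refl = root-∃

    to≈ : Setoid._≈_ Target (to (proj₁ found , (t₀ , factorization))) (C , h₀)
    to≈ = ((λ t h → trans (proj₂ (colour t _)) (cong (φ t) (inverseʳ θ)))
          , λ (t , h) → trans (cong (predecessor t ,_) (trans (conj-intertwines θ (ρ (predecessor t)) _)
              (cong (ρ (predecessor t) ⟨$⟩ʳ_) (inverseʳ θ)))) (σ≗ (t , h)))
        , proj₁ (proj₂ found)
      where
      θ : Permutation′ n
      θ = proj₁ found

  LabelledFactorizations≃CactusTours : LabelledFactorizations ≃ Target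
  LabelledFactorizations≃CactusTours = bijective⇒≃ {LabelledFactorizations} {Target} to
    (λ {x} {y} → to-cong {x} {y}) (λ {x} {y} → to-injective {x} {y})
    λ (C , h₀) → (proj₁ (ToFactorization.found C h₀) , (CT.t₀ C , ToFactorization.factorization C h₀)) , ToFactorization.to≈ C h₀

-- Finiteness and counting

⨆-cong : ∀ {k} {S T : Fin k → Setoid 0ℓ 0ℓ} → (∀ t → S t ≃ T t) → ⨆ S ≃ ⨆ T
⨆-cong {S = S} {T} i = record
  { to        = λ (t , x) → t , Inverse.to (i t) x
  ; from      = λ (t , x) → t , Inverse.from (i t) x
  ; to-cong   = λ { (same {t} e) → same (Inverse.to-cong (i t) e) }
  ; from-cong = λ { (same {t} e) → same (Inverse.from-cong (i t) e) }
  ; inverse   = (λ { (same {t} e) → same (Inverse.inverseˡ (i t) e) })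
              , (λ { (same {t} e) → same (Inverse.inverseʳ (i t) e) })
  }

-- S is the slice of the product over u₀, and membership in this slice is decided by comparing
-- indices in `Fin b`.
Finite-factor : ∀ {S U b} → Finite (×-setoid S U) → U HasSize b → Setoid.Carrier U → Finite S
Finite-factor {S} {U} fin i u₀ =
  let N , j = Finite-Sub {×-setoid S U} fin
        (λ (_ , e) f → trans (Inverse.to-cong i (Setoid.sym U e)) f)
        (λ (_ , u) → Inverse.to i u Fin.≟ Inverse.to i u₀)
  in N , (bijective⇒≃ {S} {Sub (×-setoid S U) (λ (_ , u) → Inverse.to i u ≡ Inverse.to i u₀)}
        (λ s → (s , u₀) , refl) (λ e → e , Setoid.refl U) proj₁
        (λ ((s , u) , e) → s , Setoid.refl S , Setoid.trans U (Setoid.sym U (Inverse.strictlyInverseʳ i u₀))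
          (Setoid.trans U (Inverse.from-cong i (sym e)) (Inverse.strictlyInverseʳ i u))) ⨟ j)

empty⇒HasSize0 : ∀ {S N} → S HasSize N → ¬ Setoid.Carrier S → N ≡ 0
empty⇒HasSize0 {N = zero}  i ¬s = refl
empty⇒HasSize0 {N = suc N} i ¬s = contradiction (Inverse.from i zero) ¬s

inhabited⇒NonZero : ∀ {S N} → S HasSize N → Setoid.Carrier S → NonZero N
inhabited⇒NonZero {N = zero}  i s with () ← Inverse.to i s
inhabited⇒NonZero {N = suc N} i s = _

Finite-Subset : ∀ k → Finite (≡-setoid (Subset k))
Finite-Subset k = 2 ^ k , (bijective⇒≃ {≡-setoid (Subset k)} {≋-setoid (≡-setoid Bool) k} Vec.lookup
  (λ { refl _ → refl })
  (λ {A} {B} e → trans (sym (Vec.tabulate∘lookup A)) (trans (Vec.tabulate-cong e) (Vec.tabulate∘lookup B)))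
  (λ f → Vec.tabulate f , Vec.lookup∘tabulate f) ⨟ HasSize-^ k (≃-sym Fin.2↔Bool))

opaque
  Finite-𝓜s : ∀ {k} m (q : Vector ℕ k) → Finite (𝓜s m q)
  Finite-𝓜s {k} m q =
    let _ , i = Finite-Subset k
        N , j = Finite-Sub {≋-setoid (≡-setoid (Subset k)) m} {P} (_ , HasSize-^ m i) resp P?
    in N , (𝓜s≃ ⨟ j)
    where
    P : (Fin m → Subset k) → Set
    P R = (∀ h → ∃[ t ] t ∉ R h) × (∀ t → ∣ column R t ∣ ≡ q t)
    resp : ∀ {R R′} → (∀ h → R h ≡ R′ h) → P R → P R′
    resp e (s , m) = (λ h → let t , t∉ = s h in t , subst (t ∉_) (e h) t∉)
      , λ t → trans (cong ∣_∣ (Vec.tabulate-cong λ h → cong (λ A → Vec.lookup A t) (sym (e h)))) (m t)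
    P? : Decidable P
    P? R = Fin.all? (λ h → Fin.any? λ t → ¬? (t ∈? R h)) ×-dec Fin.all? (λ t → ∣ column R t ∣ ℕ.≟ q t)
    𝓜s≃ : 𝓜s m q ≃ Sub (≋-setoid (≡-setoid (Subset k)) m) P
    𝓜s≃ = bijective⇒≃ {𝓜s m q} {Sub (≋-setoid (≡-setoid (Subset k)) m) P}
      (λ M → 𝓜.tuple M , (λ h → let t , _ , t∉ = proj₂ (𝓜.strict M h) in t , t∉) , 𝓜.multiplicity M) id id
      λ (R , s , m) → record { tuple = R ; strict = λ h → (λ _ → ∈⊤) , proj₁ (s h) , ∈⊤ , proj₂ (s h) ; multiplicity = m }
        , λ _ → refl

𝓜s-cong : ∀ {k} m {q q′ : Vector ℕ k} → q ≗ q′ → 𝓜s m q ≃ 𝓜s m q′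
𝓜s-cong m {q} {q′} e = bijective⇒≃ {𝓜s m q} {𝓜s m q′} (transport e) id id λ M → transport (sym ∘ e) M , λ _ → refl
  where
  transport : ∀ {q q′} → q ≗ q′ → 𝓜 m q → 𝓜 m q′
  transport e M = record { tuple = 𝓜.tuple M ; strict = 𝓜.strict M ; multiplicity = λ t → trans (𝓜.multiplicity M t) (e t) }

module _ {k : ℕ} (n : ℕ) .{{_ : NonZero n}} where

  opaque
    Finite-ColoredFactorizations : (q : Vector ℕ k) → Finite (ColoredFactorizations n q)
    Finite-ColoredFactorizations q =
      let N , j = Finite-Sub {Data} {P} (let _ , a = Finite-Πₛ {k} (λ _ → Permutations n) (λ _ → _ , Permutations-size n)
                                             _ , b = Finite-Πₛ Colours (λ t → Finite-Πₛ {n} _ λ _ → _ , HasSize-Fin)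
                                         in _ , HasSize-× a b) (λ {x} {y} → resp {x} {y}) P?
      in N , (bijective⇒≃ {ColoredFactorizations n q} {Sub Data P}
          (λ F → (CF.π F , CF.φ F) , CF.product F
               , (λ t → IsColoring⇒invariant {π = CF.π F t} (CF.colored F t))
               , (λ t → IsColoring⇒surjective {π = CF.π F t} (CF.colored F t)))
          id id
          (λ ((π , φ) , product , inv , onto) → record
            { π = π ; φ = φ ; product = product ; colored = λ t → invariant⇒IsColoring {π = π t} (inv t) (onto t) }
            , (λ _ _ → refl) , λ _ _ → refl) ⨟ j)
      where
      module CF = ColoredFactorization
      Colours : Fin k → Setoid 0ℓ 0ℓ
      Colours t = Πₛ {n} λ _ → ≡-setoid (Fin (q t))
      Data : Setoid 0ℓ 0ℓ
      Data = ×-setoid (Πₛ {k} λ _ → Permutations n) (Πₛ Colours)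
      P : Setoid.Carrier Data → Set
      P (π , φ) = (∀ i → compose π i ≡ longCycle i) × (∀ t i → φ t (π t ⟨$⟩ʳ i) ≡ φ t i) × (∀ t c → ∃ λ i → φ t i ≡ c)
      resp : ∀ {x y} → Setoid._≈_ Data x y → P x → P y
      resp {π , φ} {π′ , φ′} (π≈ , φ≈) (product , inv , onto) =
        (λ i → trans (sym (compose-conj id π′ π π≈ i)) (product i))
        , (λ t i → trans (sym (φ≈ t _)) (trans (cong (φ t) (sym (π≈ t i))) (trans (inv t i) (φ≈ t i))))
        , λ t c → let i , e = onto t c in i , trans (sym (φ≈ t i)) e
      P? : Decidable P
      P? (π , φ) = Fin.all? (λ i → compose π i Fin.≟ longCycle i)
        ×-dec (Fin.all? (λ t → Fin.all? λ i → φ t (π t ⟨$⟩ʳ i) Fin.≟ φ t i)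
        ×-dec Fin.all? (λ t → Fin.all? λ c → Fin.any? λ i → φ t i Fin.≟ c))

  ColoredFactorizations-cong : ∀ {q q′ : Vector ℕ k} → q ≗ q′ → ColoredFactorizations n q ≃ ColoredFactorizations n q′
  ColoredFactorizations-cong {q} {q′} e = bijective⇒≃ {ColoredFactorizations n q} {ColoredFactorizations n q′}
    (recolour e) (λ (π≈ , φ≈) → π≈ , λ t i → cong (cast (e t)) (φ≈ t i))
    (λ (π≈ , φ≈) → π≈ , λ t i → cast-injective (e t) (φ≈ t i))
    λ F → recolour (sym ∘ e) F , (λ _ _ → refl) , λ t i → cast-cast (sym (e t)) (e t) _
    where
    cast-cast : ∀ {a b} .(e : a ≡ b) .(f : b ≡ a) c → cast f (cast e c) ≡ c
    cast-cast e f c = trans (Fin.cast-trans e f c) (Fin.cast-is-id refl c)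
    cast-injective : ∀ {a b} (e : a ≡ b) {c d : Fin a} → cast e c ≡ cast e d → c ≡ d
    cast-injective e {c} {d} eq = trans (sym (cast-cast e (sym e) c)) (trans (cong (cast (sym e)) eq) (cast-cast e (sym e) d))
    recolour : ∀ {q q′ : Vector ℕ k} → q ≗ q′ → ColoredFactorization n q → ColoredFactorization n q′
    recolour e F = record
      { π = π ; φ = λ t i → cast (e t) (φ t i) ; product = product
      ; colored = λ t → invariant⇒IsColoring {π = π t} (λ i → cong (cast (e t)) (IsColoring⇒invariant {π = π t} (colored t) i))
          λ c → let i , f = IsColoring⇒surjective {π = π t} (colored t) (cast (sym (e t)) c)
                in i , trans (cong (cast (e t)) f) (cast-cast (sym (e t)) (e t) c) }
      where open ColoredFactorization F

byLast : ∀ {X : Set} {m} → (Fin m → X) → X → Fin (suc m) → X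
byLast {m = zero}  f x zero    = x
byLast {m = suc m} f x zero    = f zero
byLast {m = suc m} f x (suc t) = byLast (f ∘ suc) x t

byLast-inject₁ : ∀ {X : Set} {m} (f : Fin m → X) x e → byLast f x (inject₁ e) ≡ f e
byLast-inject₁ f x zero    = refl
byLast-inject₁ f x (suc e) = byLast-inject₁ (f ∘ suc) x e

byLast-fromℕ : ∀ {X : Set} {m} (f : Fin m → X) x → byLast f x (fromℕ m) ≡ x
byLast-fromℕ {m = zero}  f x = refl
byLast-fromℕ {m = suc m} f x = byLast-fromℕ (f ∘ suc) x

ToLast-cong : ∀ {m} {f g : Fin m → Fin (suc m)} → f ≗ g → ∀ {v} → SuccessorGraph.ToLast m f v → SuccessorGraph.ToLast m g v
ToLast-cong e SuccessorGraph.here = SuccessorGraph.here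
ToLast-cong {m} {f} {g} e (SuccessorGraph.via d r) =
  SuccessorGraph.via d (subst (SuccessorGraph.ToLast m g) (e d) (ToLast-cong e r))

tree-cong : ∀ {m} {f g : Fin m → Fin (suc m)} → f ≗ g → IsTree (SuccessorGraph.graph m f) → IsTree (SuccessorGraph.graph m g)
tree-cong {m} {f} {g} e tree =
  SuccessorGraph.toLast⇒tree m g λ v → ToLast-cong e (SuccessorGraph.tree⇒toLast m f tree v)

module Counting (k′ n′ : ℕ) (p : Vector ℕ (suc k′)) where
  private
    k n : ℕ
    k = suc k′
    n = suc n′

  Pieces : Setoid 0ℓ 0ℓ
  Pieces = CactusFactorizations.Pieces k′ n′ p

  ⨆𝓒≃Pieces : ⨆𝓒 n p ≃ Pieces
  ⨆𝓒≃Pieces = ⨆-cong λ t → ≃-sym (Factorizations.ColoredFactorizations≃𝓒 k′ n′)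

  -- A factor `Fin n` accompanies the chain: with the tours of the types it selects the arc leaving
  -- type k from which the tour starts, and with the cactus tours it selects the root hyperedge.
  ValidBiddings≃ : ValidBiddings n p ≃ ×-setoid (Permutations n) Pieces
  ValidBiddings≃ = ValidBiddings≃TypedTours
    ⨟ (≃-sym (Forests≃TypedTours (zero , zero)) ×-inverse Fin≃)
    ⨟ (≃-sym CactusTours≃Forests ×-inverse Fin≃)
    ⨟ ≃-sym (CactusFactorizations.LabelledFactorizations≃CactusTours k′ n′ p)
    where
    open ValidBiddingTours k′ n′ p
    Fin≃ : ≡-setoid (Fin n) ≃ ≡-setoid (Fin n)
    Fin≃ = HasSize-Fin

  TreeSamples : Setoid 0ℓ 0ℓ
  TreeSamples = Sub (Samples n p) TreeEvent

  -- What a bidding contains besides its sample: all of ω_k, and the other permutations without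
  -- their last values.
  Orders : Setoid 0ℓ 0ℓ
  Orders = ×-setoid (Permutations n) (≋-setoid (Permutations n′) k′)

  private
    end : Fin n
    end = n′ mod n

    emb : ∀ (e : Fin k′) → embed {k} e ≡ inject₁ e
    emb = SuccessorGraph.embed≡inject₁ k′ (λ _ → zero)

    insert-end : ∀ i j (ρ : Permutation′ n′) → insert i j ρ ⟨$⟩ʳ i ≡ j
    insert-end i j ρ with i Fin.≟ i
    ... | yes _   = refl
    ... | no  i≢i = contradiction refl i≢i

  to : Setoid.Carrier (ValidBiddings n p) → Setoid.Carrier (×-setoid TreeSamples Orders)
  to ((ω , M) , valid) = (((λ e → ω (embed e) ⟨$⟩ʳ end) , M) , valid) , (ω (fromℕ k′) , λ e → remove end (ω (embed e)))

  split : ∀ (ω ω′ : Fin k → Permutation′ n) → (∀ e → ω (embed e) ≈ₚ ω′ (embed e)) → ω (fromℕ k′) ≈ₚ ω′ (fromℕ k′) → ∀ t → ω t ≈ₚ ω′ t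
  split ω ω′ e f t with SuccessorGraph.cases k′ (λ _ → zero) t
  ... | inj₁ refl       = f
  ... | inj₂ (d , refl) = e d

  ValidBiddings≃TreeSamples : ValidBiddings n p ≃ ×-setoid TreeSamples Orders
  ValidBiddings≃TreeSamples = bijective⇒≃ {ValidBiddings n p} {×-setoid TreeSamples Orders} to
    (λ { {(ω , _) , _} {(ω′ , _) , _} (ω≈ , R≈) → ((λ e → ω≈ (embed e) end) , R≈)
      , (ω≈ (fromℕ k′) , λ e → proj₂ (Inverse.to-cong (Permutations-split {n′} end) {ω (embed e)} {ω′ (embed e)} (ω≈ (embed e)))) })
    (λ { {(ω , _) , _} {(ω′ , _) , _} ((i≈ , R≈) , (top≈ , rest≈)) →
      split ω ω′ (λ e → split-injective {ω (embed e)} {ω′ (embed e)} (i≈ e) (rest≈ e)) top≈ , R≈ })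
    surjective
    where
    split-injective : ∀ {π ρ : Permutation′ n} → π ⟨$⟩ʳ end ≡ ρ ⟨$⟩ʳ end → remove end π ≈ₚ remove end ρ → π ≈ₚ ρ
    split-injective {π} {ρ} e f j = trans (sym (Inverse.strictlyInverseʳ ends π j))
      (trans (Inverse.from-cong ends {_ , remove end π} {_ , remove end ρ} (e , f) j) (Inverse.strictlyInverseʳ ends ρ j))
      where
      ends : Permutations n ≃ ×-setoid (≡-setoid (Fin n)) (Permutations n′)
      ends = Permutations-split end
    surjective : ∀ y → ∃ λ x → Setoid._≈_ (×-setoid TreeSamples Orders) (to x) y
    surjective (((i , M) , tree) , (π , ρ)) =
      ((ω , M) , tree-cong (λ e → cong (λ h → α (embed e) (𝓜.tuple M h)) (sym (ω-end e))) tree)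
      , ((ω-end , λ _ → refl)
      , ((λ j → cong (λ σ → σ ⟨$⟩ʳ j) (byLast-fromℕ (λ e → insert end (i e) (ρ e)) π))
        , λ e j → trans (cong (λ σ → remove end σ ⟨$⟩ʳ j) (ω-embed e)) (remove-insert end (i e) (ρ e) j)))
      where
      ω : Fin k → Permutation′ n
      ω = byLast (λ e → insert end (i e) (ρ e)) π
      ω-embed : ∀ e → ω (embed e) ≡ insert end (i e) (ρ e)
      ω-embed e = trans (cong ω (emb e)) (byLast-inject₁ (λ e → insert end (i e) (ρ e)) π e)
      ω-end : ∀ e → ω (embed e) ⟨$⟩ʳ end ≡ i e
      ω-end e = trans (cong (λ σ → σ ⟨$⟩ʳ end) (ω-embed e)) (insert-end end (i e) (ρ e))

  Orders-size : Orders HasSize (n !) * (n′ !) ^ k′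
  Orders-size = HasSize-× (Permutations-size n) (HasSize-^ k′ (Permutations-size n′))

-- Samples with a first set of k-1 types, and trees for p_k = 0

∣true∷∣ : ∀ {m b} (A : Subset m) → b ≡ true → ∣ b ∷ A ∣ ≡ suc ∣ A ∣
∣true∷∣ A refl = refl

∣false∷∣ : ∀ {m b} (A : Subset m) → b ≡ false → ∣ b ∷ A ∣ ≡ ∣ A ∣
∣false∷∣ A refl = refl

lookup-true⇒∈ : ∀ {m} (A : Subset m) {t} → Vec.lookup A t ≡ true → t ∈ A
lookup-true⇒∈ A {t} e = Vec.lookup⇒[]= t A e

lookup-false⇒∉ : ∀ {m} (A : Subset m) {t} → Vec.lookup A t ≡ false → t ∉ A
lookup-false⇒∉ A e t∈ = contradiction (trans (sym e) (Vec.[]=⇒lookup t∈)) λ ()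

∣tabulate∣-punchIn : ∀ {m} (f : Fin (suc m) → Bool) i → f i ≡ true →
                     ∣ Vec.tabulate f ∣ ≡ suc ∣ Vec.tabulate (f ∘ punchIn i) ∣
∣tabulate∣-punchIn f zero e = ∣true∷∣ (Vec.tabulate (f ∘ suc)) e
∣tabulate∣-punchIn {suc m} f (suc i) e with f zero | ∣tabulate∣-punchIn (f ∘ suc) i e
... | true  | ih = cong suc ih
... | false | ih = ih

∣tabulate∣≡0⁺ : ∀ {m} (f : Fin m → Bool) → (∀ i → f i ≡ false) → ∣ Vec.tabulate f ∣ ≡ 0
∣tabulate∣≡0⁺ f e = bijection⇒∣∣ (Vec.tabulate f) (λ ()) (λ { {()} }) (λ ())
  λ {i} p → contradiction (trans (sym (e i)) (∈-tabulate⁻ f p)) λ ()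

∣tabulate∣≡0⁻ : ∀ {m} (f : Fin m → Bool) → ∣ Vec.tabulate f ∣ ≡ 0 → ∀ i → f i ≡ false
∣tabulate∣≡0⁻ f e i with f i in fi
... | false = refl
... | true with () ← subst Fin e (proj₁ (sel-surjective (Vec.tabulate f) (∈-tabulate⁺ f fi)))

except : ∀ {m} → Fin (suc m) → Subset (suc m)
except zero            = false ∷ ⊤
except {suc m} (suc t) = true ∷ except t

∣except∣ : ∀ {m} (t : Fin (suc m)) → ∣ except t ∣ ≡ m
∣except∣ {m} zero      = ∣⊤∣≡n m
∣except∣ {suc m} (suc t) = cong suc (∣except∣ t)

∣∣≡⇒except : ∀ {m} (A : Subset (suc m)) → ∣ A ∣ ≡ m → ∃ λ t → A ≡ except t
∣∣≡⇒except {m}     (false ∷ A) e = zero , cong (false ∷_) (∣p∣≡n⇒p≡⊤ e)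
∣∣≡⇒except {suc m} (true ∷ A)  e = let t , e′ = ∣∣≡⇒except A (ℕ.suc-injective e) in suc t , cong (true ∷_) e′

except-injective : ∀ {m} {t u : Fin (suc m)} → except t ≡ except u → t ≡ u
except-injective {m}     {zero}  {zero}  e = refl
except-injective {suc m} {suc t} {suc u} e = cong suc (except-injective (Vec.∷-injectiveʳ e))
except-injective {suc m} {zero}  {suc u} ()
except-injective {suc m} {suc t} {zero}  ()

lookup-except-≡ : ∀ {m} (t : Fin (suc m)) → Vec.lookup (except t) t ≡ false
lookup-except-≡ zero            = refl
lookup-except-≡ {suc m} (suc t) = lookup-except-≡ t

lookup-except-≢ : ∀ {m} (t u : Fin (suc m)) → u ≢ t → Vec.lookup (except t) u ≡ true
lookup-except-≢ zero            zero    ≢ = contradiction refl ≢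
lookup-except-≢ zero            (suc u) ≢ = Vec.lookup-replicate u true
lookup-except-≢ {suc m} (suc t) zero    ≢ = refl
lookup-except-≢ {suc m} (suc t) (suc u) ≢ = lookup-except-≢ t u (≢ ∘ cong suc)

-- If R₁ is [k] without t, then the other sets contain t as often as p_t
-- says, and each other type once less.
module FirstSubset (k′ n′ : ℕ) (p : Vector ℕ (suc k′)) (positive : ∀ t → 0 < p t) where
  private
    k n : ℕ
    k = suc k′
    n = suc n′

  -- The multiplicities are p + e_t minus one in each entry, as in the formula for the
  -- factorizations of type p + e_t.
  Rest : Fin k → Setoid 0ℓ 0ℓ
  Rest t = 𝓜s n′ (pred ∘ updateAt p t suc)

  private
    Source Target : Setoid 0ℓ 0ℓ
    Source = Sub (Samples n p) FirstSubsetEvent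
    Target = ×-setoid (≋-setoid (≡-setoid (Fin n)) k′) (⨆ Rest)

    rest-≡ : ∀ t → pred (updateAt p t suc t) ≡ p t
    rest-≡ t = cong pred (FVec.updateAt-updates t p)

    rest-≢ : ∀ {t u} → u ≢ t → suc (pred (updateAt p t suc u)) ≡ p u
    rest-≢ {t} {u} u≢t = trans (cong (λ x → suc (pred x)) (FVec.updateAt-minimal u t p u≢t)) (ℕ.suc-pred (p u) {{Data.Nat.>-nonZero (positive u)}})

    restrict : (M : 𝓜 n p) → ∀ t → 𝓜.tuple M zero ≡ except t → 𝓜 n′ (pred ∘ updateAt p t suc)
    restrict M t e = record { tuple = 𝓜.tuple M ∘ suc ; strict = 𝓜.strict M ∘ suc ; multiplicity = mult }
      where
      mult : ∀ u → ∣ Vec.tabulate (λ h → Vec.lookup (𝓜.tuple M (suc h)) u) ∣ ≡ pred (updateAt p t suc u)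
      mult u with u Fin.≟ t
      ... | yes refl = trans (sym (∣false∷∣ (column (𝓜.tuple M ∘ suc) u) (trans (cong (λ A → Vec.lookup A u) e) (lookup-except-≡ u))))
                         (trans (𝓜.multiplicity M u) (sym (rest-≡ u)))
      ... | no  u≢t  = ℕ.suc-injective (trans (sym (∣true∷∣ (column (𝓜.tuple M ∘ suc) u) (trans (cong (λ A → Vec.lookup A u) e) (lookup-except-≢ t u u≢t))))
                         (trans (𝓜.multiplicity M u) (sym (rest-≢ u≢t))))

    extend : ∀ t → 𝓜 n′ (pred ∘ updateAt p t suc) → 𝓜 n p
    extend t M = record
      { tuple = R
      ; strict = λ { zero → (λ _ → ∈⊤) , t , ∈⊤ , lookup-false⇒∉ (except t) (lookup-except-≡ t) ; (suc h) → 𝓜.strict M h }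
      ; multiplicity = mult }
      where
      R : Fin n → Subset k
      R zero    = except t
      R (suc h) = 𝓜.tuple M h
      mult : ∀ u → ∣ Vec.tabulate (λ h → Vec.lookup (R h) u) ∣ ≡ p u
      mult u with u Fin.≟ t
      ... | yes refl = trans (∣false∷∣ (column (𝓜.tuple M) u) (lookup-except-≡ u)) (trans (𝓜.multiplicity M u) (rest-≡ u))
      ... | no  u≢t  = trans (∣true∷∣ (column (𝓜.tuple M) u) (lookup-except-≢ t u u≢t)) (trans (cong suc (𝓜.multiplicity M u)) (rest-≢ u≢t))

    missing : (((_ , M) , _) : Setoid.Carrier Source) → ∃ λ t → 𝓜.tuple M zero ≡ except t
    missing ((i , M) , e) = ∣∣≡⇒except (𝓜.tuple M zero) e

    to : Setoid.Carrier Source → Setoid.Carrier Target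
    to x@((i , M) , e) = i , (proj₁ (missing x) , restrict M _ (proj₂ (missing x)))

    join : ∀ {t u} {M : 𝓜 n′ (pred ∘ updateAt p t suc)} {N : 𝓜 n′ (pred ∘ updateAt p u suc)} → t ≡ u →
           (∀ h → 𝓜.tuple M h ≡ 𝓜.tuple N h) → Setoid._≈_ (⨆ Rest) (t , M) (u , N)
    join refl e = same e

    unjoin : ∀ {x y} → Setoid._≈_ (⨆ Rest) x y → proj₁ x ≡ proj₁ y × (∀ h → 𝓜.tuple (proj₂ x) h ≡ 𝓜.tuple (proj₂ y) h)
    unjoin (same e) = refl , e

  FirstSubset≃ : Source ≃ Target
  FirstSubset≃ = bijective⇒≃ {Source} {Target} to
    (λ {x} {y} (i≈ , M≈) → i≈ , join (except-injective (trans (sym (proj₂ (missing x))) (trans (M≈ zero) (proj₂ (missing y))))) (M≈ ∘ suc))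
    (λ {x} {y} (i≈ , M≈) → i≈ , λ
      { zero    → trans (proj₂ (missing x)) (trans (cong except (proj₁ (unjoin M≈))) (sym (proj₂ (missing y))))
      ; (suc h) → proj₂ (unjoin M≈) h })
    λ (i , (t , M)) → let x = (i , extend t M) , ∣except∣ t in
      x , (λ _ → refl) , join (sym (except-injective (proj₂ (missing x)))) λ _ → refl

-- If k belongs to none of the sets, then α(t , R) < k unless t ∈ R, so that
-- the tree must consist of the edges {t , t-1}.
module MissingType (k′ n′ : ℕ) (p q : Vector ℕ (suc k′)) (p-top : p (fromℕ k′) ≡ 0) (q-top : q (fromℕ k′) ≡ 0)
                   (p-suc : ∀ e → p (inject₁ e) ≡ suc (q (inject₁ e))) where
  private
    k n : ℕ
    k = suc k′
    n = suc n′
    top : Fin k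
    top = fromℕ k′
  open Cyclic k′

  private
    emb : ∀ (e : Fin k′) → embed {k} e ≡ inject₁ e
    emb = SuccessorGraph.embed≡inject₁ k′ (λ _ → zero)

    toℕ-emb : ∀ (e : Fin k′) → toℕ (embed {k} e) ≡ toℕ e
    toℕ-emb e = trans (cong toℕ (emb e)) (Fin.toℕ-inject₁ e)

    toℕ-predecessor : ∀ {t : Fin k} {x} → toℕ t ≡ suc x → toℕ (predecessor t) ≡ x
    toℕ-predecessor {t} {x} e = trans (toℕ-⊕ t k′) (trans (cong (λ y → (y + k′) % k) e)
      (trans (cong (_% k) (sym (ℕ.+-suc x k′))) (trans (ℕ.[m+n]%n≡m%n x k) (ℕ.m<n⇒m%n≡m x<k))))
      where
      x<k : x < k
      x<k = ℕ.<-trans (subst (x <_) (sym e) ℕ.≤-refl) (Fin.toℕ<n t)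

    toℕ-⊕-< : ∀ (t : Fin k) r → toℕ t + r < k → toℕ (t ⊕ r) ≡ toℕ t + r
    toℕ-⊕-< t r lt = trans (toℕ-⊕ t r) (ℕ.m<n⇒m%n≡m lt)

    -- The run above t stops before `top`, which is not in A, so that α does not wrap around.
    stays : ∀ {t A} → t ∉ A → top ∉ A → toℕ t < k′ → toℕ t ≤ toℕ (α t A) × toℕ (α t A) < k′
    stays {t} {A} t∉ top∉ t<k′ with r , inside-run , _ , e ← α-∉ t∉ =
      subst (λ u → toℕ t ≤ toℕ u × toℕ u < k′) (sym e)
        (subst (λ x → toℕ t ≤ x × x < k′) (sym (toℕ-⊕-< t r (ℕ.m<n⇒m<1+n t+r<k′))) (ℕ.m≤m+n (toℕ t) r , t+r<k′))
      where
      d : ℕ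
      d = k′ ∸ toℕ t
      t+d : toℕ t + d ≡ k′
      t+d = ℕ.m+[n∸m]≡n (ℕ.<⇒≤ t<k′)
      t⊕d : t ⊕ d ≡ top
      t⊕d = Fin.toℕ-injective (trans (toℕ-⊕-< t d (subst (_< k) (sym t+d) (ℕ.n<1+n k′))) (trans t+d (sym (Fin.toℕ-fromℕ k′))))
      r<d : r < d
      r<d = ℕ.≰⇒> λ d≤r → top∉ (subst (_∈ A) t⊕d (inside-run d (ℕ.m<n⇒0<n∸m t<k′) d≤r))
      t+r<k′ : toℕ t + r < k′
      t+r<k′ = subst (toℕ t + r <_) t+d (ℕ.+-monoʳ-< (toℕ t) r<d)

  module _ (i : Fin k′ → Fin n) (R : Fin n → Subset k) where
    private
      f : Fin k′ → Fin k
      f e = α (embed e) (R (i e))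
    open SuccessorGraph k′ f

    forced⇒tree : (∀ e → embed e ∈ R (i e)) → IsTree graph
    forced⇒tree forced = toLast⇒tree λ v → go (toℕ v) v refl
      where
      go : ∀ x v → toℕ v ≡ x → ToLast v
      go x v e with cases v
      ... | inj₁ refl = here
      -- The first type is followed by `top`, since its predecessor wraps around.
      go zero v e | inj₂ (d , refl) = via d (subst ToLast (sym (trans (α-∈ (forced d))
        (Fin.toℕ-injective (trans (toℕ-⊕ (embed d) k′) (trans (cong (λ y → (y + k′) % k) e)
          (trans (ℕ.m<n⇒m%n≡m (ℕ.n<1+n k′)) (sym (Fin.toℕ-fromℕ k′)))))))) here)
      go (suc x) v e | inj₂ (d , refl) = via d (go x (f d) (trans (cong toℕ (α-∈ (forced d))) (toℕ-predecessor e)))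

    -- Induction from the largest e downwards. If e were not in its set, then its successors would
    -- never leave the types from e on that are below `top`: larger ones only go down by one, by
    -- induction, and from e itself α does not go down.
    tree⇒forced : (∀ h → top ∉ R h) → IsTree graph → ∀ e → embed e ∈ R (i e)
    tree⇒forced top∉ tree e = go k′ e (ℕ.m≤m+n k′ (toℕ e))
      where
      go : ∀ d e → k′ ≤ d + toℕ e → embed e ∈ R (i e)
      go zero    e le = contradiction (Fin.toℕ<n e) (ℕ.≤⇒≯ le)
      go (suc d) e le = decidable-stable (embed e ∈? R (i e)) λ e∉ →
        let e≤ , <k′ = stays e∉ (top∉ (i e)) (subst (_< k′) (sym (toℕ-emb e)) (Fin.toℕ<n e))
        in stuck e∉ (tree⇒toLast tree (f e)) (subst (_≤ toℕ (f e)) (toℕ-emb e) e≤) <k′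
        where
        stuck : embed e ∉ R (i e) → ∀ {v} → ToLast v → toℕ e ≤ toℕ v → toℕ v < k′ → ⊥
        stuck e∉ here      _  v<k′ = ℕ.<-irrefl (Fin.toℕ-fromℕ k′) v<k′
        stuck e∉ (via g r) e≤ v<k′ with ℕ.m≤n⇒m<n∨m≡n (subst (toℕ e ≤_) (toℕ-emb g) e≤)
        ... | inj₂ e≡g with refl ← Fin.toℕ-injective e≡g =
          let e≤′ , <k′ = stays e∉ (top∉ (i e)) v<k′ in stuck e∉ r (ℕ.≤-trans e≤ e≤′) <k′
        ... | inj₁ e<g = stuck e∉ r (subst (toℕ e ≤_) (sym lower) (ℕ.<⇒≤pred e<g))
                (subst (_< k′) (sym lower) (ℕ.≤-<-trans ℕ.pred[n]≤n (Fin.toℕ<n g)))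
          where
          g∈ : embed g ∈ R (i g)
          g∈ = go d g (ℕ.≤-trans le (subst (_≤ d + toℕ g) (ℕ.+-suc d (toℕ e)) (ℕ.+-monoʳ-≤ d e<g)))
          lower : toℕ (f g) ≡ pred (toℕ g)
          lower = trans (cong toℕ (α-∈ g∈)) (toℕ-predecessor (trans (toℕ-emb g)
            (sym (ℕ.suc-pred (toℕ g) {{Data.Nat.>-nonZero (ℕ.≤-<-trans z≤n e<g)}}))))

  private
    Source Target : Setoid 0ℓ 0ℓ
    Source = Sub (Samples n p) TreeEvent
    Target = ×-setoid (≋-setoid (≡-setoid (Fin n)) k′) (𝓜s n′ q)

    bit : ∀ {m} {r : Vector ℕ k} → 𝓜 m r → Fin m → Fin k → Bool
    bit M h t = Vec.lookup (𝓜.tuple M h) t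

    top-bit : ∀ {m} {r : Vector ℕ k} (M : 𝓜 m r) → r top ≡ 0 → ∀ h → bit M h top ≡ false
    top-bit M r≡0 = ∣tabulate∣≡0⁻ (λ h → bit M h top) (trans (𝓜.multiplicity M top) r≡0)

    own-bit : ∀ (i : Fin k′ → Fin n) (M : 𝓜 n p) → TreeEvent {k} {n} {p} (i , M) → ∀ e → bit M (i e) (inject₁ e) ≡ true
    own-bit i M tree e = Vec.[]=⇒lookup (subst (_∈ 𝓜.tuple M (i e)) (emb e)
      (tree⇒forced i (𝓜.tuple M) (λ h → lookup-false⇒∉ (𝓜.tuple M h) (top-bit M p-top h)) tree e))

    by-type : (P : Fin k → Set) → P top → (∀ e → P (inject₁ e)) → ∀ t → P t
    by-type P x y t with SuccessorGraph.last-or-embed k′ (λ _ → zero) t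
    ... | inj₁ refl       = x
    ... | inj₂ (e , refl) = y e

    fill : ∀ {m} → (Fin m → Fin k′ → Bool) → Fin m → Subset k
    fill b h = Vec.tabulate (byLast (b h) false)

    fill-top : ∀ {m} (b : Fin m → Fin k′ → Bool) h → Vec.lookup (fill b h) top ≡ false
    fill-top b h = trans (Vec.lookup∘tabulate (byLast (b h) false) top) (byLast-fromℕ (b h) false)

    fill-inject₁ : ∀ {m} (b : Fin m → Fin k′ → Bool) h e → Vec.lookup (fill b h) (inject₁ e) ≡ b h e
    fill-inject₁ b h e = trans (Vec.lookup∘tabulate (byLast (b h) false) (inject₁ e)) (byLast-inject₁ (b h) false e)

    filled : ∀ {m} {r : Vector ℕ k} (b : Fin m → Fin k′ → Bool) → r top ≡ 0 →
             (∀ e → ∣ Vec.tabulate (λ h → b h e) ∣ ≡ r (inject₁ e)) → 𝓜 m r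
    filled {r = r} b r≡0 counts = record
      { tuple = fill b
      ; strict = λ h → (λ _ → ∈⊤) , top , ∈⊤ , lookup-false⇒∉ (fill b h) (fill-top b h)
      ; multiplicity = by-type (λ t → ∣ Vec.tabulate (λ h → Vec.lookup (fill b h) t) ∣ ≡ r t)
          (trans (∣tabulate∣≡0⁺ _ (fill-top b)) (sym r≡0))
          (λ e → trans (cong ∣_∣ (Vec.tabulate-cong λ h → fill-inject₁ b h e)) (counts e)) }

    ext : ∀ {A B : Subset k} → Vec.lookup A top ≡ Vec.lookup B top → (∀ e → Vec.lookup A (inject₁ e) ≡ Vec.lookup B (inject₁ e)) → A ≡ B
    ext {A} {B} x y = Vec-ext (by-type (λ t → Vec.lookup A t ≡ Vec.lookup B t) x y)

    -- Column e loses its entry at the index i_e, which is `true` by `own-bit`, and each column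
    -- closes up on its own. The columns can be treated independently because sets without type k
    -- are strict.
    others : (Fin k′ → Fin n) → 𝓜 n p → Fin n′ → Fin k′ → Bool
    others i M h e = bit M (punchIn (i e) h) (inject₁ e)

    to : Setoid.Carrier Source → Setoid.Carrier Target
    to ((i , M) , tree) = i , filled (others i M) q-top λ e → ℕ.suc-injective
      (trans (sym (∣tabulate∣-punchIn (λ h → bit M h (inject₁ e)) (i e) (own-bit i M tree e)))
        (trans (𝓜.multiplicity M (inject₁ e)) (p-suc e)))

    entry : ∀ (x h : Fin n) → (Fin n′ → Bool) → Bool
    entry x h b with x Fin.≟ h
    ... | yes _  = true
    ... | no x≢h = b (punchOut x≢h)

    entry-≡ : ∀ x b → entry x x b ≡ true
    entry-≡ x b with x Fin.≟ x
    ... | yes _   = refl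
    ... | no  x≢x = contradiction refl x≢x

    entry-punchIn : ∀ x h b → entry x (punchIn x h) b ≡ b h
    entry-punchIn x h b with x Fin.≟ punchIn x h
    ... | yes e   = contradiction (sym e) (Fin.punchInᵢ≢i x h)
    ... | no  x≢h = cong b (trans (Fin.punchOut-cong x refl) (Fin.punchOut-punchIn x))

    surjective : ∀ y → ∃ λ x → Setoid._≈_ Target (to x) y
    surjective (i , M) = ((i , N) , forced⇒tree i (𝓜.tuple N) forced) , (λ _ → refl)
        , λ h → ext (trans (fill-top (others i N) h) (sym (top-bit M q-top h)))
            λ e → trans (fill-inject₁ (others i N) h e)
              (trans (fill-inject₁ b (punchIn (i e) h) e) (entry-punchIn (i e) h (λ h → bit M h (inject₁ e))))
      where
      b : Fin n → Fin k′ → Bool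
      b h e = entry (i e) h (λ h → bit M h (inject₁ e))
      N : 𝓜 n p
      N = filled b p-top λ e → trans (∣tabulate∣-punchIn (λ h → b h e) (i e) (entry-≡ (i e) _))
        (trans (cong suc (trans (cong ∣_∣ (Vec.tabulate-cong λ h → entry-punchIn (i e) h _)) (𝓜.multiplicity M (inject₁ e))))
          (sym (p-suc e)))
      forced : ∀ e → embed e ∈ 𝓜.tuple N (i e)
      forced e = subst (_∈ 𝓜.tuple N (i e)) (sym (emb e))
        (lookup-true⇒∈ (𝓜.tuple N (i e)) (trans (fill-inject₁ b (i e) e) (entry-≡ (i e) _)))

    injective : ∀ {x y} → Setoid._≈_ Target (to x) (to y) → Setoid._≈_ Source x y
    injective {(i , M) , tree} {(j , N) , tree′} (i≈ , M≈) = i≈ , λ h →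
      ext (trans (top-bit M p-top h) (sym (top-bit N p-top h))) (λ e → bits h e)
      where
      bits : ∀ h e → bit M h (inject₁ e) ≡ bit N h (inject₁ e)
      bits h e with i e Fin.≟ h
      ... | yes refl = trans (own-bit i M tree e) (sym (trans (cong (λ x → bit N x (inject₁ e)) (i≈ e)) (own-bit j N tree′ e)))
      ... | no  i≢h  = subst (λ h → bit M h (inject₁ e) ≡ bit N h (inject₁ e)) (Fin.punchIn-punchOut i≢h)
        (trans (sym (fill-inject₁ (others i M) g e)) (trans (cong (λ A → Vec.lookup A (inject₁ e)) (M≈ g))
          (trans (fill-inject₁ (others j N) g e) (cong (λ x → bit N (punchIn x g) (inject₁ e)) (sym (i≈ e))))))
        where
        g : Fin n′
        g = punchOut i≢h

  MissingType≃ : Source ≃ Target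
  MissingType≃ = bijective⇒≃ {Source} {Target} to
    (λ { {(i , M) , _} {(j , N) , _} (i≈ , M≈) → i≈ , λ h → ext (trans (fill-top (others i M) h) (sym (fill-top (others j N) h)))
      λ e → trans (fill-inject₁ (others i M) h e) (trans (cong (λ A → Vec.lookup A (inject₁ e)) (M≈ (punchIn (i e) h)))
        (trans (cong (λ x → bit N (punchIn x h) (inject₁ e)) (i≈ e)) (sym (fill-inject₁ (others j N) h e)))) })
    (λ {x} {y} → injective {x} {y}) surjective

-- The equivalence

sum-zero : ∀ {m} (f : Vector ℕ m) → (∀ t → f t ≡ 0) → sum f ≡ 0
sum-zero {zero}  f e = refl
sum-zero {suc m} f e = cong₂ _+_ (e zero) (sum-zero (f ∘ suc) (e ∘ suc))

sum-single : ∀ {m} (f : Vector ℕ m) i → (∀ t → t ≢ i → f t ≡ 0) → sum f ≡ f i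
sum-single f zero    e = trans (cong (f zero +_) (sum-zero (f ∘ suc) λ t → e (suc t) λ ())) (ℕ.+-identityʳ _)
sum-single f (suc i) e = cong₂ _+_ (e zero λ ()) (sum-single (f ∘ suc) i λ t t≢i → e (suc t) (t≢i ∘ Fin.suc-injective))

sum-cancel : ∀ {m} (f g : Vector ℕ m) i → sum f ≡ sum g → (∀ t → t ≢ i → f t ≡ g t) → f i ≡ g i
sum-cancel f g zero    s e = ℕ.+-cancelʳ-≡ (sum (g ∘ suc)) _ _
  (trans (cong (f zero +_) (sym (sum-cong-≗ λ t → e (suc t) λ ()))) s)
sum-cancel f g (suc i) s e = sum-cancel (f ∘ suc) (g ∘ suc) i
  (ℕ.+-cancelˡ-≡ (g zero) _ _ (trans (cong (_+ sum (f ∘ suc)) (sym (e zero λ ()))) s))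
  λ t t≢i → e (suc t) (t≢i ∘ Fin.suc-injective)

Probability-numerators : ∀ {S E F q f g t} → Probability S E q → Probability S F q → Sub S E HasSize f → Sub S F HasSize g →
                         S HasSize t → f ≡ g
Probability-numerators {S} {E} {F} {q} {f} {g} {t} P Q i j s = begin
  f             ≡⟨ HasSize-unique i P.favourable-size ⟩
  P.favourable  ≡⟨ ℕ.*-cancelʳ-≡ _ _ P.total (trans (cong (P.favourable *_) (HasSize-unique P.total-size Q.total-size))
                     (ℚ.normalize-injective-≃ P.favourable Q.favourable P.total Q.total (trans (sym P.ratio) Q.ratio))) ⟩
  Q.favourable  ≡⟨ HasSize-unique Q.favourable-size j ⟩
  g             ∎
  where
  open ≡-Reasoning
  module P = Probability P
  module Q = Probability Q

module Equivalence (k′ n′ : ℕ) where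
  private
    k n : ℕ
    k = suc k′
    n = suc n′
    top : Fin k
    top = fromℕ k′

  infixl 6 _+e_

  _+e_ : Vector ℕ k → Fin k → Vector ℕ k
  p +e t = updateAt p t suc

  Positive : Vector ℕ k → Set
  Positive p = ∀ t → 0 < p t

  factorizations : Vector ℕ k → ℕ
  factorizations q = proj₁ (Finite-ColoredFactorizations n q)

  factorizations-size : ∀ q → ColoredFactorizations n q HasSize factorizations q
  factorizations-size q = proj₂ (Finite-ColoredFactorizations n q)

  M : Vector ℕ k → ℕ
  M q = proj₁ (Finite-𝓜s n′ q)

  M-size : ∀ q → 𝓜s n′ q HasSize M q
  M-size q = proj₂ (Finite-𝓜s n′ q)

  -- The right hand side of (a).
  formula : Vector ℕ k → ℕ
  formula q = (n !) ^ k′ * M (pred ∘ q)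

  module _ (p : Vector ℕ k) where
    open Counting k′ n′ p

    cacti : ℕ
    cacti = sum λ t → factorizations (p +e t)

    Pieces-size : Pieces HasSize cacti
    Pieces-size = HasSize-⨆ _ λ t → factorizations-size (p +e t)

    ⨆𝓒-size : ⨆𝓒 n p HasSize cacti
    ⨆𝓒-size = ⨆𝓒≃Pieces ⨟ Pieces-size

    ValidBiddings-size : ValidBiddings n p HasSize n ! * cacti
    ValidBiddings-size = ValidBiddings≃ ⨟ HasSize-× (Permutations-size n) Pieces-size

    opaque
      -- The samples with trees are a factor of the valid biddings, which are already counted; so
      -- there is no need to decide whether a graph is a tree.
      trees-finite : Finite TreeSamples
      trees-finite = Finite-factor {TreeSamples} {Orders} (_ , (≃-sym ValidBiddings≃TreeSamples ⨟ ValidBiddings-size))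
        Orders-size (idₚ , λ _ → idₚ)

    trees : ℕ
    trees = proj₁ trees-finite

    -- Counts the valid biddings in two ways. The factor n! for the labellings of the cacti cancels
    -- against the one for ω_k.
    cacti≡trees : cacti ≡ trees * (n′ !) ^ k′
    cacti≡trees = ℕ.*-cancelˡ-≡ _ _ (n !) {{ℕ._!≢0 n}} (begin
      n ! * cacti                      ≡⟨ HasSize-unique ValidBiddings-size
                                            (ValidBiddings≃TreeSamples ⨟ HasSize-× (proj₂ trees-finite) Orders-size) ⟩
      trees * (n ! * (n′ !) ^ k′)      ≡⟨ swap-left trees (n !) _ ⟩
      n ! * (trees * (n′ !) ^ k′)      ∎)
      where
      open ≡-Reasoning
      swap-left : ∀ a b c → a * (b * c) ≡ b * (a * c)
      swap-left = ℕSolver.solve-∀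

    first : ℕ
    first = n ^ k′ * sum λ t → M (pred ∘ (p +e t))

    first-size : Positive p → Sub (Samples n p) FirstSubsetEvent HasSize first
    first-size positive = FirstSubset.FirstSubset≃ k′ n′ p positive
      ⨟ HasSize-× (HasSize-^ k′ HasSize-Fin) (HasSize-⨆ _ λ t → M-size (pred ∘ (p +e t)))

    opaque
      Samples-finite : Finite (Samples n p)
      Samples-finite = _ , HasSize-× (HasSize-^ k′ HasSize-Fin) (proj₂ (Finite-𝓜s n p))

  ^-! : (n !) ^ k′ ≡ n ^ k′ * (n′ !) ^ k′
  ^-! = ^-distrib k′
    where
    ^-distrib : ∀ m → (n * n′ !) ^ m ≡ n ^ m * (n′ !) ^ m
    ^-distrib zero    = refl
    ^-distrib (suc m) = trans (cong (n * n′ ! *_) (^-distrib m)) (interchange n (n′ !) (n ^ m) ((n′ !) ^ m))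
      where
      interchange : ∀ a b c d → a * b * (c * d) ≡ a * c * (b * d)
      interchange = ℕSolver.solve-∀

  -- The counterpart of `cacti≡trees`, with the formula in place of the numbers of factorizations
  -- and the first subset event in place of the trees.
  formulas≡first : ∀ p → sum (λ t → formula (p +e t)) ≡ first p * (n′ !) ^ k′
  formulas≡first p = begin
    sum (λ t → (n !) ^ k′ * M (pred ∘ (p +e t)))     ≡⟨ sym (*-distribˡ-sum ((n !) ^ k′) (λ t → M (pred ∘ (p +e t)))) ⟩
    (n !) ^ k′ * s                                   ≡⟨ cong (_* s) ^-! ⟩
    n ^ k′ * (n′ !) ^ k′ * s                         ≡⟨ swap-right (n ^ k′) _ s ⟩
    n ^ k′ * s * (n′ !) ^ k′                         ∎
    where
    open ≡-Reasoning
    s : ℕ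
    s = sum λ t → M (pred ∘ (p +e t))
    swap-right : ∀ a b c → a * b * c ≡ a * c * b
    swap-right = ℕSolver.solve-∀

  +e-≡ : ∀ p t → (p +e t) t ≡ suc (p t)
  +e-≡ p t = FVec.updateAt-updates t p

  +e-≢ : ∀ p {t u} → u ≢ t → (p +e t) u ≡ p u
  +e-≢ p {t} {u} u≢t = FVec.updateAt-minimal u t p u≢t

  +e-positive : ∀ p → Positive p → ∀ t → Positive (p +e t)
  +e-positive p positive t u with u Fin.≟ t
  ... | yes refl = subst (0 <_) (sym (+e-≡ p t)) z<s
  ... | no  u≢t  = subst (0 <_) (sym (+e-≢ p u≢t)) (positive u)

  factorizations-cong : ∀ {q q′} → q ≗ q′ → factorizations q ≡ factorizations q′
  factorizations-cong {q} {q′} e = HasSize-unique (factorizations-size q)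
    (ColoredFactorizations-cong n e ⨟ factorizations-size q′)

  M-cong : ∀ {q q′} → q ≗ q′ → M q ≡ M q′
  M-cong {q} {q′} e = HasSize-unique (M-size q) (𝓜s-cong n′ e ⨟ M-size q′)

  FactorizationFormula : Set
  FactorizationFormula = (p : Vector ℕ k) → Positive p →
    ∃[ m ] (𝓜s n′ (pred ∘ p) HasSize m) × (ColoredFactorizations n p HasSize ((n !) ^ k′) * m)

  TreeProbability : Set
  TreeProbability = (p : Vector ℕ k) → Positive p → 𝓜 n p →
    ∃[ q ] Probability (Samples n p) TreeEvent q × Probability (Samples n p) FirstSubsetEvent q

  formula⇒probability : FactorizationFormula → TreeProbability
  formula⇒probability a p positive sample = _ , probability (proj₂ (trees-finite p)) , probability
      (subst (Sub (Samples n p) FirstSubsetEvent HasSize_) (sym trees≡first) (first-size p positive))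
    where
    total-nonZero : NonZero (proj₁ (Samples-finite p))
    total-nonZero = inhabited⇒NonZero (proj₂ (Samples-finite p)) ((λ _ → zero) , sample)
    probability : ∀ {E f} → Sub (Samples n p) E HasSize f →
                  Probability (Samples n p) E (ℚ._/_ (ℤ.+ f) (proj₁ (Samples-finite p)) {{total-nonZero}})
    probability i = record
      { total-nonZero = total-nonZero ; favourable-size = i ; total-size = proj₂ (Samples-finite p) ; ratio = refl }
    formula-holds : ∀ t → factorizations (p +e t) ≡ formula (p +e t)
    formula-holds t with m , i , j ← a (p +e t) (+e-positive p positive t) =
      trans (HasSize-unique (factorizations-size (p +e t)) j) (cong ((n !) ^ k′ *_) (HasSize-unique i (M-size _)))
    trees≡first : trees p ≡ first p
    trees≡first = ℕ.*-cancelʳ-≡ _ _ ((n′ !) ^ k′) {{ℕ.m^n≢0 (n′ !) k′ {{ℕ._!≢0 n′}}}}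
      (trans (sym (cacti≡trees p)) (trans (sum-cong-≗ formula-holds) (formulas≡first p)))

  probability⇒trees≡first : TreeProbability → ∀ p → Positive p → trees p ≡ first p
  probability⇒trees≡first b p positive with proj₁ (Finite-𝓜s n p) in e
  -- Without any sample there is no probability to compare, but then both events are empty.
  ... | zero = trans (empty⇒HasSize0 (proj₂ (trees-finite p)) λ (x , _) → none x)
                 (sym (empty⇒HasSize0 (first-size p positive) λ (x , _) → none x))
    where
    none : ¬ Setoid.Carrier (Samples n p)
    none (_ , sample) with () ← subst Fin e (Inverse.to (proj₂ (Finite-𝓜s n p)) sample)
  ... | suc _ =
    let _ , P , Q = b p positive (Inverse.from (proj₂ (Finite-𝓜s n p)) (subst Fin (sym e) zero))
    in Probability-numerators P Q (proj₂ (trees-finite p)) (first-size p positive) (proj₂ (Samples-finite p))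

  -- The induction on q_k determines the number of factorizations from the
  -- sums over t of those of type p + e_t.  For q_k = 1 only the term t = k
  -- survives if p_k = 0.
  module _ (sums : ∀ p → Positive p → sum (λ t → factorizations (p +e t)) ≡ sum (λ t → formula (p +e t))) where
    private
      lower : Vector ℕ k → Vector ℕ k
      lower q = updateAt q top pred

      lower-top : ∀ {q m} → q top ≡ suc m → lower q top ≡ m
      lower-top {q} e = trans (FVec.updateAt-updates top q) (cong pred e)

      lower-≢ : ∀ q {t} → t ≢ top → lower q t ≡ q t
      lower-≢ q {t} t≢ = FVec.updateAt-minimal t top q t≢

      lower+e : ∀ {q m} → q top ≡ suc m → lower q +e top ≗ q
      lower+e {q} e t with t Fin.≟ top
      ... | yes refl = trans (+e-≡ (lower q) top) (trans (cong suc (lower-top {q} e)) (sym e))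
      ... | no  t≢   = trans (+e-≢ (lower q) t≢) (lower-≢ q t≢)

      uncolorable : ∀ p t → p top ≡ 0 → t ≢ top → factorizations (p +e t) ≡ 0
      uncolorable p t p-top t≢ = empty⇒HasSize0 (factorizations-size (p +e t)) λ F →
        case (subst Fin (trans (+e-≢ p (t≢ ∘ sym)) p-top) (ColoredFactorization.φ F top zero))
        where
        case : Fin 0 → ⊥
        case ()

      base-case : ∀ q → Positive q → q top ≡ 1 → factorizations q ≡ formula q
      base-case q positive e = begin
        factorizations q                        ≡⟨ factorizations-cong (λ t → sym (lower+e {q} e t)) ⟩
        factorizations (p +e top)               ≡⟨ sym (sum-single _ top λ t → uncolorable p t p-top) ⟩
        cacti p                                 ≡⟨ cacti≡trees p ⟩
        trees p * (n′ !) ^ k′                   ≡⟨ cong (_* (n′ !) ^ k′) (HasSize-unique (proj₂ (trees-finite p))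
                                                     (MissingType.MissingType≃ k′ n′ p (pred ∘ q) p-top (cong pred e) p-suc
                                                       ⨟ HasSize-× (HasSize-^ k′ HasSize-Fin) (M-size (pred ∘ q)))) ⟩
        n ^ k′ * M (pred ∘ q) * (n′ !) ^ k′     ≡⟨ swap-right (n ^ k′) _ _ ⟩
        n ^ k′ * (n′ !) ^ k′ * M (pred ∘ q)     ≡⟨ cong (_* M (pred ∘ q)) (sym ^-!) ⟩
        formula q                               ∎
        where
        open ≡-Reasoning
        p : Vector ℕ k
        p = lower q
        p-top : p top ≡ 0
        p-top = lower-top {q} e
        p-suc : ∀ d → p (inject₁ d) ≡ suc (pred (q (inject₁ d)))
        p-suc d = trans (lower-≢ q (Fin.fromℕ≢inject₁ ∘ sym))
          (sym (ℕ.suc-pred (q (inject₁ d)) {{Data.Nat.>-nonZero (positive (inject₁ d))}}))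
        swap-right : ∀ a b c → a * b * c ≡ a * c * b
        swap-right = ℕSolver.solve-∀

      induction : ∀ m q → Positive q → q top ≡ suc m → factorizations q ≡ formula q
      induction zero    q positive e = base-case q positive e
      induction (suc m) q positive e = begin
        factorizations q            ≡⟨ factorizations-cong (λ t → sym (lower+e {q} e t)) ⟩
        -- For t ≠ k the last entry of p + e_t is q_k - 1, so that induction applies to these terms
        -- and only the term t = k remains.
        factorizations (p +e top)   ≡⟨ sum-cancel _ _ top (sums p p-positive) (λ t t≢ →
                                         induction m (p +e t) (+e-positive p p-positive t)
                                           (trans (+e-≢ p (t≢ ∘ sym)) (lower-top {q} e))) ⟩
        formula (p +e top)          ≡⟨ cong ((n !) ^ k′ *_) (M-cong λ t → cong pred (lower+e {q} e t)) ⟩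
        formula q                   ∎
        where
        open ≡-Reasoning
        p : Vector ℕ k
        p = lower q
        p-positive : Positive p
        p-positive t with t Fin.≟ top
        ... | yes refl = subst (0 <_) (sym (lower-top {q} e)) z<s
        ... | no  t≢   = subst (0 <_) (sym (lower-≢ q t≢)) (positive t)

    sums-determine : ∀ q → Positive q → factorizations q ≡ formula q
    sums-determine q positive = induction (pred (q top)) q positive
      (sym (ℕ.suc-pred (q top) {{Data.Nat.>-nonZero (positive top)}}))

  probability⇒formula : TreeProbability → FactorizationFormula
  probability⇒formula b q positive = M (pred ∘ q) , M-size (pred ∘ q)
    , subst (ColoredFactorizations n q HasSize_) (sums-determine sums q positive) (factorizations-size q)
    where
    sums : ∀ p → Positive p → sum (λ t → factorizations (p +e t)) ≡ sum (λ t → formula (p +e t))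
    sums p positive = trans (cacti≡trees p)
      (trans (cong (_* (n′ !) ^ k′) (probability⇒trees≡first b p positive)) (sym (formulas≡first p)))

corollary6p3 : (k : ℕ) → .{{_ : NonZero k}} → 2 ≤ k →
    ((n : ℕ) → .{{_ : NonZero n}} → (p : Vector ℕ k) → (∀ t → 0 < p t) →
    ∃[ c ] (⨆𝓒 n p HasSize c) × (ValidBiddings n p HasSize (n !) * c))
    ×
    (
    ((n : ℕ) → .{{_ : NonZero n}} → (p : Vector ℕ k) → (∀ t → 0 < p t) →
    ∃[ M ] (𝓜s (pred n) (pred ∘ p) HasSize M)
    × (ColoredFactorizations n p HasSize ((n !) ^ (pred k)) * M))
    ⇔
    ((n : ℕ) → .{{_ : NonZero n}} → (p : Vector ℕ k) → (∀ t → 0 < p t) → 𝓜 n p →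
    ∃[ q ] Probability (Samples n p) TreeEvent q
    × Probability (Samples n p) FirstSubsetEvent q)
    )
corollary6p3 (suc k′) _ = biddings , mk⇔
  (λ a → λ { zero {{0≢0}} → ⊥-elim-irr (NonZero.nonZero 0≢0) ; (suc n′) → Equivalence.formula⇒probability k′ n′ (a (suc n′)) })
  (λ b → λ { zero {{0≢0}} → ⊥-elim-irr (NonZero.nonZero 0≢0) ; (suc n′) → Equivalence.probability⇒formula k′ n′ (b (suc n′)) })
  where
  biddings : ∀ n → .{{_ : NonZero n}} → (p : Vector ℕ (suc k′)) → (∀ t → 0 < p t) →
             ∃[ c ] (⨆𝓒 n p HasSize c) × (ValidBiddings n p HasSize (n !) * c)
  biddings zero {{0≢0}} = ⊥-elim-irr (NonZero.nonZero 0≢0)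
  biddings (suc n′) p _ = Equivalence.cacti k′ n′ p , Equivalence.⨆𝓒-size k′ n′ p , Equivalence.ValidBiddings-size k′ n′ p
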